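{- Let $h\in\mathbb{Z}$ with $3\nmid h$ be such that $p=h^2+3h+9$ is a prime number, let $s\in\mathbb{R}$, $s\neq0$, and let $\rho(h,s,x)=x^3+hsx^2-(h+3)s^2x+s^3$. Put $$\theta_1(h,s,x)=\frac{x}{s}+\frac{h-1}{3},\qquad \theta_2(h,s,x)=-\frac{x}{s}-\frac{h+1}{3},$$ $$\gamma_1(h,s,x)=-\frac13 s(h-1-3x),\qquad \gamma_2(h,s,x)=-\frac13 s(h+1+3x).$$ Then the zeros of $\rho(h,s,x)$ are $$\gamma_1(h,s,\eta_p^{(k)}),\ k=0,1,2,\quad\text{if } h\equiv1\pmod 3,$$ $$\gamma_2(h,s,\eta_p^{(k)}),\ k=0,1,2,\quad\text{if } h\equiv2\pmod 3,$$ where $\eta_p^{(0)},\eta_p^{(1)},\eta_p^{(2)}$ are the cubic Gaussian periods of $p$. Therefore $$\rho(h,s,x)=s^3\,G_1(h,\theta_1(h,s,x))\quad\text{if } h\equiv1\pmod3,$$ $$\rho(h,s,x)=-s^3\,G_2(h,\theta_2(h,s,x))\quad\text{if } h\equiv2\pmod3,$$ where $$G_1(h,x)=x^3+x^2-\frac{p-1}{3}x+\frac{2hp+1}{27},\qquad G_2(h,x)=x^3+x^2-\frac{p-1}{3}x-\frac{(6+2h)p-1}{27}.$$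
   Context: For a prime $p\equiv1\pmod3$, let $C_0$ be the subgroup of $\mathbb{Z}_p^*=(\mathbb{Z}/p\mathbb{Z})^*$ consisting of the cubes (of order $\frac{p-1}{3}$), and let $C_1,C_2$ be the other two cosets of $C_0$ in $\mathbb{Z}_p^*$ (in any order). The cubic Gaussian periods are $\eta_p^{(k)}=\sum_{j\in C_k}e^{2\pi i j/p}$, $k=0,1,2$. (If $3\nmid h$ then $h^2+3h+9\equiv1\pmod3$.) -}

module Defs where

open import Algebra.Apartness.Bundles using (HeytingField)
open import Algebra.Bundles using (CommutativeRing; RawRing)
import Algebra.Definitions.RawSemiring as RawSemiringDefinitions
import Algebra.Properties.Ring as RingProperties
open import Data.Bool.Base using (if_then_else_)
open import Data.Fin.Base using (Fin; toℕ)
open import Data.Fin.Patterns using (0F)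
open import Data.Fin.Subset using (Subset; _∈_)
open import Data.Fin.Subset.Properties using (_∈?_)
open import Data.Integer.Base as ℤ using (ℤ; +_; -[1+_])
open import Data.Nat.Base as ℕ using (ℕ; zero; suc; _!)
open import Data.Nat.DivMod using (_mod_)
open import Data.Nat.Primality using (Prime; prime⇒nonZero)
open import Data.Nat.Properties using (_!≢0)
open import Data.Product.Base using (∃-syntax; _×_; _,_; proj₁)
open import Data.Sum.Base using (_⊎_; inj₁; inj₂)
open import Function.Bundles using (_⇔_; Equivalence)
open import Function.Definitions using (Injective)
open import Level using (Level; _⊔_)
open import Relation.Binary.Core using (Rel)
open import Relation.Binary.PropositionalEquality using (_≡_)
open import Relation.Binary.Structures using (IsStrictPartialOrder)
open import Relation.Nullary.Decidable.Core using (does)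
open import Relation.Nullary.Negation using (¬_)

------------------------------------------------------------------------
-- The real numbers: a Cauchy-complete Archimedean ordered field.
-- Classically this determines ℝ up to unique isomorphism.

record RealField (c ℓ₁ ℓ₂ : Level) : Set (Level.suc (c ⊔ ℓ₁ ⊔ ℓ₂)) where
  infix 4 _<_
  field
    heytingField : HeytingField c ℓ₁ ℓ₂

  open HeytingField heytingField public renaming (Carrier to ℝ)

  field
    _<_                  : Rel ℝ ℓ₂
    isStrictPartialOrder : IsStrictPartialOrder _≈_ _<_
    #⇔<>                 : ∀ {x y} → x # y ⇔ (x < y ⊎ y < x)
    +-monoˡ-<            : ∀ z {x y} → x < y → x + z < y + z
    *-pos                : ∀ {x y} → 0# < x → 0# < y → 0# < x * y

  commutativeRing : CommutativeRing c ℓ₁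
  commutativeRing = record { isCommutativeRing = isCommutativeRing }

  open CommutativeRing commutativeRing public using (ring; rawRing)
  open RawSemiringDefinitions (RawRing.rawSemiring rawRing)
    using () renaming (_×_ to _·_)

  fromℕ : ℕ → ℝ
  fromℕ n = n · 1#

  -- ∣ x - y ∣ < ε
  Within : ℝ → ℝ → ℝ → Set ℓ₂
  Within ε x y = (x - y < ε) × (y - x < ε)

  IsCauchy : (ℕ → ℝ) → Set (c ⊔ ℓ₂)
  IsCauchy u = ∀ ε → 0# < ε →
    ∃[ N ] (∀ m n → N ℕ.≤ m → N ℕ.≤ n → Within ε (u m) (u n))

  ConvergesTo : (ℕ → ℝ) → ℝ → Set (c ⊔ ℓ₂)
  ConvergesTo u l = ∀ ε → 0# < ε →
    ∃[ N ] (∀ n → N ℕ.≤ n → Within ε (u n) l)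

  field
    archimedean : ∀ x → ∃[ n ] x < fromℕ n
    complete    : ∀ u → IsCauchy u → ∃[ l ] ConvergesTo u l

module Residues (n : ℕ) .{{_ : ℕ.NonZero n}} where

  infixl 7 _*ₙ_

  _*ₙ_ : Fin n → Fin n → Fin n
  i *ₙ j = (toℕ i ℕ.* toℕ j) mod n

  IsUnit : Fin n → Set
  IsUnit i = ∃[ j ] i *ₙ j ≡ 1 mod n

-- C 0F is the group of cubes in (ℤ/p)*; C 1F and C 2F are the other two
-- cosets, in either order.
record IsCubicCosets {p : ℕ} (p-prime : Prime p) (C : Fin 3 → Subset p) : Set where
  private instance
    p≢0 : ℕ.NonZero p
    p≢0 = prime⇒nonZero p-prime

  open Residues p

  field
    cubes    : ∀ j → j ∈ C 0F ⇔ (∃[ y ] (IsUnit y × j ≡ y *ₙ y *ₙ y))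
    coset    : ∀ k → ∃[ g ] (IsUnit g ×
                 (∀ j → j ∈ C k ⇔ (∃[ c ] (c ∈ C 0F × j ≡ g *ₙ c))))
    distinct : Injective _≡_ _≡_ C

module Complex {c ℓ₁ ℓ₂ : Level} (R : RealField c ℓ₁ ℓ₂) where

  open RealField R public using (ℝ; _#_) renaming (0# to 0ℝ)
  private module R = RealField R

  record ℂ : Set c where
    constructor _+i_
    field
      re : ℝ
      im : ℝ

  open ℂ public

  infix  4 _≈_
  infixl 6 _+_ _-_
  infixl 7 _*_
  infix  8 -_

  _≈_ : Rel ℂ ℓ₁
  z ≈ w = (re z R.≈ re w) × (im z R.≈ im w)

  _+_ : ℂ → ℂ → ℂ
  (a +i b) + (c +i d) = (a R.+ c) +i (b R.+ d)

  _*_ : ℂ → ℂ → ℂ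
  (a +i b) * (c +i d) = (a R.* c R.- b R.* d) +i (a R.* d R.+ b R.* c)

  -_ : ℂ → ℂ
  - (a +i b) = (R.- a) +i (R.- b)

  _-_ : ℂ → ℂ → ℂ
  z - w = z + (- w)

  fromℝ : ℝ → ℂ
  fromℝ x = x +i R.0#

  0ℂ 1ℂ 𝕚 : ℂ
  0ℂ = fromℝ R.0#
  1ℂ = fromℝ R.1#
  𝕚  = R.0# +i R.1#

  rawRing : RawRing c ℓ₁
  rawRing = record
    { Carrier = ℂ ; _≈_ = _≈_ ; _+_ = _+_ ; _*_ = _*_ ; -_ = -_
    ; 0# = 0ℂ ; 1# = 1ℂ }

  open RawSemiringDefinitions (RawRing.rawSemiring rawRing) public
    using (_^_; sum)

  fromℤ : ℤ → ℂ
  fromℤ (+ n)      = fromℝ (R.fromℕ n)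
  fromℤ (-[1+ n ]) = - fromℝ (R.fromℕ (suc n))

  -- #⇒invertible inverts x - 0#, which is equal to x.
  invℝ : ∀ {x} → x # 0ℝ → ℝ
  invℝ x#0 = proj₁ (R.#⇒invertible x#0)

  infixl 7 _/_ _÷_

  _÷_ : ℂ → ∀ {x} → x # 0ℝ → ℂ
  z ÷ x#0 = z * fromℝ (invℝ x#0)

  private
    open IsStrictPartialOrder R.isStrictPartialOrder
      using (<-respˡ-≈; <-respʳ-≈) renaming (trans to <-trans)
    open RingProperties R.ring using (-‿involutive; -‿distribˡ-*)

  1#0 : R.1# # R.0#
  1#0 = R.invertible⇒# (R.1# , eq₁ , eq₂)
    where
    open RingProperties R.ring using (-0#≈0#)
    1-0≈1 : R.1# R.- R.0# R.≈ R.1#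
    1-0≈1 = R.trans (R.+-congˡ -0#≈0#) (R.+-identityʳ R.1#)
    eq₁ : R.1# R.* (R.1# R.- R.0#) R.≈ R.1#
    eq₁ = R.trans (R.*-identityˡ _) 1-0≈1
    eq₂ : (R.1# R.- R.0#) R.* R.1# R.≈ R.1#
    eq₂ = R.trans (R.*-identityʳ _) 1-0≈1

  0<1 : R.0# R.< R.1#
  0<1 with Equivalence.to R.#⇔<> 1#0
  ... | inj₂ 0<1 = 0<1
  ... | inj₁ 1<0 = <-respʳ-≈ [-1]²≈1 (R.*-pos 0<-1 0<-1)
    where
    0<-1 : R.0# R.< R.- R.1#
    0<-1 = <-respˡ-≈ (R.-‿inverseʳ R.1#)
             (<-respʳ-≈ (R.+-identityˡ _) (R.+-monoˡ-< (R.- R.1#) 1<0))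
    [-1]²≈1 : R.- R.1# R.* R.- R.1# R.≈ R.1#
    [-1]²≈1 = R.trans (R.sym (-‿distribˡ-* R.1# (R.- R.1#)))
      (R.trans (R.-‿cong (R.*-identityˡ _)) (-‿involutive R.1#))

  0<suc : ∀ n → R.0# R.< R.fromℕ (suc n)
  0<suc zero    = <-respʳ-≈ (R.sym (R.+-identityʳ R.1#)) 0<1
  0<suc (suc n) = <-trans (0<suc n)
    (<-respˡ-≈ (R.+-identityˡ _) (R.+-monoˡ-< (R.fromℕ (suc n)) 0<1))

  fromℕ#0 : ∀ n .{{_ : ℕ.NonZero n}} → R.fromℕ n # 0ℝ
  fromℕ#0 (suc n) = Equivalence.from R.#⇔<> (inj₂ (0<suc n))

  _/_ : ℂ → (n : ℕ) .{{_ : ℕ.NonZero n}} → ℂ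
  z / n = z ÷ fromℕ#0 n

  ----------------------------------------------------------------------
  -- The exponential function, π and the cubic Gaussian periods.  The
  -- function exp and the number π are characterised by properties that
  -- determine them uniquely (up to ≈).

  expPartialSum : ℂ → ℕ → ℂ
  expPartialSum z n = sum {n} (λ k → _/_ (z ^ toℕ k) (toℕ k !) {{toℕ k !≢0}})

  IsExponential : (ℂ → ℂ) → Set (c ⊔ ℓ₂)
  IsExponential exp = ∀ z →
    R.ConvergesTo (λ n → re (expPartialSum z n)) (re (exp z)) ×
    R.ConvergesTo (λ n → im (expPartialSum z n)) (im (exp z))

  -- π / 2 is the least positive zero of the cosine, cos x being the real
  -- part of exp (i x).
  record IsPi (exp : ℂ → ℂ) (π : ℝ) : Set (c ⊔ ℓ₁ ⊔ ℓ₂) where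
    cos : ℝ → ℝ
    cos x = re (exp (𝕚 * fromℝ x))

    π/2 : ℝ
    π/2 = re (fromℝ π / 2)

    field
      π/2-positive : R.0# R.< π/2
      cos-π/2≈0    : cos π/2 R.≈ R.0#
      π/2-least    : ∀ x → R.0# R.< x → cos x R.≈ R.0# → ¬ (x R.< π/2)

  -- Σ_{j ∈ S} exp (2πij / p)
  gaussianPeriod : (exp : ℂ → ℂ) (π : ℝ) (p : ℕ) .{{_ : ℕ.NonZero p}} →
                   Subset p → ℂ
  gaussianPeriod exp π p S = sum (λ (j : Fin p) →
    if does (j ∈? S)
    then exp (fromℤ (+ 2) * fromℝ π * 𝕚 * fromℤ (+ toℕ j) / p)
    else 0ℂ)

  cubicPeriods : (exp : ℂ → ℂ) (π : ℝ) {p : ℕ} → Prime p →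
                 (Fin 3 → Subset p) → Fin 3 → ℂ
  cubicPeriods exp π {p} p-prime C k =
    gaussianPeriod exp π p {{prime⇒nonZero p-prime}} (C k)

  ZerosAre : (ℂ → ℂ) → (Fin 3 → ℂ) → Set (c ⊔ ℓ₁)
  ZerosAre f r = ∀ x → f x ≈ 0ℂ ⇔ (∃[ k ] x ≈ r k)

  ρ : ℤ → ℝ → ℂ → ℂ
  ρ h s x = x ^ 3 + fromℤ h * fromℝ s * x ^ 2
            - fromℤ (h ℤ.+ + 3) * fromℝ s ^ 2 * x + fromℝ s ^ 3

  θ₁ θ₂ : ℤ → {s : ℝ} → s # 0ℝ → ℂ → ℂ
  θ₁ h s#0 x = x ÷ s#0 + fromℤ (h ℤ.- + 1) / 3
  θ₂ h s#0 x = - (x ÷ s#0) - fromℤ (h ℤ.+ + 1) / 3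

  γ₁ γ₂ : ℤ → ℝ → ℂ → ℂ
  γ₁ h s x = - (1ℂ / 3) * fromℝ s * (fromℤ (h ℤ.- + 1) - fromℤ (+ 3) * x)
  γ₂ h s x = - (1ℂ / 3) * fromℝ s * (fromℤ (h ℤ.+ + 1) + fromℤ (+ 3) * x)

  G₁ G₂ : ℕ → ℤ → ℂ → ℂ
  G₁ p h x = x ^ 3 + x ^ 2 - fromℤ (+ p ℤ.- + 1) / 3 * x
             + fromℤ (+ 2 ℤ.* h ℤ.* + p ℤ.+ + 1) / 27
  G₂ p h x = x ^ 3 + x ^ 2 - fromℤ (+ p ℤ.- + 1) / 3 * x
             - fromℤ ((+ 6 ℤ.+ + 2 ℤ.* h) ℤ.* + p ℤ.- + 1) / 27

{-# OPTIONS --safe #-}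
module Submission where

-- The periods satisfy η_k η_{k+1} = a η_k + b η_{k+1} + d η_{k+2}, where a, b
-- and d count the t in C₁ for which 1 + t lies in C₀, C₁ and C₂.  Together with
-- η₀ + η₁ + η₂ = -1 this determines their cubic up to d, and its discriminant
-- is (p (a - b))², whence 4 p = L² + 27 (a - b)² for L = 9 d - p - 1.  As also
-- 4 p = (2 h + 3)² + 27 and such a representation is unique, L = ± (2 h + 3)
-- with the sign fixed by L ≡ 1 (mod 3), and a - b = ± 1: so the cubic is G₁ or
-- G₂, and its discriminant p² keeps the roots apart, which is what decides
-- constructively to which root a zero is equal.  Of the exponential function
-- only ζ = exp (2πi / p) ≠ 1 and ζᵖ = 1 are used; they follow from the addition
-- theorem and from cos having no zero below π / 2.

open import Defs
open import Algebra.Bundles using (CommutativeRing; CommutativeSemiring; RawRing)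
import Algebra.Apartness.Properties.HeytingCommutativeRing as HeytingProperties
import Algebra.Definitions.RawSemiring as RawSemiringDefs
import Algebra.Properties.CommutativeMonoid.Sum as MonoidSum
import Algebra.Properties.CommutativeSemiring.Binomial as Binomial
import Algebra.Properties.Ring as RingProperties
import Algebra.Properties.Semiring.Exp as Exp
import Algebra.Properties.Semiring.Mult as Mult
import Algebra.Properties.Semiring.Mult.TCOptimised as SemiringMult
import Algebra.Properties.Semiring.Sum as SemiringSum
import Algebra.Solver.Ring
open import Algebra.Solver.Ring.AlmostCommutativeRing using (fromCommutativeRing; _-Raw-AlmostCommutative⟶_)
open import Data.Bool.Base using (Bool; true; false; if_then_else_; _∧_)
open import Data.Empty using (⊥; ⊥-elim)
open import Data.Fin.Base as Fin using (Fin; toℕ)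
open import Data.Fin.Patterns using (0F; 1F; 2F)
open import Data.Fin.Permutation using (Permutation; permutation)
import Data.Fin.Properties as Fin
open import Data.Fin.Subset using (Subset; _∈_)
open import Data.Fin.Subset.Properties using (_∈?_; ⊆-antisym)
open import Data.Integer.Base using (ℤ; +_; -[1+_]; _%ℕ_)
import Data.Integer.Base as ℤ
import Data.Integer.DivMod as ℤ
open import Data.Integer.Divisibility using (_∣_)
import Data.Integer.Divisibility.Signed as Signed
import Data.Integer.Properties as ℤ
open import Data.Integer.Solver using (module +-*-Solver)
open import Data.Maybe.Base as Maybe using (Maybe)
open import Data.Nat.Base using (ℕ; zero; suc; _!)
import Data.Nat.Base as ℕ
open import Data.Nat.Combinatorics using (nCk≡n!/k![n-k]!; k![n∸k]!∣n!) renaming (_C_ to _choose_)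
open import Data.Nat.Coprimality using (prime⇒coprime; coprime-Bézout)
import Data.Nat.Divisibility as ℕ
open import Data.Nat.DivMod using (_mod_; m/n*n≡m; m≡m%n+[m/n]*n)
import Data.Nat.DivMod as ℕ
open import Data.Nat.GCD using (module Bézout)
open import Data.Nat.Primality using (Prime; prime⇒nonZero; prime⇒nonTrivial; euclidsLemma)
open import Data.Nat.Properties using (_!≢0; _!*_!≢0)
import Data.Nat.Properties as ℕ
open import Data.Product.Base as Prod using (∃-syntax; _×_; _,_; proj₁; proj₂)
open import Data.Sum.Base as Sum using (_⊎_; inj₁; inj₂; [_,_]′)
open import Function.Base using (_∘_)
open import Function.Bundles using (_⇔_; mk⇔; Equivalence)
open import Level using (Level; _⊔_; 0ℓ)
open import Relation.Binary.PropositionalEquality as ≡ using (_≡_; _≢_; module ≡-Reasoning)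
import Relation.Binary.Reasoning.Setoid as SetoidReasoning
open import Relation.Binary.Structures using (IsStrictPartialOrder)
open import Relation.Nullary.Decidable using (Dec; yes; no; does; does-⇔; dec-true; dec-false; dec⇒maybe; _×-dec_; ¬?; decidable-stable)
open import Relation.Nullary.Negation using (¬_; contradiction)

-- `IsCubicCosets` supplies three distinct cosets of the cubes, but not that they exhaust the units,
-- and no primitive root modulo `p` is at hand. Exhaustion comes from counting: as
-- `p = h² + 3 h + 9`, the residue `h / 3` is a root of `X² + X + 1`, so cubing is at most three to
-- one and the units number at most three times the cubes. Only products of two different periods
-- are expanded. The square of a period would meet the pairs `j`, `- j` and produce a constant term;
-- `-1` being a cube, this cannot happen between different cosets. The three products suffice: their
-- sum gives the second symmetric function, multiplying each by the missing period gives three times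
-- the third, and weighting them by differences gives a square root of the discriminant. The
-- equation `4 p = L² + 27 M²` is thus found among complex numbers, but its terms are images of
-- integers, and injectivity of `ι` returns it to `ℤ`, where the uniqueness argument applies.
-- Writing `h = 3 m + 1` or `h = 3 m - 1` turns the fractional coefficients of `G₁` or `G₂` into
-- integer polynomials in `m`.

ℤ-rawRing : RawRing _ _
ℤ-rawRing = CommutativeRing.rawRing ℤ.+-*-commutativeRing

-- The integers inside a commutative ring, and polynomial identities over them

module IntegerEmbedding {c ℓ : Level} (R : CommutativeRing c ℓ) where
  open CommutativeRing R
  open RingProperties ring
  open SemiringMult semiring renaming (_×_ to _·_)
  open SetoidReasoning setoid

  -- The optimised multiple reduces `ι (+ 1)` to `1#`, so `con (+ 1)` in a solver call matches a
  -- literal `1#` of the goal.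
  ι : ℤ → Carrier
  ι (+ n)    = n · 1#
  ι -[1+ n ] = - (suc n · 1#)

  ι-neg : ∀ x → ι (ℤ.- x) ≈ - ι x
  ι-neg (+ zero)  = sym -0#≈0#
  ι-neg (+ suc n) = refl
  ι-neg -[1+ n ]  = sym (-‿involutive _)

  ι-⊖ : ∀ m n → ι (m ℤ.⊖ n) ≈ m · 1# - n · 1#
  ι-⊖ m zero          = sym (trans (+-congˡ -0#≈0#) (+-identityʳ _))
  ι-⊖ zero (suc n)    = sym (+-identityˡ _)
  ι-⊖ (suc m) (suc n) = begin
    ι (suc m ℤ.⊖ suc n)                  ≡⟨ ≡.cong ι (ℤ.[1+m]⊖[1+n]≡m⊖n m n) ⟩
    ι (m ℤ.⊖ n)                          ≈⟨ ι-⊖ m n ⟩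
    m · 1# - n · 1#                      ≈⟨ +-congʳ (xyx⁻¹≈y 1# (m · 1#)) ⟨
    1# + m · 1# - 1# - n · 1#            ≈⟨ +-assoc _ _ _ ⟩
    1# + m · 1# + (- 1# - n · 1#)        ≈⟨ +-congˡ (-‿+-comm 1# (n · 1#)) ⟩
    1# + m · 1# - (1# + n · 1#)          ≈⟨ +-cong (1+× m 1#) (-‿cong (1+× n 1#)) ⟨
    suc m · 1# - suc n · 1#              ∎

  ι-+ : ∀ x y → ι (x ℤ.+ y) ≈ ι x + ι y
  ι-+ (+ m)    (+ n)    = ×-homo-+ 1# m n
  ι-+ (+ m)    -[1+ n ] = ι-⊖ m (suc n)
  ι-+ -[1+ m ] (+ n)    = trans (ι-⊖ n (suc m)) (+-comm _ _)
  ι-+ -[1+ m ] -[1+ n ] = begin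
    - (suc (suc (m ℕ.+ n)) · 1#)         ≡⟨ ≡.cong (λ k → - (k · 1#)) (ℕ.+-suc (suc m) n) ⟨
    - ((suc m ℕ.+ suc n) · 1#)           ≈⟨ -‿cong (×-homo-+ 1# (suc m) (suc n)) ⟩
    - (suc m · 1# + suc n · 1#)          ≈⟨ -‿+-comm _ _ ⟨
    - (suc m · 1#) + - (suc n · 1#)      ∎

  ι-*-nonneg : ∀ m y → ι (+ m ℤ.* y) ≈ m · 1# * ι y
  ι-*-nonneg m (+ n)    = trans (reflexive (≡.cong ι (≡.sym (ℤ.pos-* m n)))) (×1-homo-* m n)
  ι-*-nonneg m -[1+ n ] = begin
    ι (+ m ℤ.* -[1+ n ])             ≡⟨ ≡.cong ι (ℤ.neg-distribʳ-* (+ m) (+ suc n)) ⟨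
    ι (ℤ.- (+ m ℤ.* + suc n))        ≈⟨ ι-neg (+ m ℤ.* + suc n) ⟩
    - ι (+ m ℤ.* + suc n)            ≈⟨ -‿cong (ι-*-nonneg m (+ suc n)) ⟩
    - (m · 1# * suc n · 1#)          ≈⟨ -‿distribʳ-* _ _ ⟩
    m · 1# * - (suc n · 1#)          ∎

  ι-* : ∀ x y → ι (x ℤ.* y) ≈ ι x * ι y
  ι-* (+ m)    y = ι-*-nonneg m y
  ι-* -[1+ m ] y = begin
    ι (-[1+ m ] ℤ.* y)             ≡⟨ ≡.cong ι (ℤ.neg-distribˡ-* (+ suc m) y) ⟨
    ι (ℤ.- (+ suc m ℤ.* y))        ≈⟨ ι-neg (+ suc m ℤ.* y) ⟩
    - ι (+ suc m ℤ.* y)            ≈⟨ -‿cong (ι-*-nonneg (suc m) y) ⟩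
    - (suc m · 1# * ι y)           ≈⟨ -‿distribˡ-* _ _ ⟩
    - (suc m · 1#) * ι y           ∎

  homomorphism : ℤ-rawRing -Raw-AlmostCommutative⟶ fromCommutativeRing R
  homomorphism = record
    { ⟦_⟧    = ι
    ; +-homo = ι-+
    ; *-homo = ι-*
    ; -‿homo = ι-neg
    ; 0-homo = refl
    ; 1-homo = refl
    }

module IntegerSolver {c ℓ : Level} (R : CommutativeRing c ℓ)
  (hom : ℤ-rawRing -Raw-AlmostCommutative⟶ fromCommutativeRing R) where
  open CommutativeRing R
  open _-Raw-AlmostCommutative⟶_ hom using (⟦_⟧)

  -- Coefficients are compared in `ℤ`, since equality in the target ring need not be decidable; an
  -- undecided comparison only leaves a normal form less simplified.
  ⟦⟧-≟ : ∀ x y → Maybe (⟦ x ⟧ ≈ ⟦ y ⟧)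
  ⟦⟧-≟ x y = Maybe.map (λ x≡y → reflexive (≡.cong ⟦_⟧ x≡y)) (dec⇒maybe (x ℤ.≟ y))

  open Algebra.Solver.Ring ℤ-rawRing (fromCommutativeRing R) hom ⟦⟧-≟ public

module CubicDiscriminant {c ℓ : Level} (R : CommutativeRing c ℓ) where
  open CommutativeRing R
  open IntegerEmbedding R
  open IntegerSolver R homomorphism

  -- `u - v` is `(x - y) (y - z) (x - z)`, so this is the classical discriminant of the cubic with
  -- roots `x`, `y`, `z`.
  discriminant : ∀ x y z → let u = x * x * y + y * y * z + z * z * x ; v = x * y * y + y * z * z + z * x * x
                               e₁ = x + y + z ; e₂ = x * y + y * z + z * x ; e₃ = x * y * z in
    (u - v) * (u - v) ≈ e₁ * e₁ * e₂ * e₂ - ι (+ 4) * (e₂ * e₂ * e₂) - ι (+ 4) * (e₁ * e₁ * e₁ * e₃) + ι (+ 18) * (e₁ * e₂ * e₃) - ι (+ 27) * (e₃ * e₃)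
  discriminant = solve 3 (λ x y z → let u = x :* x :* y :+ y :* y :* z :+ z :* z :* x ; v = x :* y :* y :+ y :* z :* z :+ z :* x :* x
                                        e₁ = x :+ y :+ z ; e₂ = x :* y :+ y :* z
                                            :+ z :* x ; e₃ = x :* y :* z in
    (u :- v) :* (u :- v) := e₁ :* e₁ :* e₂ :* e₂ :- con (+ 4) :* (e₂ :* e₂ :* e₂) :- con (+ 4) :* (e₁ :* e₁ :* e₁ :* e₃) :+ con (+ 18) :* (e₁ :* e₂ :* e₃) :- con (+ 27) :* (e₃ :* e₃)) refl

module CubeIdentities {c ℓ : Level} (R : CommutativeRing c ℓ) where
  open CommutativeRing R
  open IntegerEmbedding R
  open IntegerSolver R homomorphism
  open SetoidReasoning setoid

  cube-* : ∀ u v → (u * v) * (u * v) * (u * v) ≈ (u * u * u) * (v * v * v)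
  cube-* = solve 2 (λ u v → (u :* v) :* (u :* v) :* (u :* v) := (u :* u :* u) :* (v :* v :* v)) refl

  *-cube-interchange : ∀ x y u v → (x * (u * u * u)) * (y * (v * v * v))
      ≈ x * y * ((u * v) * (u * v) * (u * v))
  *-cube-interchange = solve 4 (λ x y u v →
    (x :* (u :* u :* u)) :* (y :* (v :* v :* v)) := x :* y :* ((u :* v) :* (u :* v) :* (u :* v))) refl

  -- The two sides differ by a multiple of `ω * ω + ω + 1#`. The solver cannot use the hypothesis,
  -- so the cofactor is written out.
  cube-factorisation : ∀ ω y a → ω * ω + ω + 1# ≈ 0# →
                       (y - a) * ((y - ω * a) * (y - ω * ω * a)) ≈ y * y * y - a * a * a
  cube-factorisation ω y a ω≈ = begin
    (y - a) * ((y - ω * a) * (y - ω * ω * a))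
      ≈⟨ solve 3 (λ ω y a → (y :- a) :* ((y :- ω :* a) :* (y :- ω :* ω :* a)) :=
                    (y :* y :* y :- a :* a :* a)
                      :+ (ω :* ω :+ ω :+ con (+ 1)) :* (ω :* a :* a :* y :- a :* y :* y :- (ω :- con (+ 1)) :* a :* a :* a))
                 refl ω y a ⟩
    (y * y * y - a * a * a) + (ω * ω + ω + 1#) * _    ≈⟨ +-congˡ (trans (*-congʳ ω≈) (zeroˡ _)) ⟩
    (y * y * y - a * a * a) + 0#                      ≈⟨ +-identityʳ _ ⟩
    y * y * y - a * a * a                             ∎

-- The ring ℤ/p

module Modular (p : ℕ) .{{_ : ℕ.NonZero p}} where
  open import Data.Integer.Base using (_+_; _*_; _-_; -_)
  open ≡ using (refl; cong; cong₂; sym; trans)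

  lift : Fin p → ℤ
  lift i = + toℕ i

  opaque
    -- Opaque, so that type checking never unfolds the division by `p`; everything later goes
    -- through `red-cong`, `red-lift` and `lift-red`.
    red : ℤ → Fin p
    red x = Fin.fromℕ< (ℤ.n%ℕd<d x p)

  -- A positive `t` would force `p ≤ r`; a negative one is the positive case with `r` and `s`
  -- exchanged.
  residue-unique : ∀ r s t → r ℕ.< p → s ℕ.< p → + r ≡ + s + t * + p → r ≡ s
  residue-unique r s (+ zero) r<p s<p eq = ℤ.+-injective (trans eq (ℤ.+-identityʳ (+ s)))
  residue-unique r s (+ suc n) r<p s<p eq = contradiction r<p
      (ℕ.≤⇒≯ (ℕ.≤-trans (ℕ.m≤m+n p (n ℕ.* p)) (ℕ.≤-trans (ℕ.m≤n+m _ s) (ℕ.≤-reflexive (sym eq′)))))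
    where
    eq′ : r ≡ s ℕ.+ suc n ℕ.* p
    eq′ = ℤ.+-injective (trans eq (cong (λ z → + s + z) (sym (ℤ.pos-* (suc n) p))))
  residue-unique r s t@(-[1+ n ]) r<p s<p eq = sym (residue-unique s r (+ suc n) s<p r<p eq′)
    where
    open +-*-Solver
    eq′ : + s ≡ + r + + suc n * + p
    eq′ = trans (solve 3 (λ s t p → s := s :+ t :* p :+ (:- t) :* p) refl (+ s) t (+ p))
                (cong (λ z → z + + suc n * + p) (sym eq))

  opaque
    unfolding red

    red-cong : ∀ x y k → x ≡ y + k * + p → red x ≡ red y
    red-cong x y k eq = Fin.fromℕ<-cong _ _ (residue-unique (x ℤ.%ℕ p) (y ℤ.%ℕ p) (y ℤ./ℕ p - x ℤ./ℕ p + k)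
        (ℤ.n%ℕd<d x p) (ℤ.n%ℕd<d y p) (begin
          + (x ℤ.%ℕ p)                       ≡⟨ solve 2 (λ r q → r := r :+ q :+ (:- q)) refl
              (+ (x ℤ.%ℕ p)) (x ℤ./ℕ p * + p) ⟩
          + (x ℤ.%ℕ p) + x ℤ./ℕ p * + p - x ℤ./ℕ p * + p  ≡⟨ cong (λ z → z - x ℤ./ℕ p * + p)
              (trans (sym (ℤ.a≡a%ℕn+[a/ℕn]*n x p)) eq) ⟩
          y + k * + p - x ℤ./ℕ p * + p ≡⟨ cong (λ z → z + k * + p - x ℤ./ℕ p * + p) (ℤ.a≡a%ℕn+[a/ℕn]*n y p) ⟩
          + (y ℤ.%ℕ p) + y ℤ./ℕ p * + p + k * + p - x ℤ./ℕ p * + p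
            ≡⟨ solve 5 (λ r q k q′ p → r :+ q :* p :+ k :* p :- q′ :* p := r
                :+ (q :- q′ :+ k) :* p) refl (+ (y ℤ.%ℕ p)) (y ℤ./ℕ p) k (x ℤ./ℕ p) (+ p) ⟩
          + (y ℤ.%ℕ p) + (y ℤ./ℕ p - x ℤ./ℕ p + k) * + p ∎)) _ _
      where
      open ≡-Reasoning
      open +-*-Solver

    red-lift : ∀ i → red (lift i) ≡ i
    red-lift i = Fin.toℕ-injective (trans (Fin.toℕ-fromℕ< _) (ℕ.m<n⇒m%n≡m (Fin.toℕ<n i)))

    lift-red : ∀ x → lift (red x) ≡ x + (- (x ℤ./ℕ p)) * + p
    lift-red x = begin
      + toℕ (red x)         ≡⟨ cong +_ (Fin.toℕ-fromℕ< _) ⟩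
      + (x ℤ.%ℕ p)          ≡⟨ solve 3 (λ r q p → r := r :+ q :* p :+ (:- q) :* p) refl (+ (x ℤ.%ℕ p))
          (x ℤ./ℕ p) (+ p) ⟩
      + (x ℤ.%ℕ p) + x ℤ./ℕ p * + p + (- (x ℤ./ℕ p)) * + p ≡⟨ cong (λ z → z + (- (x ℤ./ℕ p)) * + p)
          (ℤ.a≡a%ℕn+[a/ℕn]*n x p) ⟨
      x + (- (x ℤ./ℕ p)) * + p ∎
      where
      open ≡-Reasoning
      open +-*-Solver

    toℕ-red-+ : ∀ n → toℕ (red (+ n)) ≡ n ℕ.% p
    toℕ-red-+ n = Fin.toℕ-fromℕ< _

    red-mod : ∀ n → red (+ n) ≡ n mod p
    red-mod n = refl

  infixl 6 _⊕_
  infixl 7 _⊗_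
  infix 8 ⊖_

  opaque
    _⊕_ _⊗_ : Fin p → Fin p → Fin p
    i ⊕ j = red (lift i + lift j)
    i ⊗ j = red (lift i * lift j)

    ⊖_ : Fin p → Fin p
    ⊖ i = red (- lift i)

  opaque
    unfolding _⊕_ _⊗_ ⊖_

    red-⊕ : ∀ x y → red (x + y) ≡ red x ⊕ red y
    red-⊕ x y = red-cong (x + y) (lift (red x) + lift (red y)) (x ℤ./ℕ p + y ℤ./ℕ p) (sym (begin
      lift (red x) + lift (red y) + (x ℤ./ℕ p + y ℤ./ℕ p) * + p ≡⟨ cong₂
          (λ a b → a + b + (x ℤ./ℕ p + y ℤ./ℕ p) * + p) (lift-red x) (lift-red y) ⟩
      _ ≡⟨ solve 5 (λ x y q r p → x :+ (:- q) :* p :+ (y :+ (:- r) :* p) :+ (q :+ r) :* p := x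
          :+ y) refl x y (x ℤ./ℕ p) (y ℤ./ℕ p) (+ p) ⟩
      x + y ∎))
      where
      open ≡-Reasoning
      open +-*-Solver

    red-⊗ : ∀ x y → red (x * y) ≡ red x ⊗ red y
    red-⊗ x y = red-cong (x * y) (lift (red x) * lift (red y)) k (sym (begin
      lift (red x) * lift (red y) + k * + p ≡⟨ cong₂ (λ a b → a * b + k * + p) (lift-red x) (lift-red y) ⟩
      _ ≡⟨ solve 5 (λ x y q r p → (x :+ (:- q) :* p) :* (y :+ (:- r) :* p)
          :+ (x :* r :+ y :* q :- q :* r :* p) :* p := x :* y) refl x y (x ℤ./ℕ p) (y ℤ./ℕ p) (+ p) ⟩
      x * y ∎))
      where
      open ≡-Reasoning
      open +-*-Solver
      k : ℤ
      k = x * (y ℤ./ℕ p) + y * (x ℤ./ℕ p) - (x ℤ./ℕ p) * (y ℤ./ℕ p) * + p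

    red-⊖ : ∀ x → red (- x) ≡ ⊖ red x
    red-⊖ x = red-cong (- x) (- lift (red x)) (- (x ℤ./ℕ p)) (sym (begin
      - lift (red x) + (- (x ℤ./ℕ p)) * + p ≡⟨ cong (λ a → - a + (- (x ℤ./ℕ p)) * + p) (lift-red x) ⟩
      _ ≡⟨ solve 3 (λ x q p → :- (x :+ (:- q) :* p) :+ (:- q) :* p := :- x) refl x (x ℤ./ℕ p) (+ p) ⟩
      - x ∎))
      where
      open ≡-Reasoning
      open +-*-Solver

    ⊕-def : ∀ i j → i ⊕ j ≡ red (lift i + lift j)
    ⊕-def i j = refl

    ⊗-def : ∀ i j → i ⊗ j ≡ red (lift i * lift j)
    ⊗-def i j = refl

  0ₚ 1ₚ : Fin p
  0ₚ = red (+ 0)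
  1ₚ = red (+ 1)

  private
    -- Every residue is `red` of its lift, so a law for residues need only be checked on reductions
    -- of integers, where it becomes the same law in `ℤ`.
    red³ : (P : Fin p → Fin p → Fin p → Set) → (∀ x y z → P (red x) (red y) (red z)) → ∀ i j k → P i j k
    red³ P h i j k = ≡.subst₂ (λ i j → P i j k) (red-lift i) (red-lift j)
      (≡.subst (P (red (lift i)) (red (lift j))) (red-lift k) (h (lift i) (lift j) (lift k)))

    ⊕-assoc : ∀ i j k → (i ⊕ j) ⊕ k ≡ i ⊕ (j ⊕ k)
    ⊕-assoc = red³ (λ i j k → (i ⊕ j) ⊕ k ≡ i ⊕ (j ⊕ k)) λ x y z → begin
      (red x ⊕ red y) ⊕ red z   ≡⟨ cong (_⊕ red z) (red-⊕ x y) ⟨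
      red (x + y) ⊕ red z     ≡⟨ red-⊕ (x + y) z ⟨
      red (x + y + z)       ≡⟨ cong red (ℤ.+-assoc x y z) ⟩
      red (x + (y + z))     ≡⟨ red-⊕ x (y + z) ⟩
      red x ⊕ red (y + z)     ≡⟨ cong (red x ⊕_) (red-⊕ y z) ⟩
      red x ⊕ (red y ⊕ red z)   ∎
      where open ≡-Reasoning

    ⊗-assoc : ∀ i j k → (i ⊗ j) ⊗ k ≡ i ⊗ (j ⊗ k)
    ⊗-assoc = red³ (λ i j k → (i ⊗ j) ⊗ k ≡ i ⊗ (j ⊗ k)) λ x y z → begin
      (red x ⊗ red y) ⊗ red z   ≡⟨ cong (_⊗ red z) (red-⊗ x y) ⟨
      red (x * y) ⊗ red z     ≡⟨ red-⊗ (x * y) z ⟨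
      red (x * y * z)       ≡⟨ cong red (ℤ.*-assoc x y z) ⟩
      red (x * (y * z))     ≡⟨ red-⊗ x (y * z) ⟩
      red x ⊗ red (y * z)     ≡⟨ cong (red x ⊗_) (red-⊗ y z) ⟩
      red x ⊗ (red y ⊗ red z)   ∎
      where open ≡-Reasoning

    ⊕-comm : ∀ i j → i ⊕ j ≡ j ⊕ i
    ⊕-comm i j = trans (⊕-def i j) (trans (cong red (ℤ.+-comm (lift i) (lift j))) (sym (⊕-def j i)))

    ⊗-comm : ∀ i j → i ⊗ j ≡ j ⊗ i
    ⊗-comm i j = trans (⊗-def i j) (trans (cong red (ℤ.*-comm (lift i) (lift j))) (sym (⊗-def j i)))

    ⊕-identityˡ : ∀ i → 0ₚ ⊕ i ≡ i
    ⊕-identityˡ i = red³ (λ i _ _ → 0ₚ ⊕ i ≡ i) (λ x _ _ → trans (sym (red-⊕ (+ 0) x))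
        (cong red (ℤ.+-identityˡ x))) i i i

    ⊗-identityˡ : ∀ i → 1ₚ ⊗ i ≡ i
    ⊗-identityˡ i = red³ (λ i _ _ → 1ₚ ⊗ i ≡ i) (λ x _ _ → trans (sym (red-⊗ (+ 1) x))
        (cong red (ℤ.*-identityˡ x))) i i i

    ⊖-inverseˡ : ∀ i → ⊖ i ⊕ i ≡ 0ₚ
    ⊖-inverseˡ i = red³ (λ i _ _ → ⊖ i ⊕ i ≡ 0ₚ)
      (λ x _ _ → trans (cong (_⊕ red x) (sym (red-⊖ x))) (trans (sym (red-⊕ (- x) x))
          (cong red (ℤ.+-inverseˡ x)))) i i i

    ⊗-distribʳ : ∀ i j k → (j ⊕ k) ⊗ i ≡ j ⊗ i ⊕ k ⊗ i
    ⊗-distribʳ = red³ (λ i j k → (j ⊕ k) ⊗ i ≡ j ⊗ i ⊕ k ⊗ i) λ x y z → begin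
      (red y ⊕ red z) ⊗ red x           ≡⟨ cong (_⊗ red x) (red-⊕ y z) ⟨
      red (y + z) ⊗ red x             ≡⟨ red-⊗ (y + z) x ⟨
      red ((y + z) * x)             ≡⟨ cong red (ℤ.*-distribʳ-+ x y z) ⟩
      red (y * x + z * x)         ≡⟨ red-⊕ (y * x) (z * x) ⟩
      red (y * x) ⊕ red (z * x)     ≡⟨ cong₂ _⊕_ (red-⊗ y x) (red-⊗ z x) ⟩
      red y ⊗ red x ⊕ red z ⊗ red x     ∎
      where open ≡-Reasoning

  open import Algebra.Consequences.Propositional {A = Fin p}

  residueRing : CommutativeRing 0ℓ 0ℓ
  residueRing = record
    { Carrier = Fin p ; _≈_ = _≡_ ; _+_ = _⊕_ ; _*_ = _⊗_ ; -_ = ⊖_ ; 0# = 0ₚ ; 1# = 1ₚ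
    ; isCommutativeRing = record
      { isRing = record
        { +-isAbelianGroup = record
          { isGroup = record
            { isMonoid = record
              { isSemigroup = record
                { isMagma = record { isEquivalence = ≡.isEquivalence ; ∙-cong = cong₂ _⊕_ }
                ; assoc = ⊕-assoc }
              ; identity = comm∧idˡ⇒id ⊕-comm ⊕-identityˡ }
            ; inverse = comm∧invˡ⇒inv ⊕-comm ⊖-inverseˡ
            ; ⁻¹-cong = cong ⊖_ }
          ; comm = ⊕-comm }
        ; *-cong = cong₂ _⊗_
        ; *-assoc = ⊗-assoc
        ; *-identity = comm∧idˡ⇒id ⊗-comm ⊗-identityˡ
        ; distrib = (λ i j k → trans (⊗-comm i (j ⊕ k)) (trans (⊗-distribʳ i j k)
            (cong₂ _⊕_ (⊗-comm j i) (⊗-comm k i)))) , ⊗-distribʳ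
        }
      ; *-comm = ⊗-comm } }

  -- Bridge to the product `_*ₙ_` in which units and cosets are stated.
  ⊗-mod : ∀ i j → i ⊗ j ≡ (toℕ i ℕ.* toℕ j) mod p
  ⊗-mod i j = trans (⊗-def i j) (trans (cong red (sym (ℤ.pos-* (toℕ i) (toℕ j)))) (red-mod _))

  toℕ-0ₚ : toℕ 0ₚ ≡ 0
  toℕ-0ₚ = trans (toℕ-red-+ 0) (ℕ.m*n%n≡0 0 p)

  toℕ-⊕ : ∀ i j → toℕ (i ⊕ j) ≡ (toℕ i ℕ.+ toℕ j) ℕ.% p
  toℕ-⊕ i j = trans (cong toℕ (⊕-def i j)) (toℕ-red-+ (toℕ i ℕ.+ toℕ j))

  module _ (p-prime : Prime p) where

    -- Bézout for `p` and `toℕ i`. Over `ℕ` it comes with two sign patterns; `1 + y i = x p` yields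
    -- the inverse `- y`.
    inverse : ∀ i → i ≢ 0ₚ → ∃[ j ] i ⊗ j ≡ 1ₚ
    inverse i i≢0 with coprime-Bézout (prime⇒coprime p-prime {{i≢0′}} (Fin.toℕ<n i))
      where
      i≢0′ : ℕ.NonZero (toℕ i)
      i≢0′ = ℕ.≢-nonZero (λ eq → i≢0 (Fin.toℕ-injective (trans eq (sym toℕ-0ₚ))))
    ... | Bézout.-+ x y eq = red (+ y) , (begin
      i ⊗ red (+ y)           ≡⟨ cong (_⊗ red (+ y)) (red-lift i) ⟨
      red (lift i) ⊗ red (+ y)  ≡⟨ red-⊗ (lift i) (+ y) ⟨
      red (lift i * + y)    ≡⟨ red-cong (lift i * + y) (+ 1) (+ x) (trans (ℤ.*-comm (lift i) (+ y))
          (trans (sym (ℤ.pos-* y (toℕ i))) (trans (cong +_ (sym eq)) (cong (λ z → + 1 + z) (ℤ.pos-* x p))))) ⟩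
      1ₚ ∎)
      where open ≡-Reasoning
    ... | Bézout.+- x y eq = red (- + y) , (begin
      i ⊗ red (- + y)           ≡⟨ cong (_⊗ red (- + y)) (red-lift i) ⟨
      red (lift i) ⊗ red (- + y)  ≡⟨ red-⊗ (lift i) (- + y) ⟨
      red (lift i * (- + y))    ≡⟨ red-cong (lift i * (- + y)) (+ 1) (- + x) eq′ ⟩
      1ₚ ∎)
      where
      open ≡-Reasoning
      open +-*-Solver
      eq″ : + 1 + + y * lift i ≡ + x * + p
      eq″ = trans (cong (λ z → + 1 + z) (sym (ℤ.pos-* y (toℕ i)))) (trans (cong +_ eq) (ℤ.pos-* x p))
      eq′ : lift i * (- + y) ≡ + 1 + (- + x) * + p
      eq′ = trans (solve 2 (λ i y → i :* (:- y) := con (+ 1) :- (con (+ 1) :+ y :* i)) refl (lift i) (+ y))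
            (trans (cong (λ z → + 1 - z) eq″) (cong (λ z → + 1 + z) (ℤ.neg-distribˡ-* (+ x) (+ p))))

-- Cubic residues modulo p

module FiniteSums where
  open ≡ using (refl; cong; cong₂; sym; trans)

  module ℕSum = MonoidSum ℕ.+-0-commutativeMonoid

  ⟦_⟧ᵇ : Bool → ℕ
  ⟦ b ⟧ᵇ = if b then 1 else 0

  sum-mono : ∀ {n} (f g : Fin n → ℕ) → (∀ i → f i ℕ.≤ g i) → ℕSum.sum f ℕ.≤ ℕSum.sum g
  sum-mono {zero}  f g f≤g = ℕ.z≤n
  sum-mono {suc n} f g f≤g = ℕ.+-mono-≤ (f≤g 0F) (sum-mono (f ∘ Fin.suc) (g ∘ Fin.suc) (f≤g ∘ Fin.suc))

  sum-zero : ∀ {n} (f : Fin n → ℕ) → (∀ i → f i ≡ 0) → ℕSum.sum f ≡ 0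
  sum-zero {zero}  f f≡0 = refl
  sum-zero {suc n} f f≡0 = cong₂ ℕ._+_ (f≡0 0F) (sum-zero (f ∘ Fin.suc) (f≡0 ∘ Fin.suc))

  sum-indicator-≟ : ∀ {n} (a : Fin n) → ℕSum.sum (λ j → ⟦ does (j Fin.≟ a) ⟧ᵇ) ≡ 1
  sum-indicator-≟ {suc n} Fin.zero    = cong suc (sum-zero {n}
      (λ j → ⟦ does (Fin.suc j Fin.≟ Fin.zero) ⟧ᵇ) (λ _ → refl))
  sum-indicator-≟ {suc n} (Fin.suc a) = sum-indicator-≟ a

  term≤sum : ∀ {n} (f : Fin n → ℕ) i → f i ℕ.≤ ℕSum.sum f
  term≤sum f Fin.zero    = ℕ.m≤m+n _ _
  term≤sum f (Fin.suc i) = ℕ.≤-trans (term≤sum (f ∘ Fin.suc) i) (ℕ.m≤n+m _ _)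

  infixl 6 _⊞_
  -- Addition modulo 3, tabulated so that it computes on numerals: the three instances of
  -- `period-product` then have the cyclic shape that `Integrality` expects without rewriting.
  _⊞_ : Fin 3 → Fin 3 → Fin 3
  0F ⊞ l  = l
  1F ⊞ 0F = 1F
  1F ⊞ 1F = 2F
  1F ⊞ 2F = 0F
  2F ⊞ 0F = 2F
  2F ⊞ 1F = 0F
  2F ⊞ 2F = 1F

  ⊟_ : Fin 3 → Fin 3
  ⊟ 0F = 0F
  ⊟ 1F = 2F
  ⊟ 2F = 1F

  ⊟-⊞-cancel : ∀ k l → ⊟ k ⊞ (k ⊞ l) ≡ l
  ⊟-⊞-cancel 0F l  = refl
  ⊟-⊞-cancel 1F 0F = refl
  ⊟-⊞-cancel 1F 1F = refl
  ⊟-⊞-cancel 1F 2F = refl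
  ⊟-⊞-cancel 2F 0F = refl
  ⊟-⊞-cancel 2F 1F = refl
  ⊟-⊞-cancel 2F 2F = refl

  ⊞-cancelˡ : ∀ k l l′ → k ⊞ l ≡ k ⊞ l′ → l ≡ l′
  ⊞-cancelˡ k l l′ eq = trans (sym (⊟-⊞-cancel k l)) (trans (cong (⊟ k ⊞_) eq) (⊟-⊞-cancel k l′))

  ⊞-comm : ∀ k l → k ⊞ l ≡ l ⊞ k
  ⊞-comm 0F 0F = refl
  ⊞-comm 0F 1F = refl
  ⊞-comm 0F 2F = refl
  ⊞-comm 1F 0F = refl
  ⊞-comm 1F 1F = refl
  ⊞-comm 1F 2F = refl
  ⊞-comm 2F 0F = refl
  ⊞-comm 2F 1F = refl
  ⊞-comm 2F 2F = refl

open FiniteSums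

module PrimeField {p : ℕ} (p-prime : Prime p) where
  open ≡ using (refl; cong; sym; trans)
  instance
    p≢0 : ℕ.NonZero p
    p≢0 = prime⇒nonZero p-prime

  open Modular p public
  open CommutativeRing residueRing public using ()
    renaming ( *-comm to ⊗-comm; *-assoc to ⊗-assoc; *-identityˡ to ⊗-identityˡ; *-identityʳ to ⊗-identityʳ
             ; zeroˡ to ⊗-zeroˡ; zeroʳ to ⊗-zeroʳ; distribˡ to ⊗-distribˡ)
  module 𝔽 = CommutativeRing residueRing
  open CubeIdentities residueRing
  open RingProperties 𝔽.ring using () renaming (x∙y⁻¹≈ε⇒x≈y to x⊖y≡0⇒x≡y)

  1≢0 : 1ₚ ≢ 0ₚ
  1≢0 eq = contradiction (trans (sym (ℕ.m<n⇒m%n≡m (ℕ.nonTrivial⇒n>1 p {{prime⇒nonTrivial p-prime}})))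
    (trans (sym (toℕ-red-+ 1)) (trans (cong toℕ eq) toℕ-0ₚ))) λ ()

  opaque
    inv : ∀ x → x ≢ 0ₚ → Fin p
    inv x x≢0 = proj₁ (inverse p-prime x x≢0)

    inv-inverseʳ : ∀ x x≢0 → x ⊗ inv x x≢0 ≡ 1ₚ
    inv-inverseʳ x x≢0 = proj₂ (inverse p-prime x x≢0)

  inv-⊗-cancel : ∀ x x≢0 y → inv x x≢0 ⊗ (x ⊗ y) ≡ y
  inv-⊗-cancel x x≢0 y = begin
    inv x x≢0 ⊗ (x ⊗ y)   ≡⟨ ⊗-assoc _ _ _ ⟨
    inv x x≢0 ⊗ x ⊗ y     ≡⟨ cong (_⊗ y) (trans (⊗-comm _ _) (inv-inverseʳ x x≢0)) ⟩
    1ₚ ⊗ y                ≡⟨ ⊗-identityˡ y ⟩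
    y ∎
    where open ≡-Reasoning

  ⊗-inv-cancel : ∀ x x≢0 y → x ⊗ (inv x x≢0 ⊗ y) ≡ y
  ⊗-inv-cancel x x≢0 y = begin
    x ⊗ (inv x x≢0 ⊗ y)   ≡⟨ ⊗-assoc _ _ _ ⟨
    x ⊗ inv x x≢0 ⊗ y     ≡⟨ cong (_⊗ y) (inv-inverseʳ x x≢0) ⟩
    1ₚ ⊗ y                ≡⟨ ⊗-identityˡ y ⟩
    y ∎
    where open ≡-Reasoning

  ⊗-cancelˡ : ∀ x → x ≢ 0ₚ → ∀ {y z} → x ⊗ y ≡ x ⊗ z → y ≡ z
  ⊗-cancelˡ x x≢0 {y} {z} eq = trans (sym (inv-⊗-cancel x x≢0 y)) (trans (cong (inv x x≢0 ⊗_) eq)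
      (inv-⊗-cancel x x≢0 z))

  ⊗-nonzero : ∀ {x y} → x ≢ 0ₚ → y ≢ 0ₚ → x ⊗ y ≢ 0ₚ
  ⊗-nonzero {x} x≢0 y≢0 xy≡0 = y≢0 (⊗-cancelˡ x x≢0 (trans xy≡0 (sym (⊗-zeroʳ x))))

  ⊗-zero-product : ∀ x y → x ⊗ y ≡ 0ₚ → x ≡ 0ₚ ⊎ y ≡ 0ₚ
  ⊗-zero-product x y xy≡0 with x Fin.≟ 0ₚ
  ... | yes x≡0 = inj₁ x≡0
  ... | no  x≢0 = inj₂ (⊗-cancelˡ x x≢0 (trans xy≡0 (sym (⊗-zeroʳ x))))

  unit⇒nonzero : ∀ {x y} → x ⊗ y ≡ 1ₚ → x ≢ 0ₚ
  unit⇒nonzero {y = y} xy≡1 x≡0 = 1≢0 (trans (sym xy≡1) (trans (cong (_⊗ y) x≡0) (⊗-zeroˡ y)))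

  -- Serves as the change of variable `j ↦ x j` in sums over all residues.
  scale : ∀ x → x ≢ 0ₚ → Permutation p p
  scale x x≢0 = permutation (x ⊗_) (inv x x≢0 ⊗_) (⊗-inv-cancel x x≢0) (inv-⊗-cancel x x≢0)

  cube : Fin p → Fin p
  cube v = v ⊗ v ⊗ v

  infix 4 _~_
  -- Among units, lying in the same coset of the cubes; `0ₚ` is related only to itself. The calculus
  -- of cosets is done with this relation, independently of how `C` presents them.
  _~_ : Fin p → Fin p → Set
  x ~ y = ∃[ v ] (v ≢ 0ₚ × x ≡ y ⊗ cube v)

  cube-⊗ : ∀ u v → cube (u ⊗ v) ≡ cube u ⊗ cube v
  cube-⊗ = cube-*

  cube-1 : cube 1ₚ ≡ 1ₚ
  cube-1 = trans (cong (_⊗ 1ₚ) (⊗-identityˡ 1ₚ)) (⊗-identityˡ 1ₚ)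

  ~-refl : ∀ {x} → x ~ x
  ~-refl {x} = 1ₚ , 1≢0 , sym (trans (cong (x ⊗_) cube-1) (⊗-identityʳ x))

  ~-respˡ : ∀ {x y z} → x ≡ y → x ~ z → y ~ z
  ~-respˡ refl x~z = x~z

  ~-respʳ : ∀ {x y z} → x ≡ y → z ~ x → z ~ y
  ~-respʳ refl z~x = z~x

  ~-trans : ∀ {x y z} → x ~ y → y ~ z → x ~ z
  ~-trans {z = z} (u , u≢0 , refl) (v , v≢0 , refl) = v ⊗ u , ⊗-nonzero v≢0 u≢0 ,
    trans (⊗-assoc z (cube v) (cube u)) (cong (z ⊗_) (sym (cube-⊗ v u)))

  ~-sym : ∀ {x y} → x ~ y → y ~ x
  ~-sym {y = y} (u , u≢0 , refl) = inv u u≢0 , unit⇒nonzero (trans (⊗-comm _ _) (inv-inverseʳ u u≢0))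
      , sym (begin
    y ⊗ cube u ⊗ cube (inv u u≢0)     ≡⟨ ⊗-assoc _ _ _ ⟩
    y ⊗ (cube u ⊗ cube (inv u u≢0))   ≡⟨ cong (y ⊗_) (cube-⊗ u (inv u u≢0)) ⟨
    y ⊗ cube (u ⊗ inv u u≢0)          ≡⟨ cong (λ w → y ⊗ cube w) (inv-inverseʳ u u≢0) ⟩
    y ⊗ cube 1ₚ                       ≡⟨ cong (y ⊗_) cube-1 ⟩
    y ⊗ 1ₚ                            ≡⟨ ⊗-identityʳ y ⟩
    y                                 ∎)
    where open ≡-Reasoning

  ~-⊗ : ∀ {x y x′ y′} → x ~ x′ → y ~ y′ → x ⊗ y ~ x′ ⊗ y′
  ~-⊗ {x′ = x′} {y′} (u , u≢0 , refl) (v , v≢0 , refl) = u ⊗ v , ⊗-nonzero u≢0 v≢0 ,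
    *-cube-interchange x′ y′ u v

  ~-⊗-cancelˡ : ∀ {z x y} → z ≢ 0ₚ → z ⊗ x ~ z ⊗ y → x ~ y
  ~-⊗-cancelˡ {z} {x} {y} z≢0 (u , u≢0 , eq) = u , u≢0 , ⊗-cancelˡ z z≢0 (trans eq (⊗-assoc z y (cube u)))

  ~-cube : ∀ {v} → v ≢ 0ₚ → cube v ~ 1ₚ
  ~-cube {v} v≢0 = v , v≢0 , sym (⊗-identityˡ (cube v))

  ~-nonzero : ∀ {x y} → y ≢ 0ₚ → x ~ y → x ≢ 0ₚ
  ~-nonzero y≢0 (u , u≢0 , refl) = ⊗-nonzero y≢0 (⊗-nonzero (⊗-nonzero u≢0 u≢0) u≢0)

  IsPrimitiveCubeRoot : Fin p → Set
  IsPrimitiveCubeRoot ω = ω ⊗ ω ⊕ ω ⊕ 1ₚ ≡ 0ₚ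

  -- There are no zero divisors modulo `p`, and `y³ - a³` splits into linear factors.
  cube-fibre : ∀ ω → IsPrimitiveCubeRoot ω → ∀ y a → cube y ≡ cube a →
               y ≡ a ⊎ y ≡ ω ⊗ a ⊎ y ≡ ω ⊗ ω ⊗ a
  cube-fibre ω ω≡ y a y³≡a³ =
    [ inj₁ ∘ x⊖y≡0⇒x≡y y a
    , (λ eq → inj₂ ([ inj₁ ∘ x⊖y≡0⇒x≡y y (ω ⊗ a) , inj₂ ∘ x⊖y≡0⇒x≡y y (ω ⊗ ω ⊗ a) ]′
                      (⊗-zero-product (y ⊕ ⊖ (ω ⊗ a)) (y ⊕ ⊖ (ω ⊗ ω ⊗ a)) eq))) ]′
    (⊗-zero-product (y ⊕ ⊖ a) ((y ⊕ ⊖ (ω ⊗ a)) ⊗ (y ⊕ ⊖ (ω ⊗ ω ⊗ a))) product≡0)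
    where
    product≡0 : (y ⊕ ⊖ a) ⊗ ((y ⊕ ⊖ (ω ⊗ a)) ⊗ (y ⊕ ⊖ (ω ⊗ ω ⊗ a))) ≡ 0ₚ
    product≡0 = trans (cube-factorisation ω y a ω≡) (trans (cong (_⊕ ⊖ cube a) y³≡a³) (𝔽.-‿inverseʳ (cube a)))

module Indicators where

  indicator-mono : ∀ {a b} {A : Set a} {B : Set b} (A? : Dec A) (B? : Dec B) → (A → B) →
                   ⟦ does A? ⟧ᵇ ℕ.≤ ⟦ does B? ⟧ᵇ
  indicator-mono (no  _) B?      A→B = ℕ.z≤n
  indicator-mono (yes x) (yes y) A→B = ℕ.≤-refl
  indicator-mono (yes x) (no ¬y) A→B = contradiction (A→B x) ¬y

  indicator-≤ : ∀ {a n} {A : Set a} (A? : Dec A) → (A → 1 ℕ.≤ n) → ⟦ does A? ⟧ᵇ ℕ.≤ n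
  indicator-≤ (no  _) 1≤n = ℕ.z≤n
  indicator-≤ (yes x) 1≤n = 1≤n x

  -- At most one of the first four propositions holds, and if one does so does the fifth. This is
  -- the pointwise form of four disjoint cosets lying among the units.
  disjoint-indicators : ∀ {a} {A B C D E : Set a} (A? : Dec A) (B? : Dec B) (C? : Dec C) (D? : Dec D)
      (E? : Dec E) →
    (A → ¬ B) → (A → ¬ C) → (A → ¬ D) → (B → ¬ C) → (B → ¬ D) → (C → ¬ D) →
    (A → E) → (B → E) → (C → E) → (D → E) →
    ⟦ does A? ⟧ᵇ ℕ.+ (⟦ does B? ⟧ᵇ ℕ.+ (⟦ does C? ⟧ᵇ ℕ.+ ⟦ does D? ⟧ᵇ)) ℕ.≤ ⟦ does E? ⟧ᵇ
  disjoint-indicators (yes a) (yes b) _ _ _ ab ac ad bc bd cd ae be ce de = contradiction b (ab a)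
  disjoint-indicators (yes a) (no _) (yes c) _ _ ab ac ad bc bd cd ae be ce de = contradiction c (ac a)
  disjoint-indicators (yes a) (no _) (no _) (yes d) _ ab ac ad bc bd cd ae be ce de = contradiction d (ad a)
  disjoint-indicators (yes a) (no _) (no _) (no _) E? ab ac ad bc bd cd ae be ce de = indicator-mono
      (yes a) E? ae
  disjoint-indicators (no _) (yes b) (yes c) _ _ ab ac ad bc bd cd ae be ce de = contradiction c (bc b)
  disjoint-indicators (no _) (yes b) (no _) (yes d) _ ab ac ad bc bd cd ae be ce de = contradiction d (bd b)
  disjoint-indicators (no _) (yes b) (no _) (no _) E? ab ac ad bc bd cd ae be ce de = indicator-mono
      (yes b) E? be
  disjoint-indicators (no _) (no _) (yes c) (yes d) _ ab ac ad bc bd cd ae be ce de = contradiction d (cd c)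
  disjoint-indicators (no _) (no _) (yes c) (no _) E? ab ac ad bc bd cd ae be ce de = indicator-mono
      (yes c) E? ce
  disjoint-indicators (no _) (no _) (no _) D? E? ab ac ad bc bd cd ae be ce de = indicator-mono D? E? de

open Indicators

-- The quotient of the units by the cubes is cyclic of order 3

module CubicCosets {p : ℕ} (p-prime : Prime p) (C : Fin 3 → Subset p) (cosets : IsCubicCosets p-prime C)
  (ω : Fin p) (ω-root : PrimeField.IsPrimitiveCubeRoot p-prime ω) where
  open ≡ using (refl; cong; cong₂; sym; trans; subst)
  open PrimeField p-prime
  open IsCubicCosets cosets
  open Residues p using (_*ₙ_; IsUnit)

  isUnit⇒nonzero : ∀ {x} → IsUnit x → x ≢ 0ₚ
  isUnit⇒nonzero {x} (y , xy≡1) = unit⇒nonzero (trans (⊗-mod x y) (trans xy≡1 (sym (red-mod 1))))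

  nonzero⇒isUnit : ∀ {x} → x ≢ 0ₚ → IsUnit x
  nonzero⇒isUnit {x} x≢0 = inv x x≢0 , trans (sym (⊗-mod x _)) (trans (inv-inverseʳ x x≢0) (red-mod 1))

  *ₙ-cube : ∀ y → y *ₙ y *ₙ y ≡ cube y
  *ₙ-cube y = sym (trans (⊗-mod (y ⊗ y) y) (cong (_*ₙ y) (⊗-mod y y)))

  opaque
    rep : Fin 3 → Fin p
    rep k = proj₁ (coset k)

    rep≢0 : ∀ k → rep k ≢ 0ₚ
    rep≢0 k = isUnit⇒nonzero (proj₁ (proj₂ (coset k)))

    coset-of-rep : ∀ k j → j ∈ C k ⇔ (∃[ c ] (c ∈ C 0F × j ≡ rep k *ₙ c))
    coset-of-rep k = proj₂ (proj₂ (coset k))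

  -- This and the next three lemmas trade membership in the subsets, stated with `_*ₙ_`, for `_~_`.
  ∈C₀⇒ : ∀ {x} → x ∈ C 0F → x ~ 1ₚ
  ∈C₀⇒ {x} x∈ with Equivalence.to (cubes x) x∈
  ... | y , unit , refl = y , isUnit⇒nonzero unit , trans (*ₙ-cube y) (sym (⊗-identityˡ (cube y)))

  ⇒∈C₀ : ∀ {x} → x ~ 1ₚ → x ∈ C 0F
  ⇒∈C₀ {x} (y , y≢0 , eq) = Equivalence.from (cubes x)
    (y , nonzero⇒isUnit y≢0 , trans eq (trans (⊗-identityˡ (cube y)) (sym (*ₙ-cube y))))

  ∈C⇒ : ∀ k {x} → x ∈ C k → x ~ rep k
  ∈C⇒ k {x} x∈ with Equivalence.to (coset-of-rep k x) x∈
  ... | c , c∈ , eq with ∈C₀⇒ c∈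
  ...   | v , v≢0 , eq′ = v , v≢0 , trans eq (trans (sym (⊗-mod (rep k) c))
      (cong (rep k ⊗_) (trans eq′ (⊗-identityˡ (cube v)))))

  ⇒∈C : ∀ k {x} → x ~ rep k → x ∈ C k
  ⇒∈C k {x} (v , v≢0 , eq) = Equivalence.from (coset-of-rep k x)
    (cube v , ⇒∈C₀ (~-cube v≢0) , trans eq (⊗-mod (rep k) (cube v)))

  -- `coset 0F` comes with a representative of its own, which may differ from 1.
  rep₀~1 : rep 0F ~ 1ₚ
  rep₀~1 = ∈C₀⇒ (⇒∈C 0F ~-refl)

  -- Related representatives have the same coset as a subset, and `C` is injective.
  rep-distinct : ∀ {k l} → rep k ~ rep l → k ≡ l
  rep-distinct {k} {l} k~l = distinct (⊆-antisym
    (λ x∈ → ⇒∈C l (~-trans (∈C⇒ k x∈) k~l))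
    (λ x∈ → ⇒∈C k (~-trans (∈C⇒ l x∈) (~-sym k~l))))

  ∈C-unique : ∀ {k l x} → x ∈ C k → x ∈ C l → k ≡ l
  ∈C-unique {k} {l} x∈k x∈l = rep-distinct (~-trans (~-sym (∈C⇒ k x∈k)) (∈C⇒ l x∈l))

  ∈C⇒nonzero : ∀ {k x} → x ∈ C k → x ≢ 0ₚ
  ∈C⇒nonzero {k} x∈ = ~-nonzero (rep≢0 k) (∈C⇒ k x∈)

  opaque
    private
      count : (Fin p → Bool) → ℕ
      count c = ℕSum.sum (λ j → ⟦ c j ⟧ᵇ)

      c₀ : Fin p → Bool
      c₀ x = does (x ∈? C 0F)

      -- The indicator of `x C₀`, tested by dividing by `x`.
      translate : ∀ x → x ≢ 0ₚ → Fin p → Bool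
      translate x x≢0 j = c₀ (inv x x≢0 ⊗ j)

      count-translate : ∀ x x≢0 → count (translate x x≢0) ≡ count c₀
      count-translate x x≢0 = trans (ℕSum.sum-permute (λ j → ⟦ translate x x≢0 j ⟧ᵇ) (scale x x≢0))
        (ℕSum.sum-cong-≗ (λ j → cong (λ z → ⟦ c₀ z ⟧ᵇ) (inv-⊗-cancel x x≢0 j)))

      nonzero : Fin p → Bool
      nonzero x = does (¬? (x Fin.≟ 0ₚ))

      -- If `u = a³`, the solutions are among `a`, `ω a`, `ω² a`; if `u` is not in `C 0F`, there are
      -- none.
      fibre-bound : ∀ u → ℕSum.sum
          (λ y → ⟦ does (¬? (y Fin.≟ 0ₚ) ×-dec (u Fin.≟ cube y)) ⟧ᵇ) ℕ.≤ 3 ℕ.* ⟦ c₀ u ⟧ᵇ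
      fibre-bound u with u ∈? C 0F
      ... | no  u∉ = ℕ.≤-reflexive (sum-zero (λ y → ⟦ does (¬? (y Fin.≟ 0ₚ) ×-dec (u Fin.≟ cube y)) ⟧ᵇ)
        (λ y → cong ⟦_⟧ᵇ (dec-false (¬? (y Fin.≟ 0ₚ) ×-dec (u Fin.≟ cube y))
          (λ (y≢0 , eq) → u∉ (⇒∈C₀ (subst (_~ 1ₚ) (sym eq) (~-cube y≢0)))))))
      ... | yes u∈ with ∈C₀⇒ u∈
      ...   | a , a≢0 , eq = ℕ.≤-trans
        (sum-mono (λ y → ⟦ does (¬? (y Fin.≟ 0ₚ) ×-dec (u Fin.≟ cube y)) ⟧ᵇ)
                  (λ y → δ a y ℕ.+ (δ (ω ⊗ a) y ℕ.+ δ (ω ⊗ ω ⊗ a) y)) pointwise)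
        (ℕ.≤-reflexive (trans (ℕSum.∑-distrib-+ (δ a) _) (cong₂ ℕ._+_ (sum-indicator-≟ a)
          (trans (ℕSum.∑-distrib-+ (δ (ω ⊗ a)) _) (cong₂ ℕ._+_ (sum-indicator-≟ (ω ⊗ a))
              (sum-indicator-≟ (ω ⊗ ω ⊗ a)))))))
        where
        δ : Fin p → Fin p → ℕ
        δ a y = ⟦ does (y Fin.≟ a) ⟧ᵇ
        pointwise : ∀ y → ⟦ does (¬? (y Fin.≟ 0ₚ) ×-dec (u Fin.≟ cube y)) ⟧ᵇ ℕ.≤ δ a y ℕ.+ (δ
            (ω ⊗ a) y ℕ.+ δ (ω ⊗ ω ⊗ a) y)
        pointwise y = indicator-≤ (¬? (y Fin.≟ 0ₚ) ×-dec (u Fin.≟ cube y)) λ (_ , eq′) → [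
            (λ e → ℕ.≤-trans (one a e) (ℕ.m≤m+n (δ a y) _))
          , [ (λ e → ℕ.≤-trans (one (ω ⊗ a) e) (ℕ.≤-trans (ℕ.m≤m+n (δ (ω ⊗ a) y) _) (ℕ.m≤n+m _ (δ a y))))
            , (λ e → ℕ.≤-trans (one (ω ⊗ ω ⊗ a) e) (ℕ.≤-trans (ℕ.m≤n+m _ (δ (ω ⊗ a) y))
                (ℕ.m≤n+m _ (δ a y)))) ]′ ]′
                              (cube-fibre ω ω-root y a (trans (sym eq′) (trans eq (⊗-identityˡ (cube a)))))
          where
          one : ∀ b → y ≡ b → 1 ℕ.≤ δ b y
          one b y≡b = ℕ.≤-reflexive (sym (cong ⟦_⟧ᵇ (dec-true (y Fin.≟ b) y≡b)))

      -- Double counting of the pairs `(y , y³)`: each unit `y` is in at least one, each `u` in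
      -- `C 0F` in at most three.
      units-bound : count nonzero ℕ.≤ 3 ℕ.* count c₀
      units-bound = begin
        ℕSum.sum (λ y → ⟦ nonzero y ⟧ᵇ)                  ≤⟨ sum-mono _
            (λ y → ℕSum.sum (λ u → hit y u)) split ⟩
        ℕSum.sum (λ y → ℕSum.sum (λ u → hit y u))        ≡⟨ ℕSum.∑-comm hit ⟩
        ℕSum.sum (λ u → ℕSum.sum (λ y → hit y u))        ≤⟨ sum-mono _ _ fibre-bound ⟩
        ℕSum.sum (λ u → 3 ℕ.* ⟦ c₀ u ⟧ᵇ)                 ≡⟨ triple ⟩
        3 ℕ.* count c₀                                   ∎
        where
        open ℕ.≤-Reasoning
        hit : Fin p → Fin p → ℕ
        hit y u = ⟦ does (¬? (y Fin.≟ 0ₚ) ×-dec (u Fin.≟ cube y)) ⟧ᵇ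
        split : ∀ y → ⟦ nonzero y ⟧ᵇ ℕ.≤ ℕSum.sum (λ u → hit y u)
        split y = ℕ.≤-trans (indicator-mono (¬? (y Fin.≟ 0ₚ)) (¬? (y Fin.≟ 0ₚ) ×-dec
            (cube y Fin.≟ cube y)) (_, refl)) (term≤sum (hit y) (cube y))
        triple : ℕSum.sum (λ u → 3 ℕ.* ⟦ c₀ u ⟧ᵇ) ≡ 3 ℕ.* count c₀
        triple = trans (ℕSum.∑-distrib-+ (λ u → ⟦ c₀ u ⟧ᵇ) _) (cong (count c₀ ℕ.+_)
          (trans (ℕSum.∑-distrib-+ (λ u → ⟦ c₀ u ⟧ᵇ) _) (cong (count c₀ ℕ.+_)
          (trans (ℕSum.∑-distrib-+ (λ u → ⟦ c₀ u ⟧ᵇ) (λ _ → 0)) (cong (count c₀ ℕ.+_)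
              (sum-zero {p} (λ _ → 0) (λ _ → refl)))))))

    -- Four disjoint cosets of the group of cubes would have 4 |C₀| elements,
    -- but there are at most 3 |C₀| units.
    no-fourth-coset : ∀ x → x ≢ 0ₚ → ¬ (∀ k → ¬ x ∈ C k)
    no-fourth-coset x x≢0 x∉ = contradiction (ℕ.≤-trans four units-bound)
        (ℕ.<⇒≱ (ℕ.+-monoˡ-≤ (3 ℕ.* count c₀) positive))
      where
      positive : 1 ℕ.≤ count c₀
      positive = ℕ.≤-trans (ℕ.≤-reflexive (sym (cong ⟦_⟧ᵇ (dec-true (1ₚ ∈? C 0F) (⇒∈C₀ ~-refl)))))
        (term≤sum (λ j → ⟦ c₀ j ⟧ᵇ) 1ₚ)
      t : Fin 3 → Fin p → ℕ
      t k j = ⟦ translate (rep k) (rep≢0 k) j ⟧ᵇ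
      tₓ : Fin p → ℕ
      tₓ j = ⟦ translate x x≢0 j ⟧ᵇ
      translate⇒~ : ∀ z z≢0 j → inv z z≢0 ⊗ j ∈ C 0F → j ~ z
      translate⇒~ z z≢0 j e = subst (_~ z) (⊗-inv-cancel z z≢0 j) (subst (z ⊗ (inv z z≢0 ⊗ j) ~_)
          (trans (⊗-comm z 1ₚ) (⊗-identityˡ z)) (~-⊗ ~-refl (∈C₀⇒ e)))
      at-most-one : ∀ j → t 0F j ℕ.+ (t 1F j ℕ.+ (t 2F j ℕ.+ tₓ j)) ℕ.≤ ⟦ nonzero j ⟧ᵇ
      at-most-one j = disjoint-indicators (mem (rep 0F) (rep≢0 0F)) (mem (rep 1F) (rep≢0 1F))
          (mem (rep 2F) (rep≢0 2F)) (mem x x≢0) (¬? (j Fin.≟ 0ₚ))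
        (apart λ ()) (apart λ ()) (x-apart 0F) (apart λ ()) (x-apart 1F) (x-apart 2F)
        (translate⇒nonzero (rep 0F) (rep≢0 0F)) (translate⇒nonzero (rep 1F) (rep≢0 1F))
            (translate⇒nonzero (rep 2F) (rep≢0 2F)) (translate⇒nonzero x x≢0)
        where
        mem : ∀ z z≢0 → Dec (inv z z≢0 ⊗ j ∈ C 0F)
        mem z z≢0 = inv z z≢0 ⊗ j ∈? C 0F
        apart : ∀ {k l} → k ≢ l → inv (rep k) (rep≢0 k) ⊗ j ∈ C 0F → ¬ inv (rep l) (rep≢0 l) ⊗ j ∈ C 0F
        apart {k} {l} k≢l a b = k≢l (rep-distinct (~-trans (~-sym (translate⇒~ (rep k) (rep≢0 k) j a))
            (translate⇒~ (rep l) (rep≢0 l) j b)))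
        x-apart : ∀ k → inv (rep k) (rep≢0 k) ⊗ j ∈ C 0F → ¬ inv x x≢0 ⊗ j ∈ C 0F
        x-apart k a b = x∉ k (⇒∈C k (~-trans (~-sym (translate⇒~ x x≢0 j b)) (translate⇒~ (rep k)
            (rep≢0 k) j a)))
        translate⇒nonzero : ∀ z z≢0 → inv z z≢0 ⊗ j ∈ C 0F → j ≢ 0ₚ
        translate⇒nonzero z z≢0 e = ~-nonzero z≢0 (translate⇒~ z z≢0 j e)
      four : 4 ℕ.* count c₀ ℕ.≤ count nonzero
      four = begin
        4 ℕ.* count c₀
          ≡⟨ cong (λ z → count c₀ ℕ.+ (count c₀ ℕ.+ (count c₀ ℕ.+ z))) (ℕ.+-identityʳ (count c₀)) ⟩
        count c₀ ℕ.+ (count c₀ ℕ.+ (count c₀ ℕ.+ count c₀))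
          ≡⟨ cong₂ ℕ._+_ (count-translate (rep 0F) (rep≢0 0F))
              (cong₂ ℕ._+_ (count-translate (rep 1F) (rep≢0 1F))
              (cong₂ ℕ._+_ (count-translate (rep 2F) (rep≢0 2F)) (count-translate x x≢0))) ⟨
        ℕSum.sum (t 0F) ℕ.+ (ℕSum.sum (t 1F) ℕ.+ (ℕSum.sum (t 2F) ℕ.+ ℕSum.sum tₓ))
          ≡⟨ trans (ℕSum.∑-distrib-+ (t 0F) _) (cong (ℕSum.sum (t 0F) ℕ.+_)
              (trans (ℕSum.∑-distrib-+ (t 1F) _) (cong (ℕSum.sum (t 1F) ℕ.+_)
              (ℕSum.∑-distrib-+ (t 2F) tₓ)))) ⟨
        ℕSum.sum (λ j → t 0F j ℕ.+ (t 1F j ℕ.+ (t 2F j ℕ.+ tₓ j)))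
          ≤⟨ sum-mono _ _ at-most-one ⟩
        count nonzero ∎
        where open ℕ.≤-Reasoning

  opaque
    -- `no-fourth-coset` only refutes that no `k` exists; membership in the three subsets is
    -- decidable, so an actual index can be recovered.
    class : ∀ x → x ≢ 0ₚ → ∃[ k ] x ∈ C k
    class x x≢0 = decidable-stable (Fin.any? (λ k → x ∈? C k)) (λ ∄k → no-fourth-coset x x≢0
        (λ k x∈ → ∄k (k , x∈)))

  rep≁1 : ∀ k → k ≢ 0F → ¬ rep k ~ 1ₚ
  rep≁1 k k≢0 rep~1 = k≢0 (rep-distinct (~-trans rep~1 (~-sym rep₀~1)))

  -- Let `g = rep 1F`. If `g²` were a cube, then `g ~ g³ ~ 1`; if `g² ~ g`, then again `g ~ 1`. Only
  -- the third coset is left, so `g` generates the quotient, and the table `rep-⊞` follows.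
  rep₁²~rep₂ : rep 1F ⊗ rep 1F ~ rep 2F
  rep₁²~rep₂ with class (rep 1F ⊗ rep 1F) (⊗-nonzero (rep≢0 1F) (rep≢0 1F))
  ... | 0F , x∈ = ⊥-elim (rep≁1 1F (λ ()) (~-trans
          (~-respˡ (⊗-identityˡ (rep 1F)) (~-⊗ (~-sym (∈C₀⇒ x∈)) ~-refl)) (~-cube (rep≢0 1F))))
  ... | 1F , x∈ = ⊥-elim (rep≁1 1F (λ ()) (~-⊗-cancelˡ (rep≢0 1F) (~-respʳ (sym (⊗-identityʳ (rep 1F)))
      (∈C⇒ 1F x∈))))
  ... | 2F , x∈ = ∈C⇒ 2F x∈

  rep₁rep₂~rep₀ : rep 1F ⊗ rep 2F ~ rep 0F
  rep₁rep₂~rep₀ = ~-trans (~-⊗ ~-refl (~-sym rep₁²~rep₂))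
    (~-trans (~-respˡ (⊗-assoc (rep 1F) (rep 1F) (rep 1F)) (~-cube (rep≢0 1F))) (~-sym rep₀~1))

  rep₂²~rep₁ : rep 2F ⊗ rep 2F ~ rep 1F
  rep₂²~rep₁ = ~-trans (~-⊗ (~-sym rep₁²~rep₂) ~-refl)
    (~-respˡ (sym (⊗-assoc (rep 1F) (rep 1F) (rep 2F)))
      (~-respʳ (⊗-identityʳ (rep 1F)) (~-⊗ (~-refl {rep 1F}) (~-trans rep₁rep₂~rep₀ rep₀~1))))

  rep-⊞ : ∀ k l → rep k ⊗ rep l ~ rep (k ⊞ l)
  rep-⊞ 0F l  = ~-respʳ (⊗-identityˡ (rep l)) (~-⊗ rep₀~1 ~-refl)
  rep-⊞ 1F 0F = ~-respˡ (⊗-comm (rep 0F) (rep 1F)) (rep-⊞ 0F 1F)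
  rep-⊞ 2F 0F = ~-respˡ (⊗-comm (rep 0F) (rep 2F)) (rep-⊞ 0F 2F)
  rep-⊞ 1F 1F = rep₁²~rep₂
  rep-⊞ 1F 2F = rep₁rep₂~rep₀
  rep-⊞ 2F 1F = ~-respˡ (⊗-comm (rep 1F) (rep 2F)) rep₁rep₂~rep₀
  rep-⊞ 2F 2F = rep₂²~rep₁

  ∈C-⊗ : ∀ {k l x y} → x ∈ C k → y ∈ C l → x ⊗ y ∈ C (k ⊞ l)
  ∈C-⊗ {k} {l} x∈ y∈ = ⇒∈C (k ⊞ l) (~-trans (~-⊗ (∈C⇒ k x∈) (∈C⇒ l y∈)) (rep-⊞ k l))

  -- `class` puts `y` into some coset, and cancellation modulo 3 identifies its index.
  ∈C-⊗⁻¹ : ∀ {k l x y} → x ∈ C k → x ⊗ y ∈ C (k ⊞ l) → y ∈ C l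
  ∈C-⊗⁻¹ {k} {l} {x} {y} x∈ xy∈ with class y (λ y≡0 → ∈C⇒nonzero xy∈ (trans (cong (x ⊗_) y≡0) (⊗-zeroʳ x)))
  ... | l′ , y∈ = subst (λ l → y ∈ C l) (⊞-cancelˡ k l′ l (∈C-unique (∈C-⊗ x∈ y∈) xy∈)) y∈

  coset? : Fin 3 → Fin p → Bool
  coset? k x = does (x ∈? C k)

  coset?-⊗ : ∀ {k x} → x ∈ C k → ∀ l y → coset? (k ⊞ l) (x ⊗ y) ≡ coset? l y
  coset?-⊗ {k} {x} x∈ l y = does-⇔ (mk⇔ (∈C-⊗⁻¹ x∈) (∈C-⊗ x∈)) (x ⊗ y ∈? C (k ⊞ l)) (y ∈? C l)

  -1∈C₀ : ⊖ 1ₚ ∈ C 0F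
  -1∈C₀ = ⇒∈C₀ (⊖ 1ₚ , (λ eq → 1≢0 (trans (sym (⊖-involutive 1ₚ)) (trans (cong ⊖_ eq) ⊖0≡0))) , sym (begin
    1ₚ ⊗ (⊖ 1ₚ ⊗ ⊖ 1ₚ ⊗ ⊖ 1ₚ)   ≡⟨ ⊗-identityˡ _ ⟩
    ⊖ 1ₚ ⊗ ⊖ 1ₚ ⊗ ⊖ 1ₚ          ≡⟨ cong (_⊗ ⊖ 1ₚ) (trans (-1*x≈-x (⊖ 1ₚ)) (⊖-involutive 1ₚ)) ⟩
    1ₚ ⊗ ⊖ 1ₚ                   ≡⟨ ⊗-identityˡ _ ⟩
    ⊖ 1ₚ                        ∎))
    where
    open ≡-Reasoning
    open RingProperties 𝔽.ring using (-1*x≈-x) renaming (-0#≈0# to ⊖0≡0; -‿involutive to ⊖-involutive)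

  -- `1 + t = 0` would make `t = -1 = (-1)³` a cube. Hence the product of two consecutive periods
  -- has no constant term.
  1+C₁-nonzero : ∀ {t} → t ∈ C 1F → 1ₚ ⊕ t ≢ 0ₚ
  1+C₁-nonzero {t} t∈ 1+t≡0 = contradiction
      (∈C-unique (subst (_∈ C 1F) (+-inverseʳ-unique 1ₚ t 1+t≡0) t∈) -1∈C₀) λ ()
    where open RingProperties 𝔽.ring using (+-inverseʳ-unique)

-- Products of periods

module Conditionals where

  -- The decision is an argument to match on, which spares a `with` on membership tests buried
  -- inside sums.
  if-dec : ∀ {a b ℓ} {A : Set a} {B : Set b} (_R_ : B → B → Set ℓ) (A? : Dec A) {x y z : B} →
           (A → x R z) → (¬ A → y R z) → (if does A? then x else y) R z
  if-dec _R_ (yes p) x≈z y≈z = x≈z p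
  if-dec _R_ (no ¬p) x≈z y≈z = y≈z ¬p

open Conditionals

module Periods {p : ℕ} (p-prime : Prime p) (C : Fin 3 → Subset p) (cosets : IsCubicCosets p-prime C)
  (ω : Fin p) (ω-root : PrimeField.IsPrimitiveCubeRoot p-prime ω) where
  open ≡ using (refl; cong; cong₂; sym; trans; subst)
  open PrimeField p-prime
  open CubicCosets p-prime C cosets ω ω-root

  both : Fin 3 → Fin p → Bool
  both l t = coset? 1F t ∧ coset? l (1ₚ ⊕ t)

  -- The cyclotomic number (1, l): how many t in C₁ have 1 + t in C_l.
  N : Fin 3 → ℕ
  N l = ℕSum.sum (λ t → ⟦ both l t ⟧ᵇ)

  coset?-true : ∀ {k x} → x ∈ C k → coset? k x ≡ true
  coset?-true {k} {x} = dec-true (x ∈? C k)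

  coset?-false : ∀ {k l x} → x ∈ C k → l ≢ k → coset? l x ≡ false
  coset?-false {k} {l} {x} x∈ l≢k = dec-false (x ∈? C l) (λ x∈′ → l≢k (∈C-unique x∈′ x∈))

  coset?-0 : ∀ l → coset? l 0ₚ ≡ false
  coset?-0 l = dec-false (0ₚ ∈? C l) (λ 0∈ → ∈C⇒nonzero 0∈ refl)

  module InSemiring {a ℓ : Level} (K : CommutativeSemiring a ℓ) where
    open CommutativeSemiring K renaming (refl to ≈-refl; sym to ≈-sym; trans to ≈-trans)
    open SemiringSum semiring
    open Mult semiring using (×-congˡ) renaming (_×_ to _·_)
    open SetoidReasoning setoid

    if-≡ : ∀ {b b′ : Bool} {x : Carrier} → b ≡ b′ → (if b then x else 0#) ≈ (if b′ then x else 0#)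
    if-≡ refl = ≈-refl

    chosen : ∀ {k l x} {y : Carrier} → x ∈ C k → l ≡ k → (if coset? l x then y else 0#) ≈ y
    chosen x∈ refl = if-≡ (coset?-true x∈)

    omitted : ∀ {k l x} {y : Carrier} → x ∈ C k → l ≢ k → (if coset? l x then y else 0#) ≈ 0#
    omitted x∈ l≢k = if-≡ (coset?-false x∈ l≢k)

    select : ∀ {k x} → x ∈ C k → (f : Fin 3 → Carrier) →
             (if coset? 0F x then f 0F else 0#) + ((if coset? 1F x then f 1F else 0#) + (if coset? 2F x then f 2F else 0#)) ≈ f k
    select {0F} x∈ f = ≈-trans (+-cong (chosen x∈ refl) (+-cong (omitted x∈ λ ()) (omitted x∈ λ ())))
        (≈-trans (+-congˡ (+-identityˡ 0#)) (+-identityʳ _))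
    select {1F} x∈ f = ≈-trans (+-cong (omitted x∈ λ ()) (+-cong (chosen x∈ refl) (omitted x∈ λ ())))
        (≈-trans (+-identityˡ _) (+-identityʳ _))
    select {2F} x∈ f = ≈-trans (+-cong (omitted x∈ λ ()) (+-cong (omitted x∈ λ ()) (chosen x∈ refl)))
        (≈-trans (+-identityˡ _) (+-identityˡ _))

    sum-indicator : ∀ {n} (b : Fin n → Bool) x → sum (λ t → if b t then x else 0#) ≈ ℕSum.sum
        (λ t → ⟦ b t ⟧ᵇ) · x
    sum-indicator {zero}  b x = ≈-refl
    sum-indicator {suc n} b x with b 0F
    ... | true  = +-congˡ (sum-indicator (b ∘ Fin.suc) x)
    ... | false = ≈-trans (+-identityˡ _) (sum-indicator (b ∘ Fin.suc) x)

    *-if : ∀ b x y → x * (if b then y else 0#) ≈ (if b then x * y else 0#)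
    *-if true  x y = ≈-refl
    *-if false x y = zeroʳ x

    if-cong : ∀ b {x y : Carrier} → x ≈ y → (if b then x else 0#) ≈ (if b then y else 0#)
    if-cong true  x≈y = x≈y
    if-cong false x≈y = ≈-refl

    if-∧ : ∀ b b′ (x : Carrier) → (if b then (if b′ then x else 0#) else 0#) ≈ (if b ∧ b′ then x else 0#)
    if-∧ true  b′ x = ≈-refl
    if-∧ false b′ x = ≈-refl

    if-+ : ∀ b x y → (if b then x + y else 0#) ≈ (if b then x else 0#) + (if b then y else 0#)
    if-+ true  x y = ≈-refl
    if-+ false x y = ≈-sym (+-identityˡ 0#)

    sum-if : ∀ {n} b (f : Fin n → Carrier) → sum (λ j → if b then f j else 0#) ≈ (if b then sum f else 0#)
    sum-if true  f = ≈-refl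
    sum-if {n} false f = sum-replicate-zero n

    module _ (ψ : Fin p → Carrier) where

      -- Used twice: for `ψ j = ζ ^ j` in `ℂ` it is a Gaussian period, for `ψ = 1` in `ℕ` it is the
      -- size of a coset.
      period : Fin 3 → Carrier
      period k = sum (λ j → if coset? k j then ψ j else 0#)

      -- Multiplication by `m` carries the coset of index `k` onto that of index `k ⊞ l`, so it
      -- permutes the periods.
      sum-scaled : ∀ {l m} → m ∈ C l → ∀ k → sum (λ j → if coset? k j then ψ (j ⊗ m) else 0#) ≈ period (k ⊞ l)
      sum-scaled {l} {m} m∈ k = ≈-sym (begin
        sum (λ j → if coset? (k ⊞ l) j then ψ j else 0#)
          ≈⟨ sum-permute (λ j → if coset? (k ⊞ l) j then ψ j else 0#) (scale m (∈C⇒nonzero m∈)) ⟩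
        sum (λ j → if coset? (k ⊞ l) (m ⊗ j) then ψ (m ⊗ j) else 0#)
          ≡⟨ sum-cong-≗ (λ j → cong₂ (λ b x → if b then ψ x else 0#)
               (trans (cong (λ i → coset? i (m ⊗ j)) (⊞-comm k l)) (coset?-⊗ m∈ k j)) (⊗-comm m j)) ⟩
        sum (λ j → if coset? k j then ψ (j ⊗ m) else 0#) ∎)

      module _ (ψ-⊕ : ∀ x y → ψ (x ⊕ y) ≈ ψ x * ψ y) where

        -- Substitute b = a t: for a in C_k, b runs over C_{k+1} when t runs over C₁.
        period-product-term : ∀ k x → (if coset? k x then ψ x else 0#) * period (k ⊞ 1F) ≈
          sum (λ t → if coset? k x then (if coset? 1F t then ψ (x ⊗ (1ₚ ⊕ t)) else 0#) else 0#)
        period-product-term k x = ≈-trans (if-dec (λ b z → b * period (k ⊞ 1F) ≈ z)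
            (x ∈? C k) {z = if coset? k x then sum terms else 0#}
            (λ x∈ → ≈-trans (in-coset x∈) (≈-sym (if-≡ (coset?-true x∈))))
            (λ x∉ → ≈-trans (zeroˡ _) (≈-sym (if-≡ (dec-false (x ∈? C k) x∉)))))
          (≈-sym (sum-if (coset? k x) terms))
          where
          terms : Fin p → Carrier
          terms t = if coset? 1F t then ψ (x ⊗ (1ₚ ⊕ t)) else 0#
          in-coset : x ∈ C k → ψ x * period (k ⊞ 1F) ≈ sum terms
          in-coset x∈ = begin
            ψ x * period (k ⊞ 1F)
              ≈⟨ *-congˡ (sum-permute (λ j → if coset? (k ⊞ 1F) j then ψ j else 0#)
                  (scale x (∈C⇒nonzero x∈))) ⟩
            ψ x * sum (λ t → if coset? (k ⊞ 1F) (x ⊗ t) then ψ (x ⊗ t) else 0#)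
              ≡⟨ cong (ψ x *_) (sum-cong-≗ (λ t → cong (λ b → if b then ψ (x ⊗ t) else 0#)
                  (coset?-⊗ x∈ 1F t))) ⟩
            ψ x * sum (λ t → if coset? 1F t then ψ (x ⊗ t) else 0#)
              ≈⟨ *-distribˡ-sum (ψ x) (λ t → if coset? 1F t then ψ (x ⊗ t) else 0#) ⟩
            sum (λ t → ψ x * (if coset? 1F t then ψ (x ⊗ t) else 0#))
              ≈⟨ sum-cong-≋ (λ t → ≈-trans (*-if (coset? 1F t) (ψ x) (ψ (x ⊗ t))) (if-cong (coset? 1F t)
                  (ψ-factor t))) ⟩
            sum terms ∎
            where
            ψ-factor : ∀ t → ψ x * ψ (x ⊗ t) ≈ ψ (x ⊗ (1ₚ ⊕ t))
            ψ-factor t = ≈-trans (≈-sym (ψ-⊕ x (x ⊗ t)))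
              (reflexive (cong ψ (sym (trans (⊗-distribˡ x 1ₚ t) (cong (_⊕ x ⊗ t) (⊗-identityʳ x))))))

        private
          parts : Fin 3 → Fin 3 → Fin p → Carrier
          parts l k t = if both l t then period k else 0#

        -- For `t` in `C 1F` the factor `1 + t` is a unit in exactly one coset, of index `l` say,
        -- and by `sum-scaled` the sum is the period of index `k ⊞ l`; for other `t` everything
        -- vanishes.
        inner-sum : ∀ k t → sum (λ x → if coset? k x then (if coset? 1F t then ψ
            (x ⊗ (1ₚ ⊕ t)) else 0#) else 0#) ≈
          parts 0F k t + (parts 1F (k ⊞ 1F) t + parts 2F (k ⊞ 2F) t)
        inner-sum k t = begin
          sum (λ x → if coset? k x then (if coset? 1F t then ψ (x ⊗ (1ₚ ⊕ t)) else 0#) else 0#)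
            ≈⟨ sum-cong-≋ (λ x → if-swap (coset? k x) (coset? 1F t) (ψ (x ⊗ (1ₚ ⊕ t)))) ⟩
          sum (λ x → if coset? 1F t then (if coset? k x then ψ (x ⊗ (1ₚ ⊕ t)) else 0#) else 0#)
            ≈⟨ sum-if (coset? 1F t) (λ x → if coset? k x then ψ (x ⊗ (1ₚ ⊕ t)) else 0#) ⟩
          (if coset? 1F t then sum (λ x → if coset? k x then ψ (x ⊗ (1ₚ ⊕ t)) else 0#) else 0#)
            ≈⟨ if-dec (λ b z → b ≈ z) (t ∈? C 1F) {z = if coset? 1F t then S else 0#}
                 (λ t∈ → ≈-trans (classified (1+C₁-nonzero t∈)) (≈-sym (if-≡ (coset?-true t∈))))
                 (λ t∉ → ≈-sym (if-≡ (dec-false (t ∈? C 1F) t∉))) ⟩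
          (if coset? 1F t then S else 0#)
            ≈⟨ ≈-trans (if-+ (coset? 1F t) (s 0F) (s 1F + s 2F))
                (+-congˡ (if-+ (coset? 1F t) (s 1F) (s 2F))) ⟩
          (if coset? 1F t then s 0F else 0#) + ((if coset? 1F t then s 1F else 0#) + (if coset? 1F t then s 2F else 0#))
            ≈⟨ +-cong (≈-trans (if-∧ (coset? 1F t) (coset? 0F (1ₚ ⊕ t)) (period (k ⊞ 0F)))
                (if-cong (both 0F t) (reflexive (cong period (⊞-comm k 0F)))))
                 (+-cong (if-∧ (coset? 1F t) (coset? 1F (1ₚ ⊕ t)) (period (k ⊞ 1F)))
                     (if-∧ (coset? 1F t) (coset? 2F (1ₚ ⊕ t)) (period (k ⊞ 2F)))) ⟩
          parts 0F k t + (parts 1F (k ⊞ 1F) t + parts 2F (k ⊞ 2F) t) ∎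
          where
          if-swap : ∀ b b′ (x : Carrier) → (if b then (if b′ then x else 0#) else 0#)
              ≈ (if b′ then (if b then x else 0#) else 0#)
          if-swap true  true  x = ≈-refl
          if-swap true  false x = ≈-refl
          if-swap false true  x = ≈-refl
          if-swap false false x = ≈-refl
          s : Fin 3 → Carrier
          s l = if coset? l (1ₚ ⊕ t) then period (k ⊞ l) else 0#
          S : Carrier
          S = s 0F + (s 1F + s 2F)
          classified : 1ₚ ⊕ t ≢ 0ₚ → sum (λ x → if coset? k x then ψ (x ⊗ (1ₚ ⊕ t)) else 0#) ≈ S
          classified ≢0 = ≈-trans (sum-scaled (proj₂ (class (1ₚ ⊕ t) ≢0)) k)
              (≈-sym (select (proj₂ (class (1ₚ ⊕ t) ≢0)) (λ l → period (k ⊞ l))))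

        -- The double sum over `x` and `t` is summed over `t` first by `period-product-term` and
        -- over `x` first by `inner-sum`; `N l` of the values of `t` contribute the period of index
        -- `k ⊞ l`.
        period-product : ∀ k → period k * period (k ⊞ 1F) ≈
                         N 0F · period k + (N 1F · period (k ⊞ 1F) + N 2F · period (k ⊞ 2F))
        period-product k = begin
          period k * period (k ⊞ 1F)
            ≈⟨ *-distribʳ-sum (period (k ⊞ 1F)) (λ x → if coset? k x then ψ x else 0#) ⟩
          sum (λ x → (if coset? k x then ψ x else 0#) * period (k ⊞ 1F))
            ≈⟨ sum-cong-≋ (period-product-term k) ⟩
          sum (λ x → sum (λ t → if coset? k x then (if coset? 1F t then ψ (x ⊗ (1ₚ ⊕ t)) else 0#) else 0#))
            ≈⟨ ∑-comm {p} {p} (λ x t → if coset? k x then (if coset? 1F t then ψ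
                (x ⊗ (1ₚ ⊕ t)) else 0#) else 0#) ⟩
          sum (λ t → sum (λ x → if coset? k x then (if coset? 1F t then ψ (x ⊗ (1ₚ ⊕ t)) else 0#) else 0#))
            ≈⟨ sum-cong-≋ (inner-sum k) ⟩
          sum (λ t → parts 0F k t + (parts 1F (k ⊞ 1F) t + parts 2F (k ⊞ 2F) t))
            ≈⟨ ≈-trans (∑-distrib-+ (parts 0F k) (λ t → parts 1F (k ⊞ 1F) t + parts 2F (k ⊞ 2F) t))
                 (+-congˡ (∑-distrib-+ (parts 1F (k ⊞ 1F)) (parts 2F (k ⊞ 2F)))) ⟩
          sum (parts 0F k) + (sum (parts 1F (k ⊞ 1F)) + sum (parts 2F (k ⊞ 2F)))
            ≈⟨ +-cong (sum-indicator (both 0F) (period k))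
                (+-cong (sum-indicator (both 1F) (period (k ⊞ 1F))) (sum-indicator (both 2F)
                (period (k ⊞ 2F)))) ⟩
          N 0F · period k + (N 1F · period (k ⊞ 1F) + N 2F · period (k ⊞ 2F)) ∎

      sum-of-periods : ∀ {z} → ψ 0ₚ ≈ z → sum ψ ≈ z + (period 0F + (period 1F + period 2F))
      sum-of-periods {z} ψ0≈z = begin
        sum ψ
          ≈⟨ sum-cong-≋ pointwise ⟩
        sum (λ j → (if does (j Fin.≟ 0ₚ) then z else 0#) + (term 0F j + (term 1F j + term 2F j)))
          ≈⟨ ≈-trans (∑-distrib-+ (λ j → if does (j Fin.≟ 0ₚ) then z else 0#)
              (λ j → term 0F j + (term 1F j + term 2F j)))
               (+-congˡ (≈-trans (∑-distrib-+ (term 0F) (λ j → term 1F j + term 2F j))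
                   (+-congˡ (∑-distrib-+ (term 1F) (term 2F))))) ⟩
        sum (λ j → if does (j Fin.≟ 0ₚ) then z else 0#) + (period 0F + (period 1F + period 2F))
          ≈⟨ +-congʳ (≈-trans (sum-indicator (λ j → does (j Fin.≟ 0ₚ)) z)
              (≈-trans (×-congˡ (sum-indicator-≟ 0ₚ)) (+-identityʳ z))) ⟩
        z + (period 0F + (period 1F + period 2F)) ∎
        where
        term : Fin 3 → Fin p → Carrier
        term k j = if coset? k j then ψ j else 0#
        pointwise : ∀ j → ψ j ≈ (if does (j Fin.≟ 0ₚ) then z else 0#) + (term 0F j + (term 1F j + term 2F j))
        pointwise j = ≈-sym (if-dec (λ b w → b + (term 0F j + (term 1F j + term 2F j)) ≈ w)
            (j Fin.≟ 0ₚ) at-zero off-zero)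
          where
          at-zero : j ≡ 0ₚ → z + (term 0F j + (term 1F j + term 2F j)) ≈ ψ j
          at-zero refl = begin
            z + (term 0F 0ₚ + (term 1F 0ₚ + term 2F 0ₚ))  ≈⟨ +-congˡ (+-cong (if-≡ (coset?-0 0F))
                (+-cong (if-≡ (coset?-0 1F)) (if-≡ (coset?-0 2F)))) ⟩
            z + (0# + (0# + 0#))                          ≈⟨ +-congˡ (≈-trans (+-identityˡ _)
                (+-identityˡ _)) ⟩
            z + 0#                                        ≈⟨ +-identityʳ z ⟩
            z                                             ≈⟨ ψ0≈z ⟨
            ψ 0ₚ                                          ∎
          off-zero : j ≢ 0ₚ → 0# + (term 0F j + (term 1F j + term 2F j)) ≈ ψ j
          off-zero j≢0 = ≈-trans (+-identityˡ _) (select (proj₂ (class j j≢0)) (λ _ → ψ j))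

  open InSemiring ℕ.+-*-commutativeSemiring

  card : ℕ
  card = period (λ _ → 1) 1F

  -- The constant function 1 in `ℕ` turns `sum-of-periods` into a count of all residues, and
  -- `sum-scaled` by an element of `C 1F` shows that the three cosets have equal size.
  3card+1≡p : 1 ℕ.+ 3 ℕ.* card ≡ p
  3card+1≡p = begin
    1 ℕ.+ (card ℕ.+ (card ℕ.+ (card ℕ.+ 0)))
      ≡⟨ cong (λ z → 1 ℕ.+ z) (cong₂ ℕ._+_ card≡ (cong₂ ℕ._+_ refl (trans (ℕ.+-identityʳ card) card≡₂))) ⟩
    1 ℕ.+ (period (λ _ → 1) 0F ℕ.+ (period (λ _ → 1) 1F ℕ.+ period (λ _ → 1) 2F))
      ≡⟨ sum-of-periods (λ _ → 1) refl ⟨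
    ℕSum.sum {p} (λ _ → 1)
      ≡⟨ sum-ones p ⟩
    p ∎
    where
    open ≡-Reasoning
    sum-ones : ∀ n → ℕSum.sum {n} (λ _ → 1) ≡ n
    sum-ones zero    = refl
    sum-ones (suc n) = cong suc (sum-ones n)
    card≡ : card ≡ period (λ _ → 1) 0F
    card≡ = sym (sum-scaled (λ _ → 1) {l = 1F} (⇒∈C 1F ~-refl) 0F)
    card≡₂ : card ≡ period (λ _ → 1) 2F
    card≡₂ = sum-scaled (λ _ → 1) {l = 1F} (⇒∈C 1F ~-refl) 1F

  -- For `t` in `C 1F`, `1 + t` is nonzero and so lies in exactly one coset.
  N-sum : N 0F ℕ.+ (N 1F ℕ.+ N 2F) ≡ card
  N-sum = trans (sym (trans (ℕSum.∑-distrib-+ (λ t → ⟦ both 0F t ⟧ᵇ)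
      (λ t → ⟦ both 1F t ⟧ᵇ ℕ.+ ⟦ both 2F t ⟧ᵇ))
      (cong (N 0F ℕ.+_) (ℕSum.∑-distrib-+ (λ t → ⟦ both 1F t ⟧ᵇ) (λ t → ⟦ both 2F t ⟧ᵇ)))))
    (ℕSum.sum-cong-≗ pointwise)
    where
    pointwise : ∀ t → ⟦ both 0F t ⟧ᵇ ℕ.+ (⟦ both 1F t ⟧ᵇ ℕ.+ ⟦ both 2F t ⟧ᵇ) ≡ ⟦ coset? 1F t ⟧ᵇ
    pointwise t = by-dec (t ∈? C 1F) refl
      where
      Goal : Bool → Set
      Goal b = ⟦ b ∧ coset? 0F (1ₚ ⊕ t) ⟧ᵇ ℕ.+ (⟦ b ∧ coset? 1F (1ₚ ⊕ t) ⟧ᵇ ℕ.+ ⟦ b ∧ coset? 2F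
          (1ₚ ⊕ t) ⟧ᵇ) ≡ ⟦ b ⟧ᵇ
      by-dec : (t∈? : Dec (t ∈ C 1F)) → does t∈? ≡ coset? 1F t → Goal (coset? 1F t)
      by-dec (no  _)  eq = subst Goal eq refl
      by-dec (yes t∈) eq = subst Goal eq (select (proj₂ (class (1ₚ ⊕ t) (1+C₁-nonzero t∈))) (λ _ → 1))

-- Representations 4 p = L² + 27 M²

module QuadraticForm where
  open import Data.Integer.Base using (_+_; _*_; _-_; -_)
  open ≡ using (refl; cong; cong₂; sym; trans)
  open +-*-Solver

  square-abs : ∀ x → x * x ≡ + (ℤ.∣ x ∣ ℕ.* ℤ.∣ x ∣)
  square-abs (+ n)    = sym (ℤ.pos-* n n)
  square-abs -[1+ n ] = refl

  -- In x² + 27 (q p)² = 16 p² the second summand is too large unless q = 0.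
  multiplier-zero : ∀ {p} .{{_ : ℕ.NonZero p}} x q → x * x + + 27 * ((q * + p) * (q * + p))
      ≡ + 16 * (+ p * + p) → q ≡ + 0
  multiplier-zero {p} x q eq = by-abs ℤ.∣ q ∣ refl
   where
   by-abs : ∀ n → ℤ.∣ q ∣ ≡ n → q ≡ + 0
   by-abs zero    ∣q∣≡ = ℤ.∣i∣≡0⇒i≡0 ∣q∣≡
   -- `17 ≤ 17 + 10` is `16 < 27`.
   by-abs (suc k) ∣q∣≡ = contradiction too-large (ℕ.<⇒≱ (ℕ.*-monoˡ-< (p ℕ.* p) {{ℕ.m*n≢0 p p}} {16} {27}
       (ℕ.m≤m+n 17 10)))
    where
    open ≡-Reasoning
    ∣qp∣ : ℤ.∣ q * + p ∣ ≡ suc k ℕ.* p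
    ∣qp∣ = trans (ℤ.abs-* q (+ p)) (cong (ℕ._* p) ∣q∣≡)
    eq′ : ℤ.∣ x ∣ ℕ.* ℤ.∣ x ∣ ℕ.+ 27 ℕ.* ((suc k ℕ.* p) ℕ.* (suc k ℕ.* p)) ≡ 16 ℕ.* (p ℕ.* p)
    eq′ = ℤ.+-injective (begin
      + (ℤ.∣ x ∣ ℕ.* ℤ.∣ x ∣) + + (27 ℕ.* ((suc k ℕ.* p) ℕ.* (suc k ℕ.* p)))
        ≡⟨ cong₂ ℤ._+_ (square-abs x) (trans (sym (ℤ.pos-* 27 (ℤ.∣ q * + p ∣ ℕ.* ℤ.∣ q * + p ∣)) )
            (cong (λ n → + (27 ℕ.* (n ℕ.* n))) ∣qp∣)) ⟨
      x * x + + 27 * + (ℤ.∣ q * + p ∣ ℕ.* ℤ.∣ q * + p ∣)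
        ≡⟨ cong (λ z → x * x + + 27 * z) (square-abs (q * + p)) ⟨
      x * x + + 27 * ((q * + p) * (q * + p)) ≡⟨ eq ⟩
      + 16 * (+ p * + p) ≡⟨ cong (+ 16 *_) (ℤ.pos-* p p) ⟨
      + 16 * + (p ℕ.* p)   ≡⟨ ℤ.pos-* 16 (p ℕ.* p) ⟨
      + (16 ℕ.* (p ℕ.* p)) ∎)
    p≤ : p ℕ.≤ suc k ℕ.* p
    p≤ = ℕ.m≤m+n p (k ℕ.* p)
    too-large : 27 ℕ.* (p ℕ.* p) ℕ.≤ 16 ℕ.* (p ℕ.* p)
    too-large = ℕ.≤-trans (ℕ.*-monoʳ-≤ 27 (ℕ.*-mono-≤ p≤ p≤))
        (ℕ.≤-trans (ℕ.m≤n+m _ (ℤ.∣ x ∣ ℕ.* ℤ.∣ x ∣)) (ℕ.≤-reflexive eq′))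

  square-one : ∀ x → x * x ≡ + 1 → x ≡ + 1 ⊎ x ≡ - + 1
  square-one x x²≡1 = Sum.map (ℤ.i-j≡0⇒i≡j x (+ 1)) (ℤ.i-j≡0⇒i≡j x (- + 1))
    (ℤ.i*j≡0⇒i≡0∨j≡0 (x - + 1) (trans (solve 1 (λ x → (x :- con (+ 1)) :* (x :- con (- + 1))
        := x :* x :- con (+ 1)) refl x) (cong (_- + 1) x²≡1)))

  Unique : ℤ → ℤ → ℤ → Set
  Unique K L M = M * M ≡ + 1 × (L ≡ K ⊎ L ≡ - K)

  -- The norm form is multiplicative: `(L K + 27 M)² + 27 (L - K M)² = (K² + 27) (L² + 27 M²) = 16
  -- p²`. A nonzero multiple of `p` in the second square is too large, so `L = K M`; then `4 p = (K²
  -- + 27) M² = 4 p M²` gives `M² = 1`.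
  unique-if-divides : ∀ {p} .{{_ : ℕ.NonZero p}} K L M →
    + 4 * + p ≡ K * K + + 27 → + 4 * + p ≡ L * L + + 27 * (M * M) →
    ∀ q → L - K * M ≡ q * + p → Unique K L M
  unique-if-divides {p} K L M 4p≡K 4p≡L q eq = M²≡1 , Sum.map
      (λ M≡1 → trans L≡KM (trans (cong (K *_) M≡1) (ℤ.*-identityʳ K)))
      (λ M≡-1 → trans L≡KM (trans (cong (K *_) M≡-1) (solve 1 (λ K → K :* con (- + 1) := :- K) refl K)))
      (square-one M M²≡1)
    where
    open ≡-Reasoning
    norm : (L * K + + 27 * M) * (L * K + + 27 * M) + + 27 * ((q * + p) * (q * + p)) ≡ + 16 * (+ p * + p)
    norm = begin
      (L * K + + 27 * M) * (L * K + + 27 * M) + + 27 * ((q * + p) * (q * + p))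
        ≡⟨ cong (λ z → (L * K + + 27 * M) * (L * K + + 27 * M) + + 27 * (z * z)) eq ⟨
      (L * K + + 27 * M) * (L * K + + 27 * M) + + 27 * ((L - K * M) * (L - K * M))
        ≡⟨ solve 3 (λ K L M → (L :* K :+ con (+ 27) :* M) :* (L :* K :+ con (+ 27) :* M)
            :+ con (+ 27) :* ((L :- K :* M) :* (L :- K :* M))
                      := (K :* K :+ con (+ 27)) :* (L :* L :+ con (+ 27) :* (M :* M))) refl K L M ⟩
      (K * K + + 27) * (L * L + + 27 * (M * M)) ≡⟨ cong₂ ℤ._*_ 4p≡K 4p≡L ⟨
      (+ 4 * + p) * (+ 4 * + p) ≡⟨ solve 1 (λ p → (con (+ 4) :* p) :* (con (+ 4) :* p)
          := con (+ 16) :* (p :* p)) refl (+ p) ⟩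
      + 16 * (+ p * + p) ∎
    L≡KM : L ≡ K * M
    L≡KM = ℤ.i-j≡0⇒i≡j _ _ (trans eq (trans (cong (_* + p) (multiplier-zero (L * K + + 27 * M) q norm))
        (ℤ.*-zeroˡ (+ p))))
    M²≡1 : M * M ≡ + 1
    M²≡1 = sym (ℤ.*-cancelˡ-≡ (+ 4 * + p) (+ 1) (M * M) {{ℤ.i*j≢0 (+ 4) (+ p)}} (begin
      + 4 * + p * + 1 ≡⟨ ℤ.*-identityʳ (+ 4 * + p) ⟩
      + 4 * + p ≡⟨ 4p≡L ⟩
      L * L + + 27 * (M * M) ≡⟨ cong (λ z → z * z + + 27 * (M * M)) L≡KM ⟩
      (K * M) * (K * M) + + 27 * (M * M) ≡⟨ solve 2 (λ K M → (K :* M) :* (K :* M)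
          :+ con (+ 27) :* (M :* M) := (K :* K :+ con (+ 27)) :* (M :* M)) refl K M ⟩
      (K * K + + 27) * (M * M) ≡⟨ cong (_* (M * M)) 4p≡K ⟨
      + 4 * + p * (M * M) ∎))

  -- `(L - K M) (L + K M) = L² - K² M² = 4 p (1 - M²)`, so `p` divides one of the factors; the
  -- second case is the first with `- M` for `M`.
  unique-representation : ∀ {p} (p-prime : Prime p) K L M →
    + 4 * + p ≡ K * K + + 27 → + 4 * + p ≡ L * L + + 27 * (M * M) → Unique K L M
  unique-representation {p} p-prime K L M 4p≡K 4p≡L
    with euclidsLemma ℤ.∣ L - K * M ∣ ℤ.∣ L + K * M ∣ p-prime p∣
    where
    open ≡-Reasoning
    product : (L - K * M) * (L + K * M) ≡ (+ 4 * (+ 1 - M * M)) * + p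
    product = begin
      (L - K * M) * (L + K * M)
        ≡⟨ solve 3 (λ K L M → (L :- K :* M) :* (L :+ K :* M)
            := (L :* L :+ con (+ 27) :* (M :* M)) :- (K :* K :+ con (+ 27)) :* (M :* M)) refl K L M ⟩
      (L * L + + 27 * (M * M)) - (K * K + + 27) * (M * M) ≡⟨ cong₂ (λ a b → a - b * (M * M)) 4p≡L 4p≡K ⟨
      + 4 * + p - + 4 * + p * (M * M)
        ≡⟨ solve 2 (λ M p → con (+ 4) :* p :- con (+ 4) :* p :* (M :* M)
            := (con (+ 4) :* (con (+ 1) :- M :* M)) :* p) refl M (+ p) ⟩
      (+ 4 * (+ 1 - M * M)) * + p ∎
    p∣ : p ℕ.∣ ℤ.∣ L - K * M ∣ ℕ.* ℤ.∣ L + K * M ∣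
    p∣ = ℕ.divides ℤ.∣ + 4 * (+ 1 - M * M) ∣ (trans (sym (ℤ.abs-* (L - K * M) (L + K * M)))
           (trans (cong ℤ.∣_∣ product) (ℤ.abs-* (+ 4 * (+ 1 - M * M)) (+ p))))
  ... | inj₁ p∣L-KM with Signed.∣ᵤ⇒∣ {+ p} {L - K * M} p∣L-KM
  ...   | Signed.divides q eq = unique-if-divides {{prime⇒nonZero p-prime}} K L M 4p≡K 4p≡L q eq
  unique-representation {p} p-prime K L M 4p≡K 4p≡L | inj₂ p∣L+KM with Signed.∣ᵤ⇒∣ {+ p} {L + K * M} p∣L+KM
  ...   | Signed.divides q eq = trans (sym (neg-square M)) (proj₁ u) , proj₂ u
    where
    neg-square : ∀ M → (- M) * (- M) ≡ M * M
    neg-square = solve 1 (λ M → (:- M) :* (:- M) := M :* M) refl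
    u = unique-if-divides {{prime⇒nonZero p-prime}} K L (- M) 4p≡K
      (trans 4p≡L (cong (λ z → L * L + + 27 * z) (sym (neg-square M)))) q
      (trans (solve 3 (λ K L M → L :- K :* (:- M) := L :+ K :* M) refl K L M) eq)

  3*x≢1 : ∀ x → + 3 * x ≢ + 1
  3*x≢1 x eq with ℤ.∣ x ∣ | trans (sym (ℤ.abs-* (+ 3) x)) (cong ℤ.∣_∣ eq)
  ... | zero  | ()
  ... | suc n | e = contradiction (ℕ.m+n≡0⇒n≡0 n (ℕ.suc-injective e)) λ ()

  -- L = 9 n - p - 1 with p = 1 + 3 g is 1 modulo 3, as is 1 + 3 k: this excludes
  -- L = - (1 + 3 k).
  cyclotomic-number : ∀ {p} (p-prime : Prime p) k g n t L M →
    + p ≡ + 1 + + 3 * g →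
    + 4 * + p ≡ (+ 1 + + 3 * k) * (+ 1 + + 3 * k) + + 27 →
    (+ 1 + + 3 * k) + + p + + 1 ≡ + 9 * t →
    L ≡ + 9 * n - + p - + 1 →
    + 4 * + p ≡ L * L + + 27 * (M * M) →
    M * M ≡ + 1 × n ≡ t
  cyclotomic-number {p} p-prime k g n t L M p≡ 4p≡K 9t≡ L≡ 4p≡L =
    Prod.map₂ [ same-sign , (λ L≡-K → contradiction (opposite-sign L≡-K) (3*x≢1 (+ 3 * n - g + k))) ]′
      (unique-representation p-prime (+ 1 + + 3 * k) L M 4p≡K 4p≡L)
    where
    open ≡-Reasoning
    same-sign : L ≡ + 1 + + 3 * k → n ≡ t
    same-sign L≡K = ℤ.*-cancelˡ-≡ (+ 9) n t (begin
      + 9 * n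
        ≡⟨ solve 2 (λ n p → con (+ 9) :* n := con (+ 9) :* n :- p :- con (+ 1) :+ p :+ con (+ 1)) refl n (+ p) ⟩
      + 9 * n - + p - + 1 + + p + + 1   ≡⟨ cong (λ z → z + + p + + 1) (trans (sym L≡) L≡K) ⟩
      (+ 1 + + 3 * k) + + p + + 1       ≡⟨ 9t≡ ⟩
      + 9 * t                           ∎)
    opposite-sign : L ≡ - (+ 1 + + 3 * k) → + 3 * (+ 3 * n - g + k) ≡ + 1
    opposite-sign L≡-K = begin
      + 3 * (+ 3 * n - g + k)
        ≡⟨ solve 3 (λ n g k → con (+ 3) :* (con (+ 3) :* n :- g :+ k) :=
             (con (+ 9) :* n :- (con (+ 1) :+ con (+ 3) :* g) :- con (+ 1))
             :+ (con (+ 1) :+ con (+ 3) :* k) :+ con (+ 1)) refl n g k ⟩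
      (+ 9 * n - (+ 1 + + 3 * g) - + 1) + (+ 1 + + 3 * k) + + 1
        ≡⟨ cong (λ z → z + (+ 1 + + 3 * k) + + 1)
             (trans (cong (λ p → + 9 * n - p - + 1) (sym p≡)) (trans (sym L≡) L≡-K)) ⟩
      - (+ 1 + + 3 * k) + (+ 1 + + 3 * k) + + 1
        ≡⟨ solve 1 (λ K → :- K :+ K :+ con (+ 1) := con (+ 1)) refl (+ 1 + + 3 * k) ⟩
      + 1 ∎

-- The cubic of the periods

module CyclotomicIdentities where
  open import Data.Integer.Base using (_+_; _*_; _-_; -_)
  open +-*-Solver

  -- With symmetric functions `-1`, `- f` and `T / 3`, the long bracket is 27 times the
  -- discriminant, the factor 27 clearing the denominators. Completing the square in `d` turns it
  -- into `p² (4 p - L²)`.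
  discriminant-identity : ∀ f d p T L → p ≡ + 1 + + 3 * f → T ≡ - (f * f) + d * p → L ≡ + 9 * d - p - + 1 →
    p * p * (+ 4 * p) ≡ p * p * (L * L) ℤ.+
      (+ 27 * (f * f) + + 108 * (f * f * f) + + 36 * T + + 162 * (f * T) - + 81 * (T * T))
  discriminant-identity f d p T L ≡.refl ≡.refl ≡.refl =
    solve 2 (λ f d → let p = con (+ 1) :+ con (+ 3) :* f ; T = :- (f :* f) :+ d :* p ; L = con (+ 9) :* d :- p :- con (+ 1) in
      p :* p :* (con (+ 4) :* p) := p :* p :* (L :* L) :+
      (con (+ 27) :* (f :* f) :+ con (+ 108) :* (f :* f :* f) :+ con (+ 36) :* T
          :+ con (+ 162) :* (f :* T) :- con (+ 81) :* (T :* T))) ≡.refl f d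

  factor-p² : ∀ p L M → p * p * (L * L) + + 27 * ((M * p) * (M * p)) ≡ p * p * (L * L + + 27 * (M * M))
  factor-p² = solve 3 (λ p L M → p :* p :* (L :* L) :+ con (+ 27) :* ((M :* p) :* (M :* p))
      := p :* p :* (L :* L :+ con (+ 27) :* (M :* M))) ≡.refl

  square-* : ∀ M p → (M * p) * (M * p) ≡ (M * M) * (p * p)
  square-* = solve 2 (λ M p → (M :* p) :* (M :* p) := (M :* M) :* (p :* p)) ≡.refl

  -- This is `4 p = (2 h + 3)² + 27` at `h = 3 m + 1`, where `p = 9 m² + 15 m + 13`. There
  -- `2 h + 3 = 6 m + 5` is 2 modulo 3, so the root that is 1 modulo 3 is `K = - (2 h + 3)`. At
  -- `h = 3 m - 1`, where `p = 9 m² + 3 m + 7`, it is `2 h + 3 = 6 m + 1` itself.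
  norm₁ : ∀ m → let K = + 1 + + 3 * (- (+ 2 * m) - + 2) in
    + 4 * (+ 9 * (m * m) + + 15 * m + + 13) ≡ K * K + + 27
  norm₁ = solve 1 (λ m → let K = con (+ 1) :+ con (+ 3) :* (:- (con (+ 2) :* m) :- con (+ 2)) in
    con (+ 4) :* (con (+ 9) :* (m :* m) :+ con (+ 15) :* m :+ con (+ 13)) := K :* K :+ con (+ 27)) ≡.refl

  norm₂ : ∀ m → let K = + 1 + + 3 * (+ 2 * m) in
    + 4 * (+ 9 * (m * m) + + 3 * m + + 7) ≡ K * K + + 27
  norm₂ = solve 1 (λ m → let K = con (+ 1) :+ con (+ 3) :* (con (+ 2) :* m) in
    con (+ 4) :* (con (+ 9) :* (m :* m) :+ con (+ 3) :* m :+ con (+ 7)) := K :* K :+ con (+ 27)) ≡.refl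

  -- The cyclotomic number `(K + p + 1) / 9` comes out as `m² + m + 1` in both cases.
  nine-fold₁ : ∀ m → (+ 1 + + 3 * (- (+ 2 * m) - + 2)) + (+ 9 * (m * m) + + 15 * m + + 13) + + 1 ≡
    + 9 * (m * m + m + + 1)
  nine-fold₁ = solve 1 (λ m → (con (+ 1) :+ con (+ 3) :* (:- (con (+ 2) :* m) :- con (+ 2)))
    :+ (con (+ 9) :* (m :* m) :+ con (+ 15) :* m :+ con (+ 13)) :+ con (+ 1)
    := con (+ 9) :* (m :* m :+ m :+ con (+ 1))) ≡.refl

  nine-fold₂ : ∀ m → (+ 1 + + 3 * (+ 2 * m)) + (+ 9 * (m * m) + + 3 * m + + 7) + + 1 ≡
    + 9 * (m * m + m + + 1)
  nine-fold₂ = solve 1 (λ m → (con (+ 1) :+ con (+ 3) :* (con (+ 2) :* m))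
    :+ (con (+ 9) :* (m :* m) :+ con (+ 3) :* m :+ con (+ 7)) :+ con (+ 1)
    := con (+ 9) :* (m :* m :+ m :+ con (+ 1))) ≡.refl

  third-of-p-1₁ : ∀ m → + 9 * (m * m) + + 15 * m + + 13 ≡ + 1 + + 3 * (+ 3 * (m * m) + + 5 * m + + 4)
  third-of-p-1₁ = solve 1 (λ m → con (+ 9) :* (m :* m) :+ con (+ 15) :* m :+ con (+ 13) := con (+ 1)
      :+ con (+ 3) :* (con (+ 3) :* (m :* m) :+ con (+ 5) :* m :+ con (+ 4))) ≡.refl

  third-of-p-1₂ : ∀ m → + 9 * (m * m) + + 3 * m + + 7 ≡ + 1 + + 3 * (+ 3 * (m * m) + m + + 2)
  third-of-p-1₂ = solve 1 (λ m → con (+ 9) :* (m :* m) :+ con (+ 3) :* m :+ con (+ 7) := con (+ 1)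
      :+ con (+ 3) :* (con (+ 3) :* (m :* m) :+ m :+ con (+ 2))) ≡.refl

  -- `- f² + d p` is three times the product of the periods; the cofactor of 3 on the right is minus
  -- the constant term of `G₁`, and of `G₂` in the next lemma.
  triple-product₁ : ∀ m → let f = + 3 * (m * m) + + 5 * m + + 4 in
    - (f * f) + (m * m + m + + 1) * (+ 9 * (m * m) + + 15 * m + + 13) ≡
    + 3 * (- (+ 2 * (m * m * m) + + 4 * (m * m) + + 4 * m + + 1))
  triple-product₁ = solve 1 (λ m → let f = con (+ 3) :* (m :* m) :+ con (+ 5) :* m :+ con (+ 4) in
    :- (f :* f) :+ (m :* m :+ m :+ con (+ 1)) :* (con (+ 9) :* (m :* m) :+ con (+ 15) :* m :+ con (+ 13)) :=
    con (+ 3) :* (:- (con (+ 2) :* (m :* m :* m) :+ con (+ 4) :* (m :* m) :+ con (+ 4) :* m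
        :+ con (+ 1)))) ≡.refl

  triple-product₂ : ∀ m → let f = + 3 * (m * m) + m + + 2 in
    - (f * f) + (m * m + m + + 1) * (+ 9 * (m * m) + + 3 * m + + 7) ≡
    + 3 * (+ 2 * (m * m * m) + + 2 * (m * m) + + 2 * m + + 1)
  triple-product₂ = solve 1 (λ m → let f = con (+ 3) :* (m :* m) :+ m :+ con (+ 2) in
    :- (f :* f) :+ (m :* m :+ m :+ con (+ 1)) :* (con (+ 9) :* (m :* m) :+ con (+ 3) :* m :+ con (+ 7)) :=
    con (+ 3) :* (con (+ 2) :* (m :* m :* m) :+ con (+ 2) :* (m :* m) :+ con (+ 2) :* m :+ con (+ 1))) ≡.refl

module CubicRelations {c ℓ : Level} (K : CommutativeRing c ℓ) where
  open CommutativeRing K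
  open RingProperties ring using (x∙y⁻¹≈ε⇒x≈y)
  open IntegerEmbedding K public
  open IntegerSolver K homomorphism public
  open SetoidReasoning setoid
  open CyclotomicIdentities
  open Mult semiring using (×-assoc-*; ×-congʳ) renaming (_×_ to _·_)
  open SemiringMult semiring using (×ᵤ≈×)

  ·≈ι* : ∀ n x → n · x ≈ ι (+ n) * x
  ·≈ι* n x = trans (×-congʳ n (sym (*-identityˡ x))) (trans (sym (×-assoc-* n 1# x)) (*-congʳ (×ᵤ≈× n 1#)))

  ≈⇒-≈0 : ∀ {x y} → x ≈ y → x - y ≈ 0#
  ≈⇒-≈0 {x} {y} x≈y = trans (+-congʳ x≈y) (-‿inverseʳ y)

  -≈0⇒≈ : ∀ {x y} → x - y ≈ 0# → x ≈ y
  -≈0⇒≈ {x} {y} = x∙y⁻¹≈ε⇒x≈y x y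

  -- The solver's variables range over the target ring, so integer expressions under `ι` are
  -- expanded by hand with these rules.
  hom-+ : ∀ x y {x′ y′} → ι x ≈ x′ → ι y ≈ y′ → ι (x ℤ.+ y) ≈ x′ + y′
  hom-+ x y p q = trans (ι-+ x y) (+-cong p q)

  hom-* : ∀ x y {x′ y′} → ι x ≈ x′ → ι y ≈ y′ → ι (x ℤ.* y) ≈ x′ * y′
  hom-* x y p q = trans (ι-* x y) (*-cong p q)

  hom-neg : ∀ x {x′} → ι x ≈ x′ → ι (ℤ.- x) ≈ - x′
  hom-neg x p = trans (ι-neg x) (-‿cong p)

  *≈0 : ∀ {r} x → r ≈ 0# → x * r ≈ 0#
  *≈0 x r≈0 = trans (*-congˡ r≈0) (zeroʳ x)

  infixl 6 _⊹_
  -- For proofs by ideal membership: the solver writes a difference as a combination of expressions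
  -- that vanish by hypothesis, and `_⊹_` and `*≈0` list, in the same order, why each summand
  -- vanishes.
  _⊹_ : ∀ {x y} → x ≈ 0# → y ≈ 0# → x + y ≈ 0#
  p ⊹ q = trans (+-cong p q) (+-identityˡ 0#)

  cubic-expansion : ∀ X x y z → (X - x) * ((X - y) * (X - z)) ≈
    X * X * X - (x + y + z) * X * X + (x * y + y * z + z * x) * X - x * y * z
  cubic-expansion = solve 4 (λ X x y z → (X :- x) :* ((X :- y) :* (X :- z)) :=
    X :* X :* X :- (x :+ y :+ z) :* X :* X :+ (x :* y :+ y :* z :+ z :* x) :* X :- x :* y :* z) refl

  differences-factor : ∀ x y z → (x - y) * ((y - z) * (x - z))
      ≈ (x * x * y + y * y * z + z * z * x) - (x * y * y + y * z * z + z * x * x)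
  differences-factor = solve 3 (λ x y z → (x :- y) :* ((y :- z) :* (x :- z)) :=
    (x :* x :* y :+ y :* y :* z :+ z :* z :* x) :- (x :* y :* y :+ y :* z :* z :+ z :* x :* x)) refl

  module _ {x y z a b d f : Carrier}
    (xy≈ : x * y ≈ a * x + (b * y + d * z))
    (yz≈ : y * z ≈ a * y + (b * z + d * x))
    (zx≈ : z * x ≈ a * z + (b * x + d * y))
    (sum≈ : 1# + (x + (y + z)) ≈ 0#)
    (f≈ : a + (b + d) ≈ f) where

    private
      r₀ = sum≈
      r₁ = ≈⇒-≈0 xy≈
      r₂ = ≈⇒-≈0 yz≈
      r₃ = ≈⇒-≈0 zx≈
      r₄ = ≈⇒-≈0 (sym f≈)

    e₁≈ : x + y + z ≈ - 1#
    e₁≈ = -≈0⇒≈ (trans (solve 3 (λ x y z → x :+ y :+ z :- (:- con (+ 1)) := con (+ 1)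
        :+ (x :+ (y :+ z))) refl x y z) r₀)

    -- The three product relations add up to `(a + b + d) (x + y + z)`.
    e₂≈ : x * y + y * z + z * x ≈ - f
    e₂≈ = -≈0⇒≈ (trans
      (solve 7 (λ x y z a b d f → x :* y :+ y :* z :+ z :* x :- (:- f) :=
        (x :* y :- (a :* x :+ (b :* y :+ d :* z))) :+ (y :* z :- (a :* y :+ (b :* z :+ d :* x)))
            :+ (z :* x :- (a :* z :+ (b :* x :+ d :* y)))
        :+ (a :+ b :+ d) :* (con (+ 1) :+ (x :+ (y :+ z))) :+ (f :- (a :+ (b :+ d)))) refl x y z a b d f)
      (r₁ ⊹ r₂ ⊹ r₃ ⊹ *≈0 _ r₀ ⊹ r₄))

    private
      r₅ : x * y + y * z + z * x - (- f) ≈ 0#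
      r₅ = ≈⇒-≈0 e₂≈

    -- Multiplying each product relation by the missing root and adding gives
    -- `3 x y z = (a + b) e₂ + d (x² + y² + z²)`; then `x² + y² + z² = e₁² - 2 e₂`, and
    -- `a + b = f - d`.
    3e₃≈ : ι (+ 3) * (x * y * z) ≈ - (f * f) + d * (1# + ι (+ 3) * f)
    3e₃≈ = -≈0⇒≈ (trans
      (solve 7 (λ x y z a b d f → con (+ 3) :* (x :* y :* z) :- (:- (f :* f)
          :+ d :* (con (+ 1) :+ con (+ 3) :* f)) :=
        z :* (x :* y :- (a :* x :+ (b :* y :+ d :* z)))
            :+ x :* (y :* z :- (a :* y :+ (b :* z :+ d :* x)))
            :+ y :* (z :* x :- (a :* z :+ (b :* x :+ d :* y)))
        :+ (a :+ b :- con (+ 2) :* d) :* (x :* y :+ y :* z :+ z :* x :- (:- f))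
        :+ d :* (x :+ y :+ z :- con (+ 1)) :* (con (+ 1) :+ (x :+ (y :+ z)))
            :+ f :* (f :- (a :+ (b :+ d)))) refl x y z a b d f)
      (*≈0 _ r₁ ⊹ *≈0 _ r₂ ⊹ *≈0 _ r₃ ⊹ *≈0 _ r₅ ⊹ *≈0 _ r₀ ⊹ *≈0 _ r₄))

    -- The left side is `(x - y) x y + (y - z) y z + (z - x) z x`. On inserting the product
    -- relations `d` cancels, and `(a - b) (e₁² - 3 e₂)` remains.
    differences≈ : (x * x * y + y * y * z + z * z * x) - (x * y * y + y * z * z + z * x * x)
        ≈ (a - b) * (1# + ι (+ 3) * f)
    differences≈ = -≈0⇒≈ (trans
      (solve 7 (λ x y z a b d f → (x :* x :* y :+ y :* y :* z :+ z :* z :* x) :- (x :* y :* y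
          :+ y :* z :* z :+ z :* x :* x) :- (a :- b) :* (con (+ 1) :+ con (+ 3) :* f) :=
        (x :- y) :* (x :* y :- (a :* x :+ (b :* y :+ d :* z)))
            :+ (y :- z) :* (y :* z :- (a :* y :+ (b :* z :+ d :* x)))
            :+ (z :- x) :* (z :* x :- (a :* z :+ (b :* x :+ d :* y)))
        :+ (a :- b) :* (x :+ y :+ z :- con (+ 1)) :* (con (+ 1) :+ (x :+ (y :+ z)))
        :+ (:- (con (+ 3) :* (a :- b))) :* (x :* y :+ y :* z :+ z :* x :- (:- f))) refl x y z a b d f)
      (*≈0 _ r₁ ⊹ *≈0 _ r₂ ⊹ *≈0 _ r₃ ⊹ *≈0 _ r₀ ⊹ *≈0 _ r₅))

    -- With the factor 27 the product of the roots occurs only as its triple `T`, so no division by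
    -- 3 intervenes.
    27discriminant≈ : ∀ {T} → ι (+ 3) * (x * y * z) ≈ T →
      ι (+ 27) * (((a - b) * (1# + ι (+ 3) * f)) * ((a - b) * (1# + ι (+ 3) * f))) ≈
      ι (+ 27) * (f * f) + ι (+ 108) * (f * f * f) + ι (+ 36) * T + ι (+ 162) * (f * T) - ι (+ 81) * (T * T)
    27discriminant≈ {T} T≈ = begin
      ι (+ 27) * (((a - b) * (1# + ι (+ 3) * f)) * ((a - b) * (1# + ι (+ 3) * f)))
        ≈⟨ *-congˡ (*-cong differences≈ differences≈) ⟨
      ι (+ 27) * (w * w)
        ≈⟨ *-congˡ (CubicDiscriminant.discriminant K x y z) ⟩
      ι (+ 27) * disc (x + y + z) (x * y + y * z + z * x) e₃
        ≈⟨ *-congˡ (disc-cong e₁≈ e₂≈) ⟩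
      ι (+ 27) * disc (- 1#) (- f) e₃
        ≈⟨ solve 2 (λ f e₃ → let e₁ = :- con (+ 1) ; e₂ = :- f ; T = con (+ 3) :* e₃ in
             con (+ 27) :* (e₁ :* e₁ :* e₂ :* e₂ :- con (+ 4) :* (e₂ :* e₂ :* e₂) :- con (+ 4) :* (e₁ :* e₁ :* e₁ :* e₃) :+ con (+ 18) :* (e₁ :* e₂ :* e₃) :- con (+ 27) :* (e₃ :* e₃))
             := con (+ 27) :* (f :* f) :+ con (+ 108) :* (f :* f :* f) :+ con (+ 36) :* T
                 :+ con (+ 162) :* (f :* T) :- con (+ 81) :* (T :* T)) refl f e₃ ⟩
      (ι (+ 27) * (f * f) + ι (+ 108) * (f * f * f) + ι (+ 36) * (ι (+ 3) * e₃) + ι (+ 162) * (f * (ι (+ 3) * e₃)) - ι (+ 81) * ((ι (+ 3) * e₃) * (ι (+ 3) * e₃)))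
        ≈⟨ +-cong (+-cong (+-congˡ (*-congˡ T≈)) (*-congˡ (*-congˡ T≈))) (-‿cong (*-congˡ (*-cong T≈ T≈))) ⟩
      _ ∎
      where
      e₃ = x * y * z
      w = (x * x * y + y * y * z + z * z * x) - (x * y * y + y * z * z + z * x * x)
      disc : Carrier → Carrier → Carrier → Carrier
      disc e₁ e₂ e₃ = e₁ * e₁ * e₂ * e₂ - ι (+ 4) * (e₂ * e₂ * e₂) - ι (+ 4) * (e₁ * e₁ * e₁ * e₃) + ι (+ 18) * (e₁ * e₂ * e₃) - ι (+ 27) * (e₃ * e₃)
      disc-cong : ∀ {e₁ e₁′ e₂ e₂′} → e₁ ≈ e₁′ → e₂ ≈ e₂′ → disc e₁ e₂ e₃ ≈ disc e₁′ e₂′ e₃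
      disc-cong p q = +-congʳ (+-cong (+-cong (+-cong (*-cong (*-cong (*-cong p p) q) q)
          (-‿cong (*-congˡ (*-cong (*-cong q q) q))))
        (-‿cong (*-congˡ (*-congʳ (*-cong (*-cong p p) p))))) (*-congˡ (*-congʳ (*-cong p q))))

  module Integrality (ι-injective : ∀ {m n} → ι m ≈ ι n → m ≡ n)
    {third : Carrier} (third≈ : ι (+ 3) * third ≈ 1#)
    {x y z : Carrier} {a b d f p : ℕ}
    (xy≈ : x * y ≈ a · x + (b · y + d · z))
    (yz≈ : y * z ≈ a · y + (b · z + d · x))
    (zx≈ : z * x ≈ a · z + (b · x + d · y))
    (sum≈ : 1# + (x + (y + z)) ≈ 0#)
    (f≡ : a ℕ.+ (b ℕ.+ d) ≡ f) (p≡ : 1 ℕ.+ 3 ℕ.* f ≡ p) (p-prime : Prime p) where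

    private
      combine : ∀ {l r s t} → l ≈ a · r + (b · s + d · t) → l ≈ ι (+ a) * r + (ι (+ b) * s + ι (+ d) * t)
      combine eq = trans eq (+-cong (·≈ι* a _) (+-cong (·≈ι* b _) (·≈ι* d _)))

      f≈ : ι (+ a) + (ι (+ b) + ι (+ d)) ≈ ι (+ f)
      f≈ = trans (sym (hom-+ (+ a) (+ (b ℕ.+ d)) refl (hom-+ (+ b) (+ d) refl refl)))
          (reflexive (≡.cong (λ n → ι (+ n)) f≡))

      pℤ≡ : + p ≡ + 1 ℤ.+ + 3 ℤ.* + f
      pℤ≡ = ≡.sym (≡.trans (≡.cong (λ z → + 1 ℤ.+ z) (≡.sym (ℤ.pos-* 3 f))) (≡.cong +_ p≡))

      p≈ : ι (+ p) ≈ 1# + ι (+ 3) * ι (+ f)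
      p≈ = trans (reflexive (≡.cong ι pℤ≡)) (hom-+ (+ 1) (+ 3 ℤ.* + f) refl (hom-* (+ 3) (+ f) refl refl))

      -- T is three times the product of the roots, and 4 p = L² + 27 M².
      opaque
        T M L : ℤ
        T = ℤ.- (+ f ℤ.* + f) ℤ.+ + d ℤ.* + p
        M = + a ℤ.- + b
        L = + 9 ℤ.* + d ℤ.- + p ℤ.- + 1

        T≡ : T ≡ ℤ.- (+ f ℤ.* + f) ℤ.+ + d ℤ.* + p
        T≡ = ≡.refl

        M≡ : M ≡ + a ℤ.- + b
        M≡ = ≡.refl

        L≡ : L ≡ + 9 ℤ.* + d ℤ.- + p ℤ.- + 1
        L≡ = ≡.refl

      M≈ : ι M ≈ ι (+ a) - ι (+ b)
      M≈ = trans (reflexive (≡.cong ι M≡)) (hom-+ (+ a) (ℤ.- + b) refl (hom-neg (+ b) refl))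

      e₃-multiple : ι (+ 3) * (x * y * z) ≈ ι T
      e₃-multiple = trans (3e₃≈ (combine xy≈) (combine yz≈) (combine zx≈) sum≈ f≈)
        (sym (trans (reflexive (≡.cong ι T≡)) (hom-+ (ℤ.- (+ f ℤ.* + f)) (+ d ℤ.* + p)
            (hom-neg (+ f ℤ.* + f) (hom-* (+ f) (+ f) refl refl)) (hom-* (+ d) (+ p) refl p≈))))

      rhs : ℤ → ℤ → ℤ
      rhs f T = + 27 ℤ.* (f ℤ.* f) ℤ.+ + 108 ℤ.* (f ℤ.* f ℤ.* f) ℤ.+ + 36 ℤ.* T ℤ.+ + 162 ℤ.* (f ℤ.* T)
          ℤ.- + 81 ℤ.* (T ℤ.* T)

      ι-rhs : ∀ f T → ι (rhs f T)
          ≈ ι (+ 27) * (ι f * ι f) + ι (+ 108) * (ι f * ι f * ι f) + ι (+ 36) * ι T + ι (+ 162) * (ι f * ι T) - ι (+ 81) * (ι T * ι T)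
      ι-rhs f T =
        hom-+ (A ℤ.+ B ℤ.+ C ℤ.+ D) (ℤ.- (+ 81 ℤ.* (T ℤ.* T)))
          (hom-+ (A ℤ.+ B ℤ.+ C) D
            (hom-+ (A ℤ.+ B) C
              (hom-+ A B (hom-* (+ 27) (f ℤ.* f) refl (ι-* f f)) (hom-* (+ 108) (f ℤ.* f ℤ.* f) refl
                  (hom-* (f ℤ.* f) f (ι-* f f) refl)))
              (ι-* (+ 36) T))
            (hom-* (+ 162) (f ℤ.* T) refl (ι-* f T)))
          (hom-neg (+ 81 ℤ.* (T ℤ.* T)) (hom-* (+ 81) (T ℤ.* T) refl (ι-* T T)))
        where
        A = + 27 ℤ.* (f ℤ.* f)
        B = + 108 ℤ.* (f ℤ.* f ℤ.* f)
        C = + 36 ℤ.* T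
        D = + 162 ℤ.* (f ℤ.* T)

      -- The discriminant computed twice in the ring, as the square of `M p` and from the symmetric
      -- functions; both are images of integers, and `ι-injective` returns the equation to `ℤ`.
      27M² : + 27 ℤ.* ((M ℤ.* + p) ℤ.* (M ℤ.* + p)) ≡ rhs (+ f) T
      27M² = ι-injective (trans
        (hom-* (+ 27) ((M ℤ.* + p) ℤ.* (M ℤ.* + p)) refl (hom-* (M ℤ.* + p) (M ℤ.* + p)
            (hom-* M (+ p) M≈ p≈) (hom-* M (+ p) M≈ p≈)))
        (trans (27discriminant≈ (combine xy≈) (combine yz≈) (combine zx≈) sum≈ f≈ e₃-multiple)
            (sym (ι-rhs (+ f) T))))

      instance
        p≢0 : ℕ.NonZero p
        p≢0 = prime⇒nonZero p-prime

    4p≡L²+27M² : + 4 ℤ.* + p ≡ L ℤ.* L ℤ.+ + 27 ℤ.* (M ℤ.* M)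
    4p≡L²+27M² = ℤ.*-cancelˡ-≡ (+ p ℤ.* + p) (+ 4 ℤ.* + p) (L ℤ.* L ℤ.+ + 27 ℤ.* (M ℤ.* M)) {{ℤ.i*j≢0
        (+ p) (+ p)}}
      (≡.trans (discriminant-identity (+ f) (+ d) (+ p) T L pℤ≡ T≡ L≡)
      (≡.trans (≡.cong (λ z → + p ℤ.* + p ℤ.* (L ℤ.* L) ℤ.+ z) (≡.sym 27M²))
        (factor-p² (+ p) L M)))

    -- The second component retains the discriminant `p²`, whose invertibility will separate the
    -- roots.
    PeriodEquation : ℤ → ℤ → Set _
    PeriodEquation e₂ e₃ = (∀ X → (X - x) * ((X - y) * (X - z)) ≈ X * X * X + X * X - ι e₂ * X - ι e₃) ×
      ((x - y) * ((y - z) * (x - z))) * ((x - y) * ((y - z) * (x - z))) ≈ ι (+ p ℤ.* + p)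

    period-equation : ∀ e₂ e₃ → + f ≡ e₂ → T ≡ + 3 ℤ.* e₃ → M ℤ.* M ≡ + 1 → PeriodEquation e₂ e₃
    period-equation e₂ e₃ f≡e₂ T≡3e₃ M²≡1 = roots , squared
      where
      xyz≈ : x * y * z ≈ ι e₃
      xyz≈ = begin
        x * y * z                           ≈⟨ *-identityˡ _ ⟨
        1# * (x * y * z)                    ≈⟨ *-congʳ (trans (*-comm third (ι (+ 3))) third≈) ⟨
        third * ι (+ 3) * (x * y * z)       ≈⟨ *-assoc _ _ _ ⟩
        third * (ι (+ 3) * (x * y * z))     ≈⟨ *-congˡ
            (trans e₃-multiple (trans (reflexive (≡.cong ι T≡3e₃)) (ι-* (+ 3) e₃))) ⟩
        third * (ι (+ 3) * ι e₃)            ≈⟨ *-assoc _ _ _ ⟨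
        third * ι (+ 3) * ι e₃              ≈⟨ *-congʳ (trans (*-comm third (ι (+ 3))) third≈) ⟩
        1# * ι e₃                           ≈⟨ *-identityˡ _ ⟩
        ι e₃                                ∎
      roots : ∀ X → (X - x) * ((X - y) * (X - z)) ≈ X * X * X + X * X - ι e₂ * X - ι e₃
      roots X = begin
        (X - x) * ((X - y) * (X - z)) ≈⟨ cubic-expansion X x y z ⟩
        X * X * X - (x + y + z) * X * X + (x * y + y * z + z * x) * X - x * y * z
          ≈⟨ +-cong (+-cong (+-congˡ
              (-‿cong (*-congʳ (*-congʳ (e₁≈ (combine xy≈) (combine yz≈) (combine zx≈) sum≈ f≈)))))
               (*-congʳ (trans (e₂≈ (combine xy≈) (combine yz≈) (combine zx≈) sum≈ f≈)
                   (-‿cong (reflexive (≡.cong ι f≡e₂)))))) (-‿cong xyz≈) ⟩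
        X * X * X - (- 1#) * X * X + (- ι e₂) * X - ι e₃
          ≈⟨ solve 3 (λ X e₂ e₃ → X :* X :* X :- (:- con (+ 1)) :* X :* X :+ (:- e₂) :* X :- e₃
              := X :* X :* X :+ X :* X :- e₂ :* X :- e₃) refl X (ι e₂) (ι e₃) ⟩
        X * X * X + X * X - ι e₂ * X - ι e₃ ∎
      difference : (x - y) * ((y - z) * (x - z)) ≈ ι (M ℤ.* + p)
      difference = trans (differences-factor x y z)
        (trans (differences≈ (combine xy≈) (combine yz≈) (combine zx≈) sum≈ f≈) (sym (hom-* M (+ p) M≈ p≈)))
      squared : ((x - y) * ((y - z) * (x - z))) * ((x - y) * ((y - z) * (x - z))) ≈ ι (+ p ℤ.* + p)
      squared = trans (*-cong difference difference) (trans (sym (ι-* (M ℤ.* + p) (M ℤ.* + p)))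
          (reflexive (≡.cong ι
        (≡.trans (square-* M (+ p))
          (≡.trans (≡.cong (ℤ._* (+ p ℤ.* + p)) M²≡1) (ℤ.*-identityˡ (+ p ℤ.* + p)))))))

    private
      f-from-p : ∀ g → + p ≡ + 1 ℤ.+ + 3 ℤ.* g → + f ≡ g
      f-from-p g eq = ℤ.*-cancelˡ-≡ (+ 3) (+ f) g (ℤ-Ring.+-cancelˡ (+ 1) (+ 3 ℤ.* + f) (+ 3 ℤ.* g)
          (≡.trans (≡.sym pℤ≡) eq))
        where module ℤ-Ring = RingProperties (CommutativeRing.ring ℤ.+-*-commutativeRing)

    period-equation₁ : ∀ m → + p ≡ + 9 ℤ.* (m ℤ.* m) ℤ.+ + 15 ℤ.* m ℤ.+ + 13 →
      PeriodEquation (+ 3 ℤ.* (m ℤ.* m) ℤ.+ + 5 ℤ.* m ℤ.+ + 4)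
          (ℤ.- (+ 2 ℤ.* (m ℤ.* m ℤ.* m) ℤ.+ + 4 ℤ.* (m ℤ.* m) ℤ.+ + 4 ℤ.* m ℤ.+ + 1))
    period-equation₁ m p≡ = period-equation (+ 3 ℤ.* (m ℤ.* m) ℤ.+ + 5 ℤ.* m ℤ.+ + 4)
        (ℤ.- (+ 2 ℤ.* (m ℤ.* m ℤ.* m) ℤ.+ + 4 ℤ.* (m ℤ.* m) ℤ.+ + 4 ℤ.* m ℤ.+ + 1)) f≡′
        (≡.trans T≡ (≡.trans (≡.cong₂ (λ f dp → ℤ.- (f ℤ.* f) ℤ.+ dp) f≡′
            (≡.cong₂ ℤ._*_ (proj₂ unique) p≡)) (triple-product₁ m)))
        (proj₁ unique)
      where
      unique : M ℤ.* M ≡ + 1 × + d ≡ m ℤ.* m ℤ.+ m ℤ.+ + 1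
      unique = QuadraticForm.cyclotomic-number p-prime (ℤ.- (+ 2 ℤ.* m) ℤ.- + 2) (+ f) (+ d) (m ℤ.* m ℤ.+ m ℤ.+ + 1) L M pℤ≡
        (≡.trans (≡.cong (+ 4 ℤ.*_) p≡) (norm₁ m))
        (≡.trans (≡.cong (λ p → (+ 1 ℤ.+ + 3 ℤ.* (ℤ.- (+ 2 ℤ.* m) ℤ.- + 2)) ℤ.+ p ℤ.+ + 1) p≡) (nine-fold₁ m))
        L≡ 4p≡L²+27M²
      f≡′ : + f ≡ + 3 ℤ.* (m ℤ.* m) ℤ.+ + 5 ℤ.* m ℤ.+ + 4
      f≡′ = f-from-p (+ 3 ℤ.* (m ℤ.* m) ℤ.+ + 5 ℤ.* m ℤ.+ + 4) (≡.trans p≡ (third-of-p-1₁ m))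

    period-equation₂ : ∀ m → + p ≡ + 9 ℤ.* (m ℤ.* m) ℤ.+ + 3 ℤ.* m ℤ.+ + 7 →
      PeriodEquation (+ 3 ℤ.* (m ℤ.* m) ℤ.+ m ℤ.+ + 2) (+ 2 ℤ.* (m ℤ.* m ℤ.* m) ℤ.+ + 2 ℤ.* (m ℤ.* m)
          ℤ.+ + 2 ℤ.* m ℤ.+ + 1)
    period-equation₂ m p≡ = period-equation (+ 3 ℤ.* (m ℤ.* m) ℤ.+ m ℤ.+ + 2) (+ 2 ℤ.* (m ℤ.* m ℤ.* m)
        ℤ.+ + 2 ℤ.* (m ℤ.* m) ℤ.+ + 2 ℤ.* m ℤ.+ + 1) f≡′
        (≡.trans T≡ (≡.trans (≡.cong₂ (λ f dp → ℤ.- (f ℤ.* f) ℤ.+ dp) f≡′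
            (≡.cong₂ ℤ._*_ (proj₂ unique) p≡)) (triple-product₂ m)))
        (proj₁ unique)
      where
      unique : M ℤ.* M ≡ + 1 × + d ≡ m ℤ.* m ℤ.+ m ℤ.+ + 1
      unique = QuadraticForm.cyclotomic-number p-prime (+ 2 ℤ.* m) (+ f) (+ d) (m ℤ.* m ℤ.+ m ℤ.+ + 1) L M pℤ≡
        (≡.trans (≡.cong (+ 4 ℤ.*_) p≡) (norm₂ m))
        (≡.trans (≡.cong (λ p → (+ 1 ℤ.+ + 3 ℤ.* (+ 2 ℤ.* m)) ℤ.+ p ℤ.+ + 1) p≡) (nine-fold₂ m))
        L≡ 4p≡L²+27M²
      f≡′ : + f ≡ + 3 ℤ.* (m ℤ.* m) ℤ.+ m ℤ.+ + 2
      f≡′ = f-from-p (+ 3 ℤ.* (m ℤ.* m) ℤ.+ m ℤ.+ + 2) (≡.trans p≡ (third-of-p-1₂ m))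

-- Real and complex numbers

module OrderedField {c ℓ₁ ℓ₂ : Level} (R : RealField c ℓ₁ ℓ₂) where
  open RealField R
  open CommutativeRing commutativeRing using (semiring)
  open IsStrictPartialOrder isStrictPartialOrder public using (<-respˡ-≈; <-respʳ-≈)
    renaming (trans to <-trans; irrefl to <-irrefl; asym to <-asym)
  open RingProperties ring using (-‿involutive; -‿+-comm)
  open IntegerEmbedding commutativeRing using (homomorphism)
  open IntegerSolver commutativeRing homomorphism
  open Mult semiring using (×-homo-+; ×1-homo-*)
  open HeytingProperties heytingCommutativeRing public using (x-0≈x; #-congʳ; invertibleʳ⇒#; x#0y#0→xy#0)
  open Complex R public using (0<1; 0<suc; fromℕ#0; invℝ; 1#0)
  open SetoidReasoning setoid

  infix 4 _≤_
  -- A negation, since the order is not decidable; its transitivity rests on cotransitivity of the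
  -- strict order.
  _≤_ : ℝ → ℝ → Set ℓ₂
  x ≤ y = ¬ (y < x)

  #-reflect : ∀ {x y} → ¬ (x # y) → x ≈ y
  #-reflect {x} {y} = proj₁ (tight x y)

  -- The constructive substitute for trichotomy, inherited from the apartness.
  <-cotrans : ∀ {x y} → x < y → ∀ z → x < z ⊎ z < y
  <-cotrans {x} {y} x<y z with #-cotrans (Equivalence.from #⇔<> (inj₁ x<y)) z
  ... | inj₁ x#z = [ inj₁ , (λ z<x → inj₂ (<-trans z<x x<y)) ]′ (Equivalence.to #⇔<> x#z)
  ... | inj₂ z#y = [ inj₂ , (λ y<z → inj₁ (<-trans x<y y<z)) ]′ (Equivalence.to #⇔<> z#y)

  ≤-reflexive : ∀ {x y} → x ≈ y → x ≤ y
  ≤-reflexive x≈y y<x = <-irrefl (sym x≈y) y<x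

  <⇒≤ : ∀ {x y} → x < y → x ≤ y
  <⇒≤ x<y y<x = <-asym x<y y<x

  ≤-<-trans : ∀ {x y z} → x ≤ y → y < z → x < z
  ≤-<-trans {x} x≤y y<z = [ (λ y<x → ⊥-elim (x≤y y<x)) , (λ x<z → x<z) ]′ (<-cotrans y<z x)

  <-≤-trans : ∀ {x y z} → x < y → y ≤ z → x < z
  <-≤-trans {z = z} x<y y≤z = [ (λ x<z → x<z) , (λ z<y → ⊥-elim (y≤z z<y)) ]′ (<-cotrans x<y z)

  ≤-trans : ∀ {x y z} → x ≤ y → y ≤ z → x ≤ z
  ≤-trans x≤y y≤z z<x = x≤y (≤-<-trans y≤z z<x)

  ≤-respˡ : ∀ {x y z} → x ≈ y → x ≤ z → y ≤ z
  ≤-respˡ x≈y x≤z z<y = x≤z (<-respʳ-≈ (sym x≈y) z<y)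

  ≤-respʳ : ∀ {x y z} → x ≈ y → z ≤ x → z ≤ y
  ≤-respʳ x≈y z≤x y<z = z≤x (<-respˡ-≈ (sym x≈y) y<z)

  ≤-antisym : ∀ {x y} → x ≤ y → y ≤ x → x ≈ y
  ≤-antisym x≤y y≤x = #-reflect (λ x#y → [ y≤x , x≤y ]′ (Equivalence.to #⇔<> x#y))

  +-cancel-< : ∀ z {x y} → x + z < y + z → x < y
  +-cancel-< z {x} {y} lt = <-respˡ-≈ (cancel x) (<-respʳ-≈ (cancel y) (+-monoˡ-< (- z) lt))
    where
    cancel : ∀ x → x + z - z ≈ x
    cancel x = solve 2 (λ x z → x :+ z :- z := x) refl x z

  +-mono-≤ : ∀ {x y u v} → x ≤ y → u ≤ v → x + u ≤ y + v
  +-mono-≤ {x} {y} {u} {v} x≤y u≤v = ≤-trans (λ lt → x≤y (+-cancel-< u lt))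
    (≤-respˡ (+-comm u y) (≤-respʳ (+-comm v y) (λ lt → u≤v (+-cancel-< y lt))))

  +-mono-< : ∀ {x y u v} → x < y → u < v → x + u < y + v
  +-mono-< {x} {y} {u} {v} x<y u<v = <-trans (+-monoˡ-< u x<y)
    (<-respˡ-≈ (+-comm u y) (<-respʳ-≈ (+-comm v y) (+-monoˡ-< y u<v)))

  -- With a visibly nonnegative `d`, an inequality becomes a ring identity that the solver can
  -- check.
  from-difference : ∀ {x y d} → y - x ≈ d → 0# ≤ d → x ≤ y
  from-difference {x} {y} {d} y-x≈d 0≤d = ≤-respˡ (+-identityˡ x)
    (≤-respʳ (solve 2 (λ x y → y :- x :+ x := y) refl x y) (+-mono-≤ (≤-respʳ (sym y-x≈d) 0≤d)
        (≤-reflexive refl)))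

  to-difference : ∀ {x y} → x ≤ y → 0# ≤ y - x
  to-difference {x} x≤y = ≤-respˡ (-‿inverseʳ x) (+-mono-≤ x≤y (≤-reflexive refl))

  from-difference-< : ∀ {x y d} → y - x ≈ d → 0# < d → x < y
  from-difference-< {x} {y} {d} y-x≈d 0<d = <-respˡ-≈ (+-identityˡ x)
    (<-respʳ-≈ (solve 2 (λ x y → y :- x :+ x := y) refl x y) (+-monoˡ-< x (<-respʳ-≈ (sym y-x≈d) 0<d)))

  to-difference-< : ∀ {x y} → x < y → 0# < y - x
  to-difference-< {x} x<y = <-respˡ-≈ (-‿inverseʳ x) (+-monoˡ-< (- x) x<y)

  0≤+ : ∀ {x y} → 0# ≤ x → 0# ≤ y → 0# ≤ x + y
  0≤+ 0≤x 0≤y = ≤-respˡ (+-identityˡ 0#) (+-mono-≤ 0≤x 0≤y)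

  -- Being apart from `0#` is being invertible, and a factor of an invertible element is invertible.
  #0-factorˡ : ∀ {x y} → x * y # 0# → x # 0#
  #0-factorˡ {x} {y} xy#0 with #⇒invertible xy#0
  ... | w , _ , eq = invertibleʳ⇒# (y * w , (begin
    (x - 0#) * (y * w)  ≈⟨ *-congʳ (x-0≈x x) ⟩
    x * (y * w)         ≈⟨ *-assoc x y w ⟨
    x * y * w           ≈⟨ *-congʳ (x-0≈x (x * y)) ⟨
    (x * y - 0#) * w    ≈⟨ eq ⟩
    1#                  ∎))

  #0-factorʳ : ∀ {x y} → x * y # 0# → y # 0#
  #0-factorʳ {x} {y} xy#0 = #0-factorˡ (#-congʳ (*-comm x y) xy#0)

  positive : ∀ {x} → 0# ≤ x → x # 0# → 0# < x
  positive 0≤x x#0 = [ (λ x<0 → ⊥-elim (0≤x x<0)) , (λ 0<x → 0<x) ]′ (Equivalence.to #⇔<> x#0)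

  -- A negative product is apart from `0#`, hence so are both factors; being nonnegative they are
  -- then positive, and so is the product.
  0≤* : ∀ {x y} → 0# ≤ x → 0# ≤ y → 0# ≤ x * y
  0≤* {x} {y} 0≤x 0≤y xy<0 = <-asym xy<0 (*-pos (positive 0≤x (#0-factorˡ xy#0))
      (positive 0≤y (#0-factorʳ xy#0)))
    where xy#0 = Equivalence.from #⇔<> (inj₁ xy<0)

  *-mono-≤ : ∀ {z x y} → 0# ≤ z → x ≤ y → z * x ≤ z * y
  *-mono-≤ {z} {x} {y} 0≤z x≤y = from-difference
      (solve 3 (λ x y z → z :* y :- z :* x := z :* (y :- x)) refl x y z)
    (0≤* 0≤z (to-difference x≤y))

  *-mono-< : ∀ {z x y} → 0# < z → x < y → z * x < z * y
  *-mono-< {z} {x} {y} 0<z x<y = from-difference-<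
      (solve 3 (λ x y z → z :* y :- z :* x := z :* (y :- x)) refl x y z)
    (*-pos 0<z (to-difference-< x<y))

  0≤-halve : ∀ {x} → 0# ≤ x + x → 0# ≤ x
  0≤-halve 0≤2x x<0 = 0≤2x (<-respʳ-≈ (+-identityˡ 0#) (+-mono-< x<0 x<0))

  0≤square : ∀ x → 0# ≤ x * x
  0≤square x x²<0 = [ (λ x<0 → <-asym x²<0
      (<-respʳ-≈ (solve 1 (λ x → (:- x) :* (:- x) := x :* x) refl x) (*-pos (neg x<0) (neg x<0))))
                    , (λ 0<x → <-asym x²<0 (*-pos 0<x 0<x)) ]′ (Equivalence.to #⇔<>
                        (#0-factorˡ (Equivalence.from #⇔<> (inj₁ x²<0))))
    where
    neg : ∀ {x} → x < 0# → 0# < - x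
    neg {x} x<0 = from-difference-< (solve 1 (λ x → :- x :- con (+ 0) := :- x) refl x)
        (<-respˡ-≈ (-‿inverseʳ x) (<-respʳ-≈ (+-identityˡ (- x)) (+-monoˡ-< (- x) x<0)))

  square≈0 : ∀ {x} → x * x ≈ 0# → x ≈ 0#
  square≈0 {x} x²≈0 = #-reflect (λ x#0 → [ (λ x<0 → <-irrefl (sym x²≈0) (pos x#0)) ,
      (λ 0<x → <-irrefl (sym x²≈0) (*-pos 0<x 0<x)) ]′ (Equivalence.to #⇔<> x#0))
    where
    pos : x # 0# → 0# < x * x
    pos x#0 = positive (0≤square x) (x#0y#0→xy#0 x#0 x#0)

  zero-product : ∀ {x y} → x * y ≈ 0# → x # 0# → y ≈ 0#
  zero-product {x} {y} xy≈0 x#0 with #⇒invertible x#0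
  ... | w , eq , _ = begin
    y               ≈⟨ *-identityˡ y ⟨
    1# * y          ≈⟨ *-congʳ (trans (*-congˡ (sym (x-0≈x x))) eq) ⟨
    w * x * y       ≈⟨ *-assoc w x y ⟩
    w * (x * y)     ≈⟨ *-congˡ xy≈0 ⟩
    w * 0#          ≈⟨ zeroʳ w ⟩
    0#              ∎

  invℝ-inverseʳ : ∀ {x} (x#0 : x # 0#) → x * invℝ x#0 ≈ 1#
  invℝ-inverseʳ {x} x#0 = trans (*-congʳ (sym (x-0≈x x))) (proj₂ (proj₂ (#⇒invertible x#0)))

  opaque
    recip : ∀ n .{{_ : ℕ.NonZero n}} → ℝ
    recip n = invℝ (fromℕ#0 n)

    recip-inverseʳ : ∀ n .{{_ : ℕ.NonZero n}} → fromℕ n * recip n ≈ 1#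
    recip-inverseʳ n = invℝ-inverseʳ (fromℕ#0 n)

    recip-def : ∀ n .{{_ : ℕ.NonZero n}} → invℝ (fromℕ#0 n) ≈ recip n
    recip-def n = refl

  >⇒# : ∀ {x} → 0# < x → x # 0#
  >⇒# 0<x = Equivalence.from #⇔<> (inj₂ 0<x)

  inverse-positive : ∀ {x y} → 0# < x → x * y ≈ 1# → 0# < y
  inverse-positive {x} {y} 0<x xy≈1 = [
      (λ y<0 → ⊥-elim (<-asym 0<1 (<-respˡ-≈ xy≈1 (<-respʳ-≈ (zeroʳ x) (*-mono-< 0<x y<0)))))
    , (λ 0<y → 0<y) ]′ (Equivalence.to #⇔<> (#0-factorʳ (#-congʳ (sym xy≈1) 1#0)))

  recip-positive : ∀ n .{{_ : ℕ.NonZero n}} → 0# < recip n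
  recip-positive n@(suc m) = inverse-positive (0<suc m) (recip-inverseʳ n)

  0≤fromℕ : ∀ n → 0# ≤ fromℕ n
  0≤fromℕ zero    = ≤-reflexive refl
  0≤fromℕ (suc n) = <⇒≤ (0<suc n)

  fromℕ-+ : ∀ m n → fromℕ (m ℕ.+ n) ≈ fromℕ m + fromℕ n
  fromℕ-+ = ×-homo-+ 1#

  fromℕ-* : ∀ m n → fromℕ (m ℕ.* n) ≈ fromℕ m * fromℕ n
  fromℕ-* = ×1-homo-*

  fromℕ-mono-≤ : ∀ {m n} → m ℕ.≤ n → fromℕ m ≤ fromℕ n
  fromℕ-mono-≤ {m} {n} m≤n = ≤-respˡ (+-identityʳ _) (≤-respʳ (trans (sym (fromℕ-+ m (n ℕ.∸ m)))
      (reflexive (≡.cong fromℕ (ℕ.m+[n∸m]≡n m≤n))))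
    (+-mono-≤ (≤-reflexive refl) (0≤fromℕ (n ℕ.∸ m))))

  fromℕ-1 : fromℕ 1 ≈ 1#
  fromℕ-1 = +-identityʳ 1#

  0<half : ∀ {ε} → 0# < ε → 0# < ε * recip 2
  0<half 0<ε = *-pos 0<ε (recip-positive 2)

  half+half : ∀ ε → ε * recip 2 + ε * recip 2 ≈ ε
  half+half ε = begin
    -- `fromℕ 2` unfolds to `1# + (1# + 0#)`; the factor 2 is spelled this way for `recip-inverseʳ`
    -- to apply.
    ε * h + ε * h         ≈⟨ solve 2 (λ ε h → ε :* h :+ ε :* h
        := ε :* ((con (+ 1) :+ (con (+ 1) :+ con (+ 0))) :* h)) refl ε h ⟩
    ε * ((1# + (1# + 0#)) * h)     ≈⟨ *-congˡ (recip-inverseʳ 2) ⟩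
    ε * 1#                ≈⟨ *-identityʳ ε ⟩
    ε                     ∎
    where h = recip 2

  AbsBound : ℝ → ℝ → Set ℓ₂
  AbsBound x b = (x ≤ b) × (- x ≤ b)

  absBound-resp : ∀ {x y b} → x ≈ y → AbsBound x b → AbsBound y b
  absBound-resp x≈y (p , q) = ≤-respˡ x≈y p , ≤-respˡ (-‿cong x≈y) q

  absBound-+ : ∀ {x y a b} → AbsBound x a → AbsBound y b → AbsBound (x + y) (a + b)
  absBound-+ {x} {y} (p , q) (r , s) = +-mono-≤ p r , ≤-respˡ (-‿+-comm x y) (+-mono-≤ q s)

  absBound-neg : ∀ {x b} → AbsBound x b → AbsBound (- x) b
  absBound-neg {x} (p , q) = q , ≤-respˡ (sym (-‿involutive x)) p

  -- `2 (a b - x y) = (a - x) (b + y) + (a + x) (b - y)` has nonnegative factors, which avoids the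
  -- undecidable distinction of signs; likewise for `a b + x y`.
  absBound-* : ∀ {x y a b} → AbsBound x a → AbsBound y b → AbsBound (x * y) (a * b)
  absBound-* {x} {y} {a} {b} (p , q) (r , s) =
    from-difference refl (0≤-halve (≤-respʳ
      (solve 4 (λ x y a b → (a :- x) :* (b :- (:- y)) :+ (a :- (:- x)) :* (b :- y) := (a :* b :- x :* y)
          :+ (a :* b :- x :* y)) refl x y a b)
      (0≤+ (0≤* (to-difference p) (to-difference s)) (0≤* (to-difference q) (to-difference r))))) ,
    from-difference refl (0≤-halve (≤-respʳ
      (solve 4 (λ x y a b → (a :- x) :* (b :- y) :+ (a :- (:- x)) :* (b :- (:- y))
          := (a :* b :- (:- (x :* y))) :+ (a :* b :- (:- (x :* y)))) refl x y a b)
      (0≤+ (0≤* (to-difference p) (to-difference r)) (0≤* (to-difference q) (to-difference s)))))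

  absBound-nonneg : ∀ {x b} → AbsBound x b → 0# ≤ b
  absBound-nonneg {x} {b} (p , q) = 0≤-halve (≤-respˡ (-‿inverseʳ x) (+-mono-≤ p q))

  -- A positive `x` would violate the bound `ε = x / 2`.
  absBound-zero : ∀ {x} → (∀ ε → 0# < ε → AbsBound x ε) → x ≈ 0#
  absBound-zero {x} bound = ≤-antisym (upper x (λ ε 0<ε → proj₁ (bound ε 0<ε)))
      (≤-respʳ (solve 1 (λ x → con (+ 0) :- (:- x) := x) refl x)
        (to-difference (upper (- x) (λ ε 0<ε → proj₂ (bound ε 0<ε)))))
    where
    upper : ∀ x → (∀ ε → 0# < ε → x ≤ ε) → x ≤ 0#
    upper x x≤ 0<x = x≤ (x * h) (0<half 0<x) (<-respʳ-≈ (half+half x) (<-respˡ-≈ (+-identityˡ (x * h))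
        (+-monoˡ-< (x * h) (0<half 0<x))))
      where h = recip 2

-- The ring of complex numbers

module ComplexRing {c ℓ₁ ℓ₂ : Level} (R : RealField c ℓ₁ ℓ₂) where
  open Complex R hiding (1#0; 0<1; 0<suc; fromℕ#0)
  private module R = RealField R
  open OrderedField R using (invℝ-inverseʳ)
  open IntegerEmbedding R.commutativeRing using (homomorphism)
  open IntegerSolver R.commutativeRing homomorphism

  ℂ-commutativeRing : CommutativeRing c ℓ₁
  ℂ-commutativeRing = record
    { Carrier = ℂ ; _≈_ = _≈_ ; _+_ = _+_ ; _*_ = _*_ ; -_ = -_ ; 0# = 0ℂ ; 1# = 1ℂ
    ; isCommutativeRing = record
      { isRing = record
        { +-isAbelianGroup = record
          { isGroup = record
            { isMonoid = record
              { isSemigroup = record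
                { isMagma = record
                  { isEquivalence = record
                    { refl = R.refl , R.refl
                    ; sym = λ (p , q) → R.sym p , R.sym q
                    ; trans = λ (p , q) (r , s) → R.trans p r , R.trans q s }
                  ; ∙-cong = λ (p , q) (r , s) → R.+-cong p r , R.+-cong q s }
                ; assoc = λ _ _ _ → R.+-assoc _ _ _ , R.+-assoc _ _ _ }
              ; identity = (λ _ → R.+-identityˡ _ , R.+-identityˡ _) , (λ _ → R.+-identityʳ _
                  , R.+-identityʳ _) }
            ; inverse = (λ _ → R.-‿inverseˡ _ , R.-‿inverseˡ _) , (λ _ → R.-‿inverseʳ _ , R.-‿inverseʳ _)
            ; ⁻¹-cong = λ (p , q) → R.-‿cong p , R.-‿cong q }
          ; comm = λ _ _ → R.+-comm _ _ , R.+-comm _ _ }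
        ; *-cong = *-cong
        ; *-assoc = *-assoc
        ; *-identity = *-identityˡ , (λ z → trans (*-comm z 1ℂ) (*-identityˡ z))
        ; distrib = distribˡ , (λ z w v → trans (*-comm (w + v) z) (trans (distribˡ z w v)
            (+-cong (*-comm z w) (*-comm z v)))) }
      ; *-comm = *-comm } }
    where
    trans : ∀ {z w v} → z ≈ w → w ≈ v → z ≈ v
    trans (p , q) (r , s) = R.trans p r , R.trans q s
    +-cong : ∀ {z z′ w w′} → z ≈ z′ → w ≈ w′ → z + w ≈ z′ + w′
    +-cong (p , q) (r , s) = R.+-cong p r , R.+-cong q s
    *-cong : ∀ {z z′ w w′} → z ≈ z′ → w ≈ w′ → z * w ≈ z′ * w′
    *-cong (p , q) (r , s) = R.+-cong (R.*-cong p r) (R.-‿cong (R.*-cong q s)) , R.+-cong (R.*-cong p s)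
        (R.*-cong q r)
    *-comm : ∀ z w → z * w ≈ w * z
    *-comm (a +i b) (c +i d) =
      solve 4 (λ a b c d → a :* c :- b :* d := c :* a :- d :* b) R.refl a b c d ,
      solve 4 (λ a b c d → a :* d :+ b :* c := c :* b :+ d :* a) R.refl a b c d
    *-assoc : ∀ z w v → (z * w) * v ≈ z * (w * v)
    *-assoc (a +i b) (c +i d) (e +i f) =
      solve 6 (λ a b c d e f → (a :* c :- b :* d) :* e :- (a :* d :+ b :* c) :* f
          := a :* (c :* e :- d :* f) :- b :* (c :* f :+ d :* e)) R.refl a b c d e f ,
      solve 6 (λ a b c d e f → (a :* c :- b :* d) :* f :+ (a :* d :+ b :* c) :* e
          := a :* (c :* f :+ d :* e) :+ b :* (c :* e :- d :* f)) R.refl a b c d e f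
    *-identityˡ : ∀ z → 1ℂ * z ≈ z
    *-identityˡ (a +i b) =
      solve 2 (λ a b → con (+ 1) :* a :- con (+ 0) :* b := a) R.refl a b ,
      solve 2 (λ a b → con (+ 1) :* b :+ con (+ 0) :* a := b) R.refl a b
    distribˡ : ∀ z w v → z * (w + v) ≈ z * w + z * v
    distribˡ (a +i b) (c +i d) (e +i f) =
      solve 6 (λ a b c d e f → a :* (c :+ e) :- b :* (d :+ f) := (a :* c :- b :* d)
          :+ (a :* e :- b :* f)) R.refl a b c d e f ,
      solve 6 (λ a b c d e f → a :* (d :+ f) :+ b :* (c :+ e) := (a :* d :+ b :* c)
          :+ (a :* f :+ b :* e)) R.refl a b c d e f

  open CommutativeRing ℂ-commutativeRing public
    using (refl; sym; trans; reflexive; setoid; +-cong; +-congˡ; +-congʳ; *-cong; *-congˡ; *-congʳ; -‿cong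
          ; +-identityˡ; +-identityʳ; *-identityˡ; *-identityʳ; +-assoc; *-assoc; *-comm; zeroˡ; zeroʳ
          ; -‿inverseʳ; distribˡ; ring; semiring; commutativeSemiring)

  module ℂι = IntegerEmbedding ℂ-commutativeRing
  open ℂι using (ι; ι-neg) public

  fromℝ-* : ∀ x y → fromℝ (x R.* y) ≈ fromℝ x * fromℝ y
  fromℝ-* x y = solve 2 (λ x y → x :* y := x :* y :- con (+ 0) :* con (+ 0)) R.refl x y ,
                solve 2 (λ x y → con (+ 0) := x :* con (+ 0) :+ con (+ 0) :* y) R.refl x y

  fromℝ-+ : ∀ x y → fromℝ (x R.+ y) ≈ fromℝ x + fromℝ y
  fromℝ-+ x y = R.refl , R.sym (R.+-identityˡ R.0#)

  fromℝ-cong : ∀ {x y} → x R.≈ y → fromℝ x ≈ fromℝ y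
  fromℝ-cong x≈y = x≈y , R.refl

  open Mult semiring using () renaming (_×_ to _·_)
  open SemiringMult semiring using (×ᵤ≈×)

  fromℕ≈· : ∀ n → fromℝ (R.fromℕ n) ≈ n · 1ℂ
  fromℕ≈· zero    = refl
  fromℕ≈· (suc n) = trans (fromℝ-+ R.1# (R.fromℕ n)) (+-congˡ (fromℕ≈· n))

  fromℤ≈ι : ∀ n → fromℤ n ≈ ι n
  fromℤ≈ι (+ n)    = trans (fromℕ≈· n) (×ᵤ≈× n 1ℂ)
  fromℤ≈ι -[1+ n ] = -‿cong (trans (fromℕ≈· (suc n)) (×ᵤ≈× (suc n) 1ℂ))

  fromℝ-inverseʳ : ∀ {x} (x#0 : x # 0ℝ) → fromℝ x * fromℝ (invℝ x#0) ≈ 1ℂ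
  fromℝ-inverseʳ {x} x#0 = trans (sym (fromℝ-* x _)) (fromℝ-cong (invℝ-inverseʳ x#0))

  fromℕ*/ : ∀ n .{{_ : ℕ.NonZero n}} z → ι (+ n) * (z / n) ≈ z
  fromℕ*/ n z = trans (*-congʳ (sym (fromℤ≈ι (+ n)))) (trans (sym (*-assoc _ z _))
      (trans (*-congʳ (*-comm _ z))
    (trans (*-assoc z _ _) (trans (*-congˡ (fromℝ-inverseʳ (Complex.fromℕ#0 R n))) (*-identityʳ z)))))

-- The exponential series

-- Up to `k = m` the power is at most `m ^ m`; each further factor `m` on the left is matched by a
-- larger factor of the factorial.
power≤factorial : ∀ m k → m ℕ.^ k ℕ.≤ m ℕ.^ m ℕ.* k !
power≤factorial zero zero = ℕ.≤-refl
power≤factorial (suc m) zero = ℕ.≤-trans (ℕ.m^n>0 (suc m) (suc m)) (ℕ.≤-reflexive (≡.sym (ℕ.*-identityʳ _)))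
power≤factorial m (suc k) = [ small , large ]′ (ℕ.≤-<-connex (suc k) m)
  where
  small : suc k ℕ.≤ m → m ℕ.^ suc k ℕ.≤ m ℕ.^ m ℕ.* suc k !
  small k<m = ℕ.≤-trans (ℕ.^-monoʳ-≤ m {{ℕ.>-nonZero (ℕ.≤-trans ℕ.z<s k<m)}} k<m)
      (ℕ.m≤m*n (m ℕ.^ m) (suc k !) {{suc k !≢0}})
  large : m ℕ.< suc k → m ℕ.^ suc k ℕ.≤ m ℕ.^ m ℕ.* suc k !
  large m≤k = ℕ.≤-trans (ℕ.*-mono-≤ (ℕ.<⇒≤ m≤k) (power≤factorial m k)) (ℕ.≤-reflexive (begin
    suc k ℕ.* (m ℕ.^ m ℕ.* k !)   ≡⟨ ℕ.*-assoc (suc k) (m ℕ.^ m) (k !) ⟨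
    suc k ℕ.* m ℕ.^ m ℕ.* k !     ≡⟨ ≡.cong (ℕ._* k !) (ℕ.*-comm (suc k) (m ℕ.^ m)) ⟩
    m ℕ.^ m ℕ.* suc k ℕ.* k !     ≡⟨ ℕ.*-assoc (m ℕ.^ m) (suc k) (k !) ⟩
    m ℕ.^ m ℕ.* suc k !           ∎))
    where open ≡.≡-Reasoning

n≤2^n : ∀ n → n ℕ.≤ 2 ℕ.^ n
n≤2^n zero    = ℕ.z≤n
n≤2^n (suc n) = ℕ.≤-trans (ℕ.+-mono-≤ (ℕ.m^n>0 2 n) (n≤2^n n))
    (ℕ.≤-reflexive (≡.cong (2 ℕ.^ n ℕ.+_) (≡.sym (ℕ.+-identityʳ (2 ℕ.^ n)))))

binomial-factorial : ∀ n k → k ℕ.≤ n → (n choose k) ℕ.* (k ! ℕ.* (n ℕ.∸ k) !) ≡ n !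
binomial-factorial n k k≤n = ≡.trans (≡.cong (ℕ._* (k ! ℕ.* (n ℕ.∸ k) !)) (nCk≡n!/k![n-k]! k≤n))
  (m/n*n≡m {{k !* (n ℕ.∸ k) !≢0}} (k![n∸k]!∣n! k≤n))

module SequenceIdentities {c ℓ : Level} (K : CommutativeRing c ℓ) where
  open CommutativeRing K
  open IntegerEmbedding K using (homomorphism)
  open IntegerSolver K homomorphism

  minus-zero : ∀ x → x - 0# ≈ x
  minus-zero = solve 1 (λ x → x :- con (+ 0) := x) refl

  common-summand : ∀ x y z → y - z ≈ (x + y) - (x + z)
  common-summand = solve 3 (λ x y z → y :- z := (x :+ y) :- (x :+ z)) refl

  product-error-step : ∀ a s s′ t u → (a + s) * t - (a * s′ + u) ≈ a * (t - s′) + (s * t - u)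
  product-error-step = solve 5 (λ a s s′ t u → (a :+ s) :* t :- (a :* s′ :+ u) := a :* (t :- s′)
      :+ (s :* t :- u)) refl

-- Estimates for complex sequences and Cauchy products

module ComplexSequences {c ℓ₁ ℓ₂ : Level} (R : RealField c ℓ₁ ℓ₂) where
  open Complex R hiding (1#0; 0<1; 0<suc; fromℕ#0; invℝ)
  module R = RealField R
  open OrderedField R public
  open ComplexRing R public
  open IntegerEmbedding R.commutativeRing using (homomorphism)
  open IntegerSolver R.commutativeRing homomorphism
  open SequenceIdentities ℂ-commutativeRing
  open SemiringSum semiring using (sum-cong-≋; ∑-distrib-+; *-distribˡ-sum)
  open RawSemiringDefs (RawRing.rawSemiring R.rawRing) public using () renaming (_^_ to _^ʳ_)

  -- The ℓ¹ norm: it is submultiplicative, and bounding it needs neither absolute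
  -- values nor square roots of real numbers.
  record Bounded (z : ℂ) (b : ℝ) : Set (c ⊔ ℓ₂) where
    constructor bounded
    field
      {reBound imBound} : ℝ
      re-bounded : AbsBound (re z) reBound
      im-bounded : AbsBound (im z) imBound
      total      : reBound R.+ imBound ≤ b

  bounded-resp : ∀ {z w b} → z ≈ w → Bounded z b → Bounded w b
  bounded-resp (p , q) (bounded r s t) = bounded (absBound-resp p r) (absBound-resp q s) t

  bounded-weaken : ∀ {z a b} → a ≤ b → Bounded z a → Bounded z b
  bounded-weaken a≤b (bounded r s t) = bounded r s (≤-trans t a≤b)

  bounded-≈ : ∀ {z a b} → a R.≈ b → Bounded z a → Bounded z b
  bounded-≈ a≈b = bounded-weaken (≤-reflexive a≈b)

  bounded-+ : ∀ {z w a b} → Bounded z a → Bounded w b → Bounded (z + w) (a R.+ b)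
  bounded-+ {a = a} {b} (bounded {a₁} {a₂} r s t) (bounded {b₁} {b₂} r′ s′ t′) = bounded
      (absBound-+ r r′) (absBound-+ s s′)
    (≤-respˡ (solve 4 (λ a₁ a₂ b₁ b₂ → (a₁ :+ a₂) :+ (b₁ :+ b₂) := (a₁ :+ b₁)
        :+ (a₂ :+ b₂)) R.refl a₁ a₂ b₁ b₂) (+-mono-≤ t t′))

  bounded-neg : ∀ {z b} → Bounded z b → Bounded (- z) b
  bounded-neg (bounded r s t) = bounded (absBound-neg r) (absBound-neg s) t

  bounded-nonneg : ∀ {z b} → Bounded z b → R.0# ≤ b
  bounded-nonneg (bounded r s t) = ≤-trans (0≤+ (absBound-nonneg r) (absBound-nonneg s)) t

  bounded-* : ∀ {z w a b} → Bounded z a → Bounded w b → Bounded (z * w) (a R.* b)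
  bounded-* {a = a} {b} p@(bounded {a₁} {a₂} r s t) q@(bounded {b₁} {b₂} r′ s′ t′) = bounded
    (absBound-+ (absBound-* r r′) (absBound-neg (absBound-* s s′)))
    (absBound-+ (absBound-* r s′) (absBound-* s r′))
    (≤-trans (≤-respˡ (solve 4 (λ a₁ a₂ b₁ b₂ → (a₁ :+ a₂) :* (b₁ :+ b₂) := (a₁ :* b₁ :+ a₂ :* b₂)
        :+ (a₁ :* b₂ :+ a₂ :* b₁)) R.refl a₁ a₂ b₁ b₂)
        (*-mono-≤ (0≤+ (absBound-nonneg r) (absBound-nonneg s)) t′))
      (≤-respˡ (R.*-comm b (a₁ R.+ a₂)) (≤-respʳ (R.*-comm b a) (*-mono-≤ (bounded-nonneg q) t))))

  absBound-self : ∀ {x} → R.0# ≤ x → AbsBound x x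
  absBound-self {x} 0≤x = ≤-reflexive R.refl , from-difference
      (solve 1 (λ x → x :- (:- x) := x :+ x) R.refl x) (0≤+ 0≤x 0≤x)

  absBound-0 : AbsBound R.0# R.0#
  absBound-0 = absBound-self (≤-reflexive R.refl)

  bounded-fromℝ : ∀ {x} → R.0# ≤ x → Bounded (fromℝ x) x
  bounded-fromℝ 0≤x = bounded (absBound-self 0≤x) absBound-0 (≤-reflexive (R.+-identityʳ _))

  bounded-0 : ∀ {b} → R.0# ≤ b → Bounded 0ℂ b
  bounded-0 0≤b = bounded-weaken 0≤b (bounded-fromℝ (≤-reflexive R.refl))

  bounded-re : ∀ {z b} → Bounded z b → AbsBound (re z) b
  bounded-re (bounded {a₁} {a₂} (p , q) s t) = ≤-trans p a₁≤b , ≤-trans q a₁≤b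
    where a₁≤b = ≤-trans (≤-respˡ (R.+-identityʳ a₁) (+-mono-≤ (≤-reflexive R.refl) (absBound-nonneg s))) t

  bounded-im : ∀ {z b} → Bounded z b → AbsBound (im z) b
  bounded-im (bounded {a₁} {a₂} r (p , q) t) = ≤-trans p a₂≤b , ≤-trans q a₂≤b
    where a₂≤b = ≤-trans (≤-respˡ (R.+-identityˡ a₂) (+-mono-≤ (absBound-nonneg r) (≤-reflexive R.refl))) t

  bounded-zero : ∀ {z} → (∀ ε → R.0# R.< ε → Bounded z ε) → z ≈ 0ℂ
  bounded-zero {z} bound = absBound-zero (λ ε 0<ε → bounded-re (bound ε 0<ε)) , absBound-zero
      (λ ε 0<ε → bounded-im (bound ε 0<ε))

  -- A natural bound allows the factorial estimate to be made in `ℕ`.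
  bounded-by-ℕ : ∀ z → ∃[ n ] Bounded z (R.fromℕ n)
  bounded-by-ℕ z with abs (re z) | abs (im z)
    where
    abs : ∀ x → ∃[ n ] AbsBound x (R.fromℕ n)
    abs x with R.archimedean x | R.archimedean (R.- x)
    ... | m , x<m | n , -x<n = m ℕ.+ n ,
      ≤-trans (<⇒≤ x<m) (fromℕ-mono-≤ (ℕ.m≤m+n m n)) , ≤-trans (<⇒≤ -x<n) (fromℕ-mono-≤ (ℕ.m≤n+m n m))
  ... | m , p | n , q = m ℕ.+ n , bounded p q (≤-reflexive (R.sym (fromℕ-+ m n)))

  -- Partial sums over 0, …, n - 1.
  S : (ℕ → ℂ) → ℕ → ℂ
  S f n = sum {n} (λ k → f (toℕ k))

  S-cong : ∀ {f g} → (∀ k → f k ≈ g k) → ∀ n → S f n ≈ S g n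
  S-cong f≈g n = sum-cong-≋ {n} (λ k → f≈g (toℕ k))

  Geometric : (ℕ → ℂ) → ℝ → ℝ → Set (c ⊔ ℓ₂)
  Geometric f L r = ∀ k → Bounded (f k) (L R.* (r ^ʳ k))

  geometric-head : ∀ {f L r} → Geometric f L r → Bounded (f 0) L
  geometric-head {L = L} bound = bounded-≈ (R.*-identityʳ L) (bound 0)

  geometric-tail : ∀ {f L r} → Geometric f L r → Geometric (f ∘ suc) (L R.* r) r
  geometric-tail {L = L} {r} bound k = bounded-≈ (R.sym (R.*-assoc L r (r ^ʳ k))) (bound (suc k))

  module _ {r : ℝ} (0≤r : R.0# ≤ r) (2r≤1 : r R.+ r ≤ R.1#) where

    -- The tail is geometric with constant `L r`, and `L + 2 L r ≤ 2 L` as `r` is at most one half: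
    -- the bound reproduces itself along the induction.
    S-bound : ∀ {f L} → Geometric f L r → ∀ n → Bounded (S f n) (L R.+ L)
    S-bound bound zero = bounded-0 (0≤+ 0≤L 0≤L)
      where 0≤L = bounded-nonneg (geometric-head bound)
    S-bound {f} {L} bound (suc n) = bounded-weaken
      (from-difference (solve 2 (λ L r → (L :+ L) :- (L :+ (L :* r :+ L :* r))
          := L :* (con (+ 1) :- (r :+ r))) R.refl L r)
        (0≤* (bounded-nonneg (geometric-head bound)) (to-difference 2r≤1)))
      (bounded-+ (geometric-head bound) (S-bound (geometric-tail bound) n))

    S-tail : ∀ {f L} → Geometric f L r → ∀ {m n} → m ℕ.≤ n → Bounded (S f n - S f m) ((L R.+ L) R.* (r ^ʳ m))
    S-tail {f} {L} bound {zero} {n} ℕ.z≤n = bounded-resp (sym (minus-zero (S f n)))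
      (bounded-≈ (R.sym (R.*-identityʳ (L R.+ L))) (S-bound bound n))
    S-tail {f} {L} bound {suc m} {suc n} (ℕ.s≤s m≤n) = bounded-resp
      (common-summand (f 0) (S (f ∘ suc) n) (S (f ∘ suc) m))
      (bounded-≈ (solve 3 (λ L r x → (L :* r :+ L :* r) :* x := (L :+ L) :* (r :* x)) R.refl L r (r ^ʳ m))
        (S-tail (geometric-tail bound) m≤n))

  Conv : (ℕ → ℂ) → (ℕ → ℂ) → ℕ → ℂ
  Conv a b m = sum {suc m} (λ k → a (toℕ k) * b (m ℕ.∸ toℕ k))

  -- `Conv a b` is the Cauchy product. Splitting off the terms with `a 0` leaves the Cauchy product
  -- of the tail of `a` with `b`, the recursion that drives `S-product`.
  S-Conv : ∀ a b n → S (Conv a b) (suc n) ≈ a 0 * S b (suc n) + S (Conv (a ∘ suc) b) n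
  S-Conv a b n = begin
    Conv a b 0 + S (λ m → a 0 * b (suc m) + Conv (a ∘ suc) b m) n
      ≈⟨ +-cong (+-identityʳ (a 0 * b 0)) (∑-distrib-+ {n} (λ k → a 0 * b (suc (toℕ k)))
          (λ k → Conv (a ∘ suc) b (toℕ k))) ⟩
    a 0 * b 0 + (S (λ m → a 0 * b (suc m)) n + S (Conv (a ∘ suc) b) n)
      ≈⟨ +-assoc _ _ _ ⟨
    (a 0 * b 0 + S (λ m → a 0 * b (suc m)) n) + S (Conv (a ∘ suc) b) n
      ≈⟨ +-congʳ (sym (trans (distribˡ (a 0) (b 0) _)
          (+-congˡ (*-distribˡ-sum {n} (a 0) (λ k → b (suc (toℕ k))))))) ⟩
    a 0 * S b (suc n) + S (Conv (a ∘ suc) b) n ∎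
    where open SetoidReasoning setoid

  -- The ratios q and 2 q differ so that the errors a₀ (S b M - S b n), each
  -- of size (2 q)ⁿ, sum to a multiple of (2 q)ⁿ.
  module _ {q : ℝ} (0≤q : R.0# ≤ q) (4q≤1 : (q R.+ q) R.+ (q R.+ q) ≤ R.1#) where

    S-product : ∀ {a b K L} → Geometric a K q → Geometric b L (q R.+ q) → ∀ {n m} → n ℕ.≤ m →
                Bounded (S a n * S b m - S (Conv a b) n)
                    ((K R.* ((L R.+ L) R.+ (L R.+ L))) R.* ((q R.+ q) ^ʳ n))
    S-product {a} {b} {K} {L} bound-a bound-b {zero} {m} ℕ.z≤n = bounded-resp
      (sym (trans (+-congʳ (zeroˡ (S b m))) (-‿inverseʳ 0ℂ)))
      (bounded-0 (≤-respʳ (R.sym (R.*-identityʳ _)) (0≤* (bounded-nonneg (geometric-head bound-a))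
          (0≤+ 0≤2L 0≤2L))))
      where
      0≤L = bounded-nonneg (geometric-head bound-b)
      0≤2L = 0≤+ 0≤L 0≤L
    -- The recursion shortens `a` but keeps all `m` terms of `b`, hence two separate lengths.
    S-product {a} {b} {K} {L} bound-a bound-b {suc n} {m} n<m = bounded-resp
      (sym (trans (+-congˡ (-‿cong (S-Conv a b n)))
        (product-error-step (a 0) (S (a ∘ suc) n) (S b (suc n)) (S b m) (S (Conv (a ∘ suc) b) n))))
      (bounded-≈ (solve 4 (λ K L q x → K :* ((L :+ L) :* ((q :+ q) :* x))
          :+ ((K :* q) :* ((L :+ L) :+ (L :+ L))) :* x
                             := (K :* ((L :+ L) :+ (L :+ L))) :* ((q :+ q) :* x)) R.refl K L q
                                 ((q R.+ q) ^ʳ n))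
        (bounded-+ (bounded-* (geometric-head bound-a) (S-tail (0≤+ 0≤q 0≤q) 4q≤1 bound-b n<m))
                   (S-product (geometric-tail bound-a) bound-b (ℕ.<⇒≤ n<m))))

  Null : (ℕ → ℂ) → Set (c ⊔ ℓ₂)
  Null u = ∀ ε → R.0# R.< ε → ∃[ N ] (∀ n → N ℕ.≤ n → Bounded (u n) ε)

  null-resp : ∀ {u v : ℕ → ℂ} → (∀ n → u n ≈ v n) → Null u → Null v
  null-resp u≈v null ε 0<ε = proj₁ (null ε 0<ε) , λ n N≤n → bounded-resp (u≈v n) (proj₂ (null ε 0<ε) n N≤n)

  null-+ : ∀ {u v : ℕ → ℂ} → Null u → Null v → Null (λ n → u n + v n)
  null-+ {u} {v} null-u null-v ε 0<ε =
    let M , bound-u = null-u _ (0<half 0<ε) ; N , bound-v = null-v _ (0<half 0<ε) in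
    M ℕ.+ N , λ n M+N≤n → bounded-≈ (half+half ε)
      (bounded-+ {u n} {v n} (bound-u n (ℕ.≤-trans (ℕ.m≤m+n M N) M+N≤n))
          (bound-v n (ℕ.≤-trans (ℕ.m≤n+m N M) M+N≤n)))

  null-neg : ∀ {u : ℕ → ℂ} → Null u → Null (λ n → - u n)
  null-neg {u} null ε 0<ε = proj₁ (null ε 0<ε) , λ n N≤n → bounded-neg {u n} (proj₂ (null ε 0<ε) n N≤n)

  null-* : ∀ {u v : ℕ → ℂ} m → (∀ n → Bounded (v n) (R.fromℕ m)) → Null u → Null (λ n → v n * u n)
  null-* {u} {v} m bound-v null-u ε 0<ε =
    let N , bound-u = null-u (ε R.* i) (R.*-pos 0<ε (recip-positive (suc m))) in
    N , λ n N≤n → bounded-≈ {v n * u n} product (bounded-* {v n} {u n}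
        (bounded-weaken (fromℕ-mono-≤ (ℕ.n≤1+n m)) (bound-v n)) (bound-u n N≤n))
    where
    i : ℝ
    i = recip (suc m)
    product : R.fromℕ (suc m) R.* (ε R.* i) R.≈ ε
    product = R.trans (solve 3 (λ x ε i → x :* (ε :* i) := ε :* (x :* i)) R.refl (R.fromℕ (suc m)) ε i)
      (R.trans (R.*-congˡ (recip-inverseʳ (suc m))) (R.*-identityʳ ε))

  null-const : ∀ {z} → Null (λ _ → z) → z ≈ 0ℂ
  null-const null = bounded-zero (λ ε 0<ε → proj₂ (null ε 0<ε) _ ℕ.≤-refl)

  ^ʳ-inverse : ∀ D {δ} → R.fromℕ D R.* δ R.≈ R.1# → ∀ k → R.fromℕ (D ℕ.^ k) R.* (δ ^ʳ k) R.≈ R.1#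
  ^ʳ-inverse D Dδ≈1 zero = R.trans (R.*-identityʳ _) fromℕ-1
  ^ʳ-inverse D {δ} Dδ≈1 (suc k) = R.trans (R.*-congʳ (fromℕ-* D (D ℕ.^ k)))
    (R.trans (solve 4 (λ d x δ y → (d :* x) :* (δ :* y) := (d :* δ) :* (x :* y)) R.refl (R.fromℕ D)
        (R.fromℕ (D ℕ.^ k)) δ (δ ^ʳ k))
      (R.trans (R.*-cong Dδ≈1 (^ʳ-inverse D Dδ≈1 k)) (R.*-identityʳ R.1#)))

  ^ʳ-nonneg : ∀ {x} → R.0# ≤ x → ∀ k → R.0# ≤ x ^ʳ k
  ^ʳ-nonneg 0≤x zero    = <⇒≤ 0<1
  ^ʳ-nonneg 0≤x (suc k) = 0≤* 0≤x (^ʳ-nonneg 0≤x k)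

  ^ʳ-positive : ∀ {x} → R.0# R.< x → ∀ k → R.0# R.< x ^ʳ k
  ^ʳ-positive 0<x zero    = 0<1
  ^ʳ-positive 0<x (suc k) = R.*-pos 0<x (^ʳ-positive 0<x k)

  inverse-nonneg : ∀ n .{{_ : ℕ.NonZero n}} {δ} → R.fromℕ n R.* δ R.≈ R.1# → R.0# R.< δ
  inverse-nonneg (suc n) = inverse-positive (0<suc n)

  -- The Archimedean axiom gives `N` above `x / ε`, and `n ≤ 2 ^ n` carries this over to `2 ^ n`.
  half-power-small : ∀ {r} → R.fromℕ 2 R.* r R.≈ R.1# → ∀ x ε → R.0# R.< ε → ∃[ N ]
      (∀ n → N ℕ.≤ n → x R.* (r ^ʳ n) R.< ε)
  half-power-small {r} 2r≈1 x ε 0<ε = let N , x/ε<N = R.archimedean (x R.* invℝ (>⇒# 0<ε)) in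
      N , λ n N≤n → from-difference-< (difference n)
        (R.*-pos (^ʳ-positive (inverse-nonneg 2 2r≈1) n) (to-difference-< (x<ε2ⁿ N x/ε<N n N≤n)))
    where
    x≈ : ε R.* (x R.* invℝ (>⇒# 0<ε)) R.≈ x
    x≈ = R.trans (solve 3 (λ ε x i → ε :* (x :* i) := x :* (ε :* i)) R.refl ε x _)
        (R.trans (R.*-congˡ (invℝ-inverseʳ (>⇒# 0<ε))) (R.*-identityʳ x))
    x<ε2ⁿ : ∀ N → x R.* invℝ (>⇒# 0<ε) R.< R.fromℕ N → ∀ n → N ℕ.≤ n → x R.< ε R.* R.fromℕ (2 ℕ.^ n)
    x<ε2ⁿ N x/ε<N n N≤n = <-≤-trans (<-respˡ-≈ x≈ (*-mono-< 0<ε x/ε<N))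
        (*-mono-≤ (<⇒≤ 0<ε) (fromℕ-mono-≤ (ℕ.≤-trans N≤n (n≤2^n n))))
    difference : ∀ n → ε R.- x R.* (r ^ʳ n) R.≈ (r ^ʳ n) R.* (ε R.* R.fromℕ (2 ℕ.^ n) R.- x)
    difference n = R.trans (R.+-congʳ (R.trans (R.sym (R.*-identityʳ ε))
        (R.*-congˡ (R.sym (^ʳ-inverse 2 2r≈1 n)))))
      (solve 4 (λ ε x y z → ε :* (y :* z) :- x :* z := z :* (ε :* y :- x)) R.refl ε x
          (R.fromℕ (2 ℕ.^ n)) (r ^ʳ n))

  null-geometric : ∀ {r} → R.fromℕ 2 R.* r R.≈ R.1# → ∀ {u x} → (∀ n → Bounded (u n) (x R.* (r ^ʳ n)))
      → Null u
  null-geometric 2r≈1 {x = x} bound ε 0<ε =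
    let N , small = half-power-small 2r≈1 x ε 0<ε in N , λ n N≤n → bounded-weaken (<⇒≤ (small n N≤n)) (bound n)

module ExponentialIdentities {c ℓ : Level} (K : CommutativeRing c ℓ) where
  open CommutativeRing K
  open IntegerEmbedding K using (homomorphism)
  open IntegerSolver K homomorphism

  product-difference : ∀ a b c x y u → x * y - u
      ≈ (- (y * (a - x)) + - (a * (b - y))) + ((a * b - c) + (c - u))
  product-difference = solve 6 (λ a b c x y u → x :* y :- u := (:- (y :* (a :- x))
      :+ :- (a :* (b :- y))) :+ ((a :* b :- c) :+ (c :- u))) refl

  difference-via : ∀ a x y → x - y ≈ - (a - x) + (a - y)
  difference-via = solve 3 (λ a x y → x :- y := :- (a :- x) :+ (a :- y)) refl

  interchange : ∀ x y u v → (x * y) * (u * v) ≈ (x * u) * (y * v)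
  interchange = solve 4 (λ x y u v → (x :* y) :* (u :* v) := (x :* u) :* (y :* v)) refl

  pull-coefficient : ∀ n p f → (n * p) * f ≈ (n * f) * p
  pull-coefficient = solve 3 (λ n p f → (n :* p) :* f := (n :* f) :* p) refl

  remainder : ∀ x y s e → (e - x) - y ≈ - ((x + (y + s)) - e) + s
  remainder = solve 4 (λ x y s e → (e :- x) :- y := :- ((x :+ (y :+ s)) :- e) :+ s) refl

module Exponential {c ℓ₁ ℓ₂ : Level} (R : RealField c ℓ₁ ℓ₂) where
  open Complex R hiding (1#0; 0<1; 0<suc; fromℕ#0; invℝ)
  open ComplexSequences R
  open ExponentialIdentities ℂ-commutativeRing
  open IntegerEmbedding R.commutativeRing using (homomorphism)
  open IntegerSolver R.commutativeRing homomorphism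
  open SemiringSum semiring using (sum-cong-≋; *-distribʳ-sum)
  open Mult semiring using (×-assoc-*; ×-congʳ) renaming (_×_ to _·_)
  open Exp semiring using (^-congˡ)

  F : ℕ → ℝ
  F k = recip (k !) {{k !≢0}}

  F-inverseʳ : ∀ k → R.fromℕ (k !) R.* F k R.≈ R.1#
  F-inverseʳ k = recip-inverseʳ (k !) {{k !≢0}}

  term : ℂ → ℕ → ℂ
  term z k = z ^ k * fromℝ (F k)

  S-term : ∀ z n → expPartialSum z n ≈ S (term z) n
  S-term z n = S-cong {λ k → _/_ (z ^ k) (k !) {{k !≢0}}} {term z} (λ k → *-congˡ {z ^ k}
      (fromℝ-cong (recip-def (k !) {{k !≢0}}))) n

  term-cong : ∀ {z w} → z ≈ w → ∀ k → term z k ≈ term w k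
  term-cong z≈w k = *-congʳ {fromℝ (F k)} (^-congˡ k z≈w)

  ^-bounded : ∀ {z b} → Bounded z b → ∀ k → Bounded (z ^ k) (b ^ʳ k)
  ^-bounded bz zero = bounded-fromℝ (<⇒≤ 0<1)
  ^-bounded {z} bz (suc k) = bounded-* {z} {z ^ k} bz (^-bounded bz k)

  F-positive : ∀ k → R.0# R.< F k
  F-positive k = recip-positive (k !) {{k !≢0}}

  term-bounded : ∀ {z b} → Bounded z b → ∀ k → Bounded (term z k) ((b ^ʳ k) R.* F k)
  term-bounded {z} bz k = bounded-* {z ^ k} {fromℝ (F k)} (^-bounded bz k)
      (bounded-fromℝ (<⇒≤ (F-positive k)))

  scaled-power : ∀ D B {δ} → R.fromℕ D R.* δ R.≈ R.1# → ∀ k → R.fromℕ ((D ℕ.* B) ℕ.^ k) R.* (δ ^ʳ k)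
      R.≈ R.fromℕ B ^ʳ k
  scaled-power D B Dδ≈1 zero = R.trans (R.*-identityʳ _) fromℕ-1
  scaled-power D B {δ} Dδ≈1 (suc k) = R.trans (R.*-congʳ (R.trans (fromℕ-* (D ℕ.* B) ((D ℕ.* B) ℕ.^ k))
      (R.*-congʳ (fromℕ-* D B))))
    (R.trans (solve 5 (λ d b x δ y → ((d :* b) :* x) :* (δ :* y) := (d :* δ) :* (b :* (x :* y))) R.refl
        (R.fromℕ D) (R.fromℕ B) (R.fromℕ ((D ℕ.* B) ℕ.^ k)) δ (δ ^ʳ k))
      (R.trans (R.*-congʳ Dδ≈1) (R.trans (R.*-identityˡ _) (R.*-congˡ (scaled-power D B Dδ≈1 k)))))

  -- `B^k / k!` equals `δ^k (D B)^k / k!`, and `power≤factorial` bounds `(D B)^k / k!` independently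
  -- of `k`. Any ratio `δ = 1 / D` is available, at the cost of the constant.
  term-geometric : ∀ D .{{_ : ℕ.NonZero D}} {δ} → R.fromℕ D R.* δ R.≈ R.1# → ∀ {z} B → Bounded z (R.fromℕ B) →
                   Geometric (term z) (R.fromℕ ((D ℕ.* B) ℕ.^ (D ℕ.* B))) δ
  term-geometric D {δ} Dδ≈1 {z} B bz k = bounded-weaken (from-difference difference
      (0≤* (0≤* (^ʳ-nonneg (<⇒≤ (inverse-nonneg D Dδ≈1)) k) (<⇒≤ (F-positive k))) (to-difference nat)))
    (bounded-≈ {term z k} (R.*-congʳ (R.sym (scaled-power D B Dδ≈1 k))) (term-bounded bz k))
    where
    M = D ℕ.* B
    X = R.fromℕ (M ℕ.^ k)
    Y = δ ^ʳ k
    K = R.fromℕ (M ℕ.^ M)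
    nat : X ≤ K R.* R.fromℕ (k !)
    nat = ≤-respʳ (fromℕ-* (M ℕ.^ M) (k !)) (fromℕ-mono-≤ (power≤factorial M k))
    difference : K R.* Y R.- X R.* Y R.* F k R.≈ (Y R.* F k) R.* (K R.* R.fromℕ (k !) R.- X)
    difference = R.trans (R.+-congʳ (R.trans (R.sym (R.*-identityʳ _)) (R.*-congˡ (R.sym (F-inverseʳ k)))))
      (solve 5 (λ K X Y n f → K :* Y :* (n :* f) :- X :* Y :* f
          := (Y :* f) :* (K :* n :- X)) R.refl K X Y (R.fromℕ (k !)) (F k))

  ·≈fromℝ* : ∀ n z → n · z ≈ fromℝ (R.fromℕ n) * z
  ·≈fromℝ* n z = trans (×-congʳ n (sym (*-identityˡ z))) (trans (sym (×-assoc-* n 1ℂ z))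
      (*-congʳ {z} (sym (fromℕ≈· n))))

  binomial-coefficient : ∀ n k → k ℕ.≤ n → R.fromℕ (n choose k) R.* F n R.≈ F k R.* F (n ℕ.∸ k)
  binomial-coefficient n k k≤n = begin
    c′ R.* F n
      ≈⟨ R.trans (R.*-congˡ (R.*-cong (F-inverseʳ k) (F-inverseʳ (n ℕ.∸ k))))
          (R.trans (R.*-congˡ (R.*-identityʳ _)) (R.*-identityʳ _)) ⟨
    c′ R.* F n R.* ((x R.* F k) R.* (y R.* F (n ℕ.∸ k)))
      ≈⟨ solve 6 (λ c f x f₁ y f₂ → c :* f :* ((x :* f₁) :* (y :* f₂))
          := ((c :* (x :* y)) :* f) :* (f₁ :* f₂)) R.refl c′ (F n) x (F k) y (F (n ℕ.∸ k)) ⟩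
    ((c′ R.* (x R.* y)) R.* F n) R.* (F k R.* F (n ℕ.∸ k))
      ≈⟨ R.*-congʳ (R.*-congʳ (R.trans (R.*-congˡ (R.sym (fromℕ-* (k !) ((n ℕ.∸ k) !))))
          (R.trans (R.sym (fromℕ-* (n choose k) (k ! ℕ.* (n ℕ.∸ k) !)))
           (R.reflexive (≡.cong R.fromℕ (binomial-factorial n k k≤n)))))) ⟩
    (R.fromℕ (n !) R.* F n) R.* (F k R.* F (n ℕ.∸ k))
      ≈⟨ R.trans (R.*-congʳ (F-inverseʳ n)) (R.*-identityˡ _) ⟩
    F k R.* F (n ℕ.∸ k) ∎
    where
    open SetoidReasoning R.setoid
    c′ = R.fromℕ (n choose k)
    x = R.fromℕ (k !)
    y = R.fromℕ ((n ℕ.∸ k) !)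

  -- The binomial theorem divided by `m !`.
  term-+ : ∀ z w m → term (z + w) m ≈ Conv (term z) (term w) m
  term-+ z w m = begin
    (z + w) ^ m * fromℝ (F m)
      ≈⟨ *-congʳ {fromℝ (F m)} (Binomial.theorem commutativeSemiring m z w) ⟩
    sum {suc m} (λ k → (m choose toℕ k) · (z ^ toℕ k * w ^ (m ℕ.∸ toℕ k))) * fromℝ (F m)
      ≈⟨ *-distribʳ-sum {suc m} (fromℝ (F m)) (λ k → (m choose toℕ k) · (z ^ toℕ k * w ^ (m ℕ.∸ toℕ k))) ⟩
    sum {suc m} (λ k → (m choose toℕ k) · (z ^ toℕ k * w ^ (m ℕ.∸ toℕ k)) * fromℝ (F m))
      ≈⟨ sum-cong-≋ {suc m} (λ k → termwise (toℕ k) (ℕ.s≤s⁻¹ (Fin.toℕ<n k))) ⟩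
    Conv (term z) (term w) m ∎
    where
    open SetoidReasoning setoid
    termwise : ∀ k → k ℕ.≤ m → (m choose k) · (z ^ k * w ^ (m ℕ.∸ k)) * fromℝ (F m) ≈ term z k * term w
        (m ℕ.∸ k)
    termwise k k≤m = begin
      (m choose k) · p * fromℝ (F m)                             ≈⟨ *-congʳ {fromℝ (F m)}
          (·≈fromℝ* (m choose k) p) ⟩
      fromℝ (R.fromℕ (m choose k)) * p * fromℝ (F m)             ≈⟨ pull-coefficient
          (fromℝ (R.fromℕ (m choose k))) p (fromℝ (F m)) ⟩
      fromℝ (R.fromℕ (m choose k)) * fromℝ (F m) * p             ≈⟨ *-congʳ {p} coefficient ⟩
      fromℝ (F k) * fromℝ (F (m ℕ.∸ k)) * p                 ≈⟨ *-comm _ p ⟩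
      p * (fromℝ (F k) * fromℝ (F (m ℕ.∸ k)))               ≈⟨ interchange (z ^ k) (w ^ (m ℕ.∸ k))
          (fromℝ (F k)) (fromℝ (F (m ℕ.∸ k))) ⟩
      term z k * term w (m ℕ.∸ k)                           ∎
      where
      p = z ^ k * w ^ (m ℕ.∸ k)
      coefficient : fromℝ (R.fromℕ (m choose k)) * fromℝ (F m) ≈ fromℝ (F k) * fromℝ (F (m ℕ.∸ k))
      coefficient = trans (sym (fromℝ-* (R.fromℕ (m choose k)) (F m)))
          (trans (fromℝ-cong (binomial-coefficient m k k≤m)) (fromℝ-* (F k) (F (m ℕ.∸ k))))

  -- The ratio `q` of `S-product`, where `4 q ≤ 1` holds with equality: the series of `z` gets ratio
  -- 1/4, that of `w` ratio 1/2.
  quarter : ℝ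
  quarter = recip 4

  2*2quarter≈1 : R.fromℕ 2 R.* (quarter R.+ quarter) R.≈ R.1#
  2*2quarter≈1 = R.trans (solve 1 (λ q → (con (+ 1) :+ (con (+ 1) :+ con (+ 0))) :* (q :+ q)
      := (con (+ 1) :+ (con (+ 1) :+ (con (+ 1) :+ (con (+ 1) :+ con (+ 0))))) :* q) R.refl quarter)
      (recip-inverseʳ 4)

  4quarter≤1 : (quarter R.+ quarter) R.+ (quarter R.+ quarter) ≤ R.1#
  4quarter≤1 = ≤-reflexive (R.trans
      (solve 1 (λ q → (q :+ q) :+ (q :+ q)
      := (con (+ 1) :+ (con (+ 1) :+ (con (+ 1) :+ (con (+ 1) :+ con (+ 0))))) :* q) R.refl quarter)
      (recip-inverseʳ 4))

  0≤quarter : R.0# ≤ quarter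
  0≤quarter = <⇒≤ (recip-positive 4)

  S-term-product-null : ∀ z w → Null (λ n → S (term z) n * S (term w) n - S (term (z + w)) n)
  S-term-product-null z w = null-geometric 2*2quarter≈1 {λ n → S (term z) n * S (term w) n - S
      (term (z + w)) n}
    (λ n → bounded-resp (+-congˡ {S (term z) n * S (term w) n} (-‿cong (sym (S-cong (term-+ z w) n))))
      (S-product 0≤quarter 4quarter≤1
        (term-geometric 4 {quarter} (recip-inverseʳ 4) (proj₁ (bounded-by-ℕ z)) (proj₂ (bounded-by-ℕ z)))
        (term-geometric 2 {quarter R.+ quarter} 2*2quarter≈1 (proj₁ (bounded-by-ℕ w))
            (proj₂ (bounded-by-ℕ w))) {n} ℕ.≤-refl))

  S-term-bounded : ∀ z → ∃[ m ] (∀ n → Bounded (S (term z) n) (R.fromℕ m))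
  S-term-bounded z = K ℕ.+ K , λ n → bounded-≈ {S (term z) n} (R.sym (fromℕ-+ K K))
      (S-bound (0≤+ 0≤quarter 0≤quarter) 4quarter≤1
        (term-geometric 2 {quarter R.+ quarter} 2*2quarter≈1 B (proj₂ (bounded-by-ℕ z))) n)
    where
    B = proj₁ (bounded-by-ℕ z)
    K = (2 ℕ.* B) ℕ.^ (2 ℕ.* B)

  conj : ℂ → ℂ
  conj (a +i b) = a +i (R.- b)

  conj-cong : ∀ {z w} → z ≈ w → conj z ≈ conj w
  conj-cong (p , q) = p , R.-‿cong q

  conj-+ : ∀ z w → conj (z + w) ≈ conj z + conj w
  conj-+ (a +i b) (c +i d) = R.refl , solve 2 (λ b d → :- (b :+ d) := :- b :+ :- d) R.refl b d

  conj-* : ∀ z w → conj (z * w) ≈ conj z * conj w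
  conj-* (a +i b) (c +i d) =
    solve 4 (λ a b c d → a :* c :- b :* d := a :* c :- (:- b) :* (:- d)) R.refl a b c d ,
    solve 4 (λ a b c d → :- (a :* d :+ b :* c) := a :* (:- d) :+ (:- b) :* c) R.refl a b c d

  conj-fromℝ : ∀ x → conj (fromℝ x) ≈ fromℝ x
  conj-fromℝ x = R.refl , solve 0 (:- con (+ 0) := con (+ 0)) R.refl

  conj-^ : ∀ z k → conj (z ^ k) ≈ conj z ^ k
  conj-^ z zero    = conj-fromℝ R.1#
  conj-^ z (suc k) = trans (conj-* z (z ^ k)) (*-congˡ {conj z} (conj-^ z k))

  conj-S : ∀ f n → conj (S f n) ≈ S (conj ∘ f) n
  conj-S f zero    = conj-fromℝ R.0#
  conj-S f (suc n) = trans (conj-+ (f 0) (S (f ∘ suc) n)) (+-congˡ {conj (f 0)} (conj-S (f ∘ suc) n))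

  conj-term : ∀ z k → conj (term z k) ≈ term (conj z) k
  conj-term z k = trans (conj-* (z ^ k) (fromℝ (F k))) (*-cong (conj-^ z k) (conj-fromℝ (F k)))

  bounded-conj : ∀ {z b} → Bounded z b → Bounded (conj z) b
  bounded-conj (bounded r s t) = bounded r (absBound-neg s) t

  module _ {exp : ℂ → ℂ} (isExp : IsExponential exp) where

    exp-null : ∀ z → Null (λ n → S (term z) n - exp z)
    exp-null z ε 0<ε =
      let M , re-bound = proj₁ (isExp z) _ (0<half 0<ε) ; N , im-bound = proj₂ (isExp z) _ (0<half 0<ε) in
      M ℕ.+ N , λ n M+N≤n → bounded-resp (+-congʳ {S-neg} (S-term z n))
        (bounded (within (re-bound n (ℕ.≤-trans (ℕ.m≤m+n M N) M+N≤n)))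
            (within (im-bound n (ℕ.≤-trans (ℕ.m≤n+m N M) M+N≤n)))
          (≤-reflexive (half+half ε)))
      where
      S-neg = - exp z
      within : ∀ {x y δ} → R.Within δ x y → AbsBound (x R.- y) δ
      within {x} {y} (p , q) = <⇒≤ p , ≤-respˡ (solve 2 (λ x y → y :- x := :- (x :- y)) R.refl x y) (<⇒≤ q)

    exp-unique : ∀ {z v} → Null (λ n → S (term z) n - v) → exp z ≈ v
    exp-unique {z} {v} null = x∙y⁻¹≈ε⇒x≈y (exp z) v
        (null-const (null-resp (λ n → sym (difference-via (S (term z) n) (exp z) v))
        (null-+ {λ n → - (S (term z) n - exp z)} {λ n → S (term z) n - v}
            (null-neg {λ n → S (term z) n - exp z} (exp-null z)) null)))
      where
      open RingProperties ring using (x∙y⁻¹≈ε⇒x≈y)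

    -- `exp` is given as a bare function; that it respects `_≈_` follows from uniqueness of limits.
    exp-cong : ∀ {z w} → z ≈ w → exp z ≈ exp w
    exp-cong {z} {w} z≈w = exp-unique {z} {exp w}
        (null-resp (λ n → +-congʳ { - exp w} (S-cong (term-cong (sym z≈w)) n)) (exp-null w))

    -- The difference of the two sides is a sum of four null sequences: the errors of the partial
    -- sums at `z`, `w` and `z + w`, the first two with bounded factors, and the Cauchy product
    -- error `S-term-product-null`.
    exp-+ : ∀ z w → exp (z + w) ≈ exp z * exp w
    exp-+ z w = sym (x∙y⁻¹≈ε⇒x≈y (exp z * exp w) (exp (z + w)) (null-const (null-resp
        (λ n → sym (product-difference (E z n) (E w n) (E (z + w) n) (exp z) (exp w) (exp (z + w))))
        (null-+ {λ n → - (exp w * (E z n - exp z)) + - (E z n * (E w n - exp w))} {λ n →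
            (E z n * E w n - E (z + w) n) + (E (z + w) n - exp (z + w))}
          (null-+ {λ n → - (exp w * (E z n - exp z))} {λ n → - (E z n * (E w n - exp w))}
            (null-neg {λ n → exp w * (E z n - exp z)} (null-* {λ n → E z n - exp z} {λ _ → exp w}
                (proj₁ (bounded-by-ℕ (exp w))) (λ _ → proj₂ (bounded-by-ℕ (exp w))) (exp-null z)))
            (null-neg {λ n → E z n * (E w n - exp w)} (null-* {λ n → E w n - exp w} {E z}
                (proj₁ (S-term-bounded z)) (proj₂ (S-term-bounded z)) (exp-null w))))
          (null-+ {λ n → E z n * E w n - E (z + w) n} {λ n → E (z + w) n - exp (z + w)}
              (S-term-product-null z w) (exp-null (z + w)))))))
      where
      open RingProperties ring using (x∙y⁻¹≈ε⇒x≈y)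
      E : ℂ → ℕ → ℂ
      E z = S (term z)

    -- The series has real coefficients, so its partial sums commute with conjugation. Together with
    -- `exp-+` this puts `cis x` on the unit circle without any calculus.
    exp-conj : ∀ z → exp (conj z) ≈ conj (exp z)
    exp-conj z = exp-unique {conj z} {conj (exp z)} (λ ε 0<ε → let N , bound = exp-null z ε 0<ε in
      N , λ n N≤n → bounded-resp (conj-difference n) (bounded-conj (bound n N≤n)))
      where
      conj-difference : ∀ n → conj (S (term z) n - exp z) ≈ S (term (conj z)) n - conj (exp z)
      conj-difference n = trans (conj-+ (S (term z) n) (- exp z))
        (+-congʳ { - conj (exp z)} (trans (conj-S (term z) n) (S-cong (conj-term z) n)))

    exp-0 : exp 0ℂ ≈ 1ℂ
    -- The bound starts at 1: the empty partial sum is 0, all others are 1.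
    exp-0 = exp-unique {0ℂ} {1ℂ} (λ ε 0<ε → 1 , λ { (suc n) (ℕ.s≤s _) → bounded-resp (sym (vanish n)) (bounded-0 (<⇒≤ 0<ε)) })
      where
      F0≈1 : F 0 R.≈ R.1#
      F0≈1 = R.trans (R.sym (R.trans (R.*-congʳ fromℕ-1) (R.*-identityˡ (F 0)))) (F-inverseʳ 0)
      S-zero : ∀ f → (∀ k → f k ≈ 0ℂ) → ∀ n → S f n ≈ 0ℂ
      S-zero f f≈0 zero    = refl
      S-zero f f≈0 (suc n) = trans (+-cong (f≈0 0) (S-zero (f ∘ suc) (λ k → f≈0 (suc k)) n)) (+-identityˡ 0ℂ)
      vanish : ∀ n → S (term 0ℂ) (suc n) - 1ℂ ≈ 0ℂ
      vanish n = trans (+-congʳ { - 1ℂ} (trans (+-cong (trans (*-identityˡ (fromℝ (F 0))) (fromℝ-cong F0≈1))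
          (S-zero (term 0ℂ ∘ suc) (λ k → trans (*-congʳ {fromℝ (F (suc k))} (zeroˡ (0ℂ ^ k)))
              (zeroˡ (fromℝ (F (suc k))))) n)) (+-identityʳ 1ℂ)))
        (-‿inverseʳ 1ℂ)

-- π and roots of unity

module RootOfUnity {c ℓ₁ ℓ₂ : Level} (R : RealField c ℓ₁ ℓ₂) where
  open Complex R hiding (1#0; 0<1; 0<suc; fromℕ#0; invℝ)
  open ComplexSequences R
  open Exponential R
  open ExponentialIdentities ℂ-commutativeRing
  open IntegerEmbedding R.commutativeRing using (homomorphism)
  open IntegerSolver R.commutativeRing homomorphism

  F≤1 : ∀ k → F k ≤ R.1#
  F≤1 k = from-difference (R.trans (R.+-congʳ (R.sym (F-inverseʳ k)))
      (solve 2 (λ n f → n :* f :- f := (n :- con (+ 1)) :* f) R.refl (R.fromℕ (k !)) (F k)))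
    (0≤* (to-difference (≤-respˡ fromℕ-1 (fromℕ-mono-≤ (ℕ.>-nonZero⁻¹ (k !) {{k !≢0}}))))
        (<⇒≤ (F-positive k)))

  term-0 : ∀ z → term z 0 ≈ 1ℂ
  term-0 z = trans (*-identityˡ (fromℝ (F 0)))
      (fromℝ-cong (R.trans (R.sym (R.trans (R.*-congʳ fromℕ-1) (R.*-identityˡ (F 0)))) (F-inverseʳ 0)))

  term-1 : ∀ z → term z 1 ≈ z
  term-1 z = trans (*-cong (*-identityʳ z)
      (fromℝ-cong (R.trans (R.sym (R.trans (R.*-congʳ fromℕ-1) (R.*-identityˡ (F 1)))) (F-inverseʳ 1))))
      (*-identityʳ z)

  -- A point `a + b i` of the unit circle with real part of its square equal to 1. The sign is
  -- decided by cotransitivity: `-1 < a` makes `a + 1` cancellable in `(a - 1) (a + 1) = 0`, and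
  -- `a < 1` makes `a - 1` so.
  square-one : ∀ {a b} → a R.* a R.- b R.* b R.≈ R.1# → a R.* a R.+ b R.* b R.≈ R.1# →
               (a R.≈ R.1# ⊎ a R.≈ R.- R.1#) × b R.≈ R.0#
  square-one {a} {b} diff sum = [
      (λ -1<a → inj₁ (R.trans (solve 1 (λ a → a := (a :- con (+ 1)) :+ con (+ 1)) R.refl a)
                                        (R.trans (R.+-congʳ (zero-product
                                            (R.trans (R.*-comm _ _) factors)
                                            (>⇒# (from-difference-< (solve 1
                                            (λ a → (a :+ con (+ 1)) :- con (+ 0)
                                            := a :- (:- con (+ 1))) R.refl a) (to-difference-< -1<a)))))
                                            (R.+-identityˡ R.1#))))
                                  , (λ a<1 → inj₂ (R.trans (solve 1
                                      (λ a → a := (a :+ con (+ 1)) :- con (+ 1)) R.refl a)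
                                        (R.trans (R.+-congʳ (zero-product factors
                                            (Equivalence.from R.#⇔<> (inj₁
                                            (from-difference-< (solve 1
                                            (λ a → con (+ 0) :- (a :- con (+ 1))
                                            := con (+ 1) :- a) R.refl a) (to-difference-< a<1))))))
                                            (R.+-identityˡ (R.- R.1#))))) ]′
                                  (<-cotrans -1<1 a)
                              , square≈0 b²≈0
    where
    b²≈0 : b R.* b R.≈ R.0#
    b²≈0 = ≤-antisym (λ 0<b² → <-irrefl (R.sym 2b²≈0) (<-respˡ-≈ (R.+-identityˡ R.0#)
        (+-mono-< 0<b² 0<b²))) (0≤square b)
      where
      2b²≈0 : b R.* b R.+ b R.* b R.≈ R.0#
      2b²≈0 = R.trans (solve 2 (λ a b → b :* b :+ b :* b
          := (a :* a :+ b :* b) :- (a :* a :- b :* b)) R.refl a b)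
        (R.trans (R.+-cong sum (R.-‿cong diff)) (R.-‿inverseʳ R.1#))
    factors : (a R.- R.1#) R.* (a R.+ R.1#) R.≈ R.0#
    factors = R.trans (solve 2 (λ a b → (a :- con (+ 1)) :* (a :+ con (+ 1))
        := (a :* a :+ b :* b) :- con (+ 1) :- b :* b) R.refl a b)
      (R.trans (R.+-cong (R.trans (R.+-congʳ sum) (R.-‿inverseʳ R.1#)) (R.-‿cong b²≈0)) (R.-‿inverseʳ R.0#))
    -1<1 : R.- R.1# R.< R.1#
    -1<1 = from-difference-< (solve 0 (con (+ 1) :- (:- con (+ 1)) := con (+ 1) :+ con (+ 1)) R.refl)
        (<-respˡ-≈ (R.+-identityˡ R.0#) (+-mono-< 0<1 0<1))

  square-minus-one : ∀ {a b} → a R.* a R.- b R.* b R.≈ R.- R.1# → a R.* a R.+ b R.* b R.≈ R.1# → a R.≈ R.0#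
  square-minus-one {a} {b} diff sum = square≈0 (≤-antisym (λ 0<a² → <-irrefl (R.sym 2a²≈0)
      (<-respˡ-≈ (R.+-identityˡ R.0#) (+-mono-< 0<a² 0<a²))) (0≤square a))
    where
    2a²≈0 : a R.* a R.+ a R.* a R.≈ R.0#
    2a²≈0 = R.trans (solve 2 (λ a b → a :* a :+ a :* a := (a :* a :- b :* b)
        :+ (a :* a :+ b :* b)) R.refl a b)
      (R.trans (R.+-cong diff sum) (R.-‿inverseˡ R.1#))

  𝕚*fromℝ : ∀ x → 𝕚 * fromℝ x ≈ (R.0# +i x)
  𝕚*fromℝ x = solve 1 (λ x → con (+ 0) :* x :- con (+ 1) :* con (+ 0) := con (+ 0)) R.refl x ,
              solve 1 (λ x → con (+ 0) :* con (+ 0) :+ con (+ 1) :* x := x) R.refl x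

  module _ {exp : ℂ → ℂ} (isExp : IsExponential exp) where

    -- Beyond `1 + z` the terms are dominated by `u² u^k` with `u` at most one half, so they add up
    -- to at most `2 u²`; `δ` is the distance of `v` from the partial sum.
    partial-sum-approximation : ∀ {z u v} → Bounded z u → u R.+ u ≤ R.1# → ∀ {δ} n →
      Bounded (S (term z) (suc (suc n)) - v) δ → Bounded ((v - 1ℂ) - z) (δ R.+ (u R.* u R.+ u R.* u))
    partial-sum-approximation {z} {u} {v} bz 2u≤1 n bound = bounded-resp {w = (v - 1ℂ) - z} rearrange
        (bounded-+ { - (S (term z) (suc (suc n)) - v)} {S (term z ∘ suc ∘ suc) n}
          (bounded-neg {S (term z) (suc (suc n)) - v} bound)
          (bounded-≈ {S (term z ∘ suc ∘ suc) n} (R.+-cong 1uu 1uu)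
              (S-bound (bounded-nonneg bz) 2u≤1 {term z ∘ suc ∘ suc} (geometric-tail {term z ∘ suc}
              (geometric-tail {term z} geometric)) n)))
      where
      1uu : R.1# R.* u R.* u R.≈ u R.* u
      1uu = R.*-congʳ (R.*-identityˡ u)
      geometric : Geometric (term z) R.1# u
      geometric k = bounded-weaken (≤-respʳ (R.trans (R.*-identityʳ _) (R.sym (R.*-identityˡ (u ^ʳ k))))
        (*-mono-≤ (^ʳ-nonneg (bounded-nonneg bz) k) (F≤1 k))) (term-bounded bz k)
      rearrange : - (S (term z) (suc (suc n)) - v) + S (term z ∘ suc ∘ suc) n ≈ (v - 1ℂ) - z
      rearrange = trans (sym (remainder (term z 0) (term z 1) (S (term z ∘ suc ∘ suc) n) v))
        (+-cong (+-congˡ {v} (-‿cong {term z 0} {1ℂ} (term-0 z))) (-‿cong {term z 1} {z} (term-1 z)))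

    exp-linear-approximation : ∀ {z u} → Bounded z u → u R.+ u ≤ R.1# → ∀ ε → R.0# R.< ε →
                               Bounded ((exp z - 1ℂ) - z) (ε R.+ (u R.* u R.+ u R.* u))
    exp-linear-approximation {z} bz 2u≤1 ε 0<ε = let N , bound = exp-null isExp z ε 0<ε in
      partial-sum-approximation {v = exp z} bz 2u≤1 N (bound (suc (suc N)) (ℕ.≤-trans (ℕ.n≤1+n N)
          (ℕ.n≤1+n (suc N))))

    cis : ℝ → ℂ
    cis x = exp (𝕚 * fromℝ x)

    cis-cong : ∀ {x y} → x R.≈ y → cis x ≈ cis y
    cis-cong x≈y = exp-cong isExp (*-congˡ {𝕚} (fromℝ-cong x≈y))

    cis-+ : ∀ x y → cis (x R.+ y) ≈ cis x * cis y
    cis-+ x y = trans (exp-cong isExp (trans (*-congˡ {𝕚} (fromℝ-+ x y)) (distribˡ 𝕚 (fromℝ x)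
        (fromℝ y)))) (exp-+ isExp (𝕚 * fromℝ x) (𝕚 * fromℝ y))

    cis-0 : cis R.0# ≈ 1ℂ
    cis-0 = trans (exp-cong isExp (𝕚*fromℝ R.0#)) (exp-0 isExp)

    cis-neg : ∀ x → cis (R.- x) ≈ conj (cis x)
    cis-neg x = trans (exp-cong isExp (trans (𝕚*fromℝ (R.- x)) (sym (conj-cong (𝕚*fromℝ x)))))
        (exp-conj isExp (𝕚 * fromℝ x))

    cis-norm : ∀ x → re (cis x) R.* re (cis x) R.+ im (cis x) R.* im (cis x) R.≈ R.1#
    cis-norm x = R.trans (solve 2 (λ a b → a :* a :+ b :* b := a :* a :- b :* (:- b)) R.refl
        (re (cis x)) (im (cis x))) (proj₁ unit)
      where
      unit : cis x * conj (cis x) ≈ 1ℂ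
      unit = trans (*-congˡ {cis x} (sym (cis-neg x))) (trans (sym (cis-+ x (R.- x)))
          (trans (cis-cong (R.-‿inverseʳ x)) cis-0))

    -- If `cis u` were 1, the linear approximation would bound `u` by `ε + 2 u²`; with `ε` half of
    -- the positive gap `u - 2 u²` this is less than `u`.
    cis-small : ∀ {u} → R.0# R.< u → u R.+ u R.< R.1# → ¬ (cis u ≈ 1ℂ)
    cis-small {u} 0<u 2u<1 cis≈1 = proj₂ (bounded-im bound) gap
      where
      u² = u R.* u
      δ = u R.- (u² R.+ u²)
      0<δ : R.0# R.< δ
      0<δ = <-respʳ-≈ (solve 1 (λ u → u :* (con (+ 1) :- (u :+ u)) := u :- (u :* u :+ u :* u)) R.refl u)
          (R.*-pos 0<u (to-difference-< 2u<1))
      z = 𝕚 * fromℝ u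
      bz : Bounded z u
      bz = bounded-resp (sym (𝕚*fromℝ u)) (bounded absBound-0 (absBound-self (<⇒≤ 0<u))
          (≤-reflexive (R.+-identityˡ u)))
      ε = δ R.* recip 2
      bound : Bounded (- (R.0# +i u)) (ε R.+ (u² R.+ u²))
      bound = bounded-resp (trans (+-cong (trans (+-congʳ { - 1ℂ} cis≈1) (-‿inverseʳ 1ℂ))
          (-‿cong (𝕚*fromℝ u))) (+-identityˡ (- (R.0# +i u))))
        (exp-linear-approximation bz (<⇒≤ 2u<1) ε (0<half 0<δ))
      gap : ε R.+ (u² R.+ u²) R.< R.- (R.- u)
      gap = from-difference-< (R.trans (solve 3 (λ u v ε → :- (:- u) :- (ε :+ v)
          := (u :- v) :- ε) R.refl u (u² R.+ u²) ε)
        (R.trans (R.+-congʳ (R.sym (half+half δ))) (solve 1 (λ ε → (ε :+ ε) :- ε := ε) R.refl ε)))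
            (0<half 0<δ)

    -- `cis (2 w)` is a square root of 1 on the unit circle. Were it `-1`, then `cis w` would be a
    -- square root of `-1`, with vanishing real part.
    cis-halve : ∀ {w} → ¬ (re (cis w) R.≈ R.0#) → cis ((w R.+ w) R.+ (w R.+ w)) ≈ 1ℂ → cis (w R.+ w) ≈ 1ℂ
    cis-halve {w} cos≉0 cis4w≈1 = [ (λ a≈1 → a≈1 , b≈0) , (λ a≈-1 → ⊥-elim (cos≉0 (square-minus-one
        (R.trans (R.sym (proj₁ (cis-+ w w))) a≈-1) (cis-norm w)))) ]′ (proj₁ cases)
      where
      cases = square-one (R.trans (R.sym (proj₁ (cis-+ (w R.+ w) (w R.+ w)))) (proj₁ cis4w≈1))
          (cis-norm (w R.+ w))
      b≈0 = proj₂ cases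

    module _ {π : ℝ} (isPi : IsPi exp π) where
      open IsPi isPi using (π/2; π/2-positive; cos-π/2≈0; π/2-least)

      -- Four times the `π/2` of which `IsPi` speaks; `2πℝ` identifies it with twice `π`.
      2π : ℝ
      2π = (π/2 R.+ π/2) R.+ (π/2 R.+ π/2)

      -- The cosine vanishes at `π/2`, so the real part of the square, `2 cos² - 1` by the norm, is
      -- `-1`, and the imaginary part `2 cos sin` is 0.
      cis-π : cis (π/2 R.+ π/2) ≈ - 1ℂ
      cis-π = R.trans (proj₁ (cis-+ π/2 π/2))
          (R.trans (solve 2 (λ a b → a :* a :- b :* b := (a :+ a) :* a :- (a :* a :+ b :* b)) R.refl
          (re (cis π/2)) (im (cis π/2)))
                  (R.trans (R.+-cong (R.trans (R.*-congˡ cos-π/2≈0) (R.zeroʳ _))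
                      (R.-‿cong (cis-norm π/2))) (R.+-identityˡ _))) ,
              R.trans (proj₂ (cis-+ π/2 π/2))
                  (R.trans (R.+-cong (R.trans (R.*-congʳ cos-π/2≈0) (R.zeroˡ _))
                  (R.trans (R.*-congˡ cos-π/2≈0) (R.zeroʳ _)))
                  (solve 0 (con (+ 0) :+ con (+ 0) := :- con (+ 0)) R.refl))

      cis-2π : cis 2π ≈ 1ℂ
      cis-2π = trans (cis-+ (π/2 R.+ π/2) (π/2 R.+ π/2)) (trans (*-cong cis-π cis-π)
        (solve 0 (:- con (+ 1) :* :- con (+ 1) :- (:- con (+ 0)) :* (:- con (+ 0)) := con (+ 1)) R.refl ,
         solve 0 (:- con (+ 1) :* :- con (+ 0) :+ (:- con (+ 0)) :* (:- con (+ 1)) := con (+ 0)) R.refl))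

      module _ (p : ℕ) .{{_ : ℕ.NonZero p}} where

        angle : ℝ
        angle = 2π R.* recip p

        ζ : ℂ
        ζ = cis angle

        cis-multiple : ∀ n → cis (R.fromℕ n R.* angle) ≈ ζ ^ n
        cis-multiple zero    = trans (cis-cong (R.zeroˡ angle)) cis-0
        cis-multiple (suc n) = trans (cis-cong (R.trans (R.distribʳ angle R.1# (R.fromℕ n))
            (R.+-congʳ (R.*-identityˡ angle))))
          (trans (cis-+ angle (R.fromℕ n R.* angle)) (*-congˡ {ζ} (cis-multiple n)))

        ζ^p≈1 : ζ ^ p ≈ 1ℂ
        ζ^p≈1 = trans (sym (cis-multiple p)) (trans (cis-cong p*angle) cis-2π)
          where
          p*angle : R.fromℕ p R.* angle R.≈ 2π
          p*angle = R.trans (solve 3 (λ p t r → p :* (t :* r) := t :* (p :* r)) R.refl (R.fromℕ p) 2π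
              (recip p))
            (R.trans (R.*-congˡ (recip-inverseʳ p)) (R.*-identityʳ 2π))

        exp-term : ∀ j → exp (fromℤ (+ 2) * fromℝ π * 𝕚 * fromℤ (+ j) / p) ≈ ζ ^ j
        exp-term j = trans (exp-cong isExp argument) (cis-multiple j)
          where
          h = Complex.invℝ R (fromℕ#0 2)
          2πℝ : R.fromℕ 2 R.* π R.≈ 2π
          2πℝ = R.sym (R.trans (solve 2 (λ π h → ((π :* h :- con (+ 0) :* con (+ 0))
              :+ (π :* h :- con (+ 0) :* con (+ 0))) :+ ((π :* h :- con (+ 0) :* con (+ 0))
              :+ (π :* h :- con (+ 0) :* con (+ 0)))
                    := ((con (+ 1) :+ (con (+ 1) :+ con (+ 0))) :* h) :* ((con (+ 1)
                        :+ (con (+ 1) :+ con (+ 0))) :* π)) R.refl π h)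
                  (R.trans (R.*-congʳ (invℝ-inverseʳ (fromℕ#0 2))) (R.*-identityˡ _)))
          argument : fromℤ (+ 2) * fromℝ π * 𝕚 * fromℤ (+ j) / p ≈ 𝕚 * fromℝ (R.fromℕ j R.* angle)
          argument = begin
            fromℝ (R.fromℕ 2) * fromℝ π * 𝕚 * fromℝ (R.fromℕ j) * fromℝ i
              ≈⟨ *-congʳ {fromℝ i} (*-congʳ {fromℝ (R.fromℕ j)} (*-congʳ {𝕚} (sym (fromℝ-* (R.fromℕ 2) π)))) ⟩
            fromℝ (R.fromℕ 2 R.* π) * 𝕚 * fromℝ (R.fromℕ j) * fromℝ i
              ≈⟨ *-congʳ {fromℝ i} (*-congʳ {fromℝ (R.fromℕ j)} (*-comm (fromℝ (R.fromℕ 2 R.* π)) 𝕚)) ⟩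
            𝕚 * fromℝ (R.fromℕ 2 R.* π) * fromℝ (R.fromℕ j) * fromℝ i
              ≈⟨ *-assoc (𝕚 * fromℝ (R.fromℕ 2 R.* π)) (fromℝ (R.fromℕ j)) (fromℝ i) ⟩
            𝕚 * fromℝ (R.fromℕ 2 R.* π) * (fromℝ (R.fromℕ j) * fromℝ i)
              ≈⟨ *-congˡ {𝕚 * fromℝ (R.fromℕ 2 R.* π)} (sym (fromℝ-* (R.fromℕ j) i)) ⟩
            𝕚 * fromℝ (R.fromℕ 2 R.* π) * fromℝ (R.fromℕ j R.* i)
              ≈⟨ *-assoc 𝕚 (fromℝ (R.fromℕ 2 R.* π)) (fromℝ (R.fromℕ j R.* i)) ⟩
            𝕚 * (fromℝ (R.fromℕ 2 R.* π) * fromℝ (R.fromℕ j R.* i))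
              ≈⟨ *-congˡ {𝕚} (sym (fromℝ-* (R.fromℕ 2 R.* π) (R.fromℕ j R.* i))) ⟩
            𝕚 * fromℝ (R.fromℕ 2 R.* π R.* (R.fromℕ j R.* i))
              ≈⟨ *-congˡ {𝕚} (fromℝ-cong (R.trans (R.*-cong 2πℝ (R.*-congˡ (recip-def p)))
                   (solve 3 (λ t j i → t :* (j :* i) := j :* (t :* i)) R.refl 2π (R.fromℕ j) (recip p)))) ⟩
            𝕚 * fromℝ (R.fromℕ j R.* angle) ∎
            where
            open SetoidReasoning setoid
            i = Complex.invℝ R (fromℕ#0 p)

        -- If ζ were 1, repeated halving of the angle would stay at 1: no square root
        -- on the way can be -1, as the cosine has no zero below π / 2.
        module _ (1<p : 1 ℕ.< p) (ζ≈1 : ζ ≈ 1ℂ) where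

          halved : ℕ → ℝ
          halved zero    = angle
          halved (suc k) = halved k R.* recip 2

          0<halved : ∀ k → R.0# R.< halved k
          0<halved zero    = R.*-pos (+-mono-<₀ (+-mono-<₀ π/2-positive π/2-positive)
              (+-mono-<₀ π/2-positive π/2-positive)) (recip-positive p)
            where
            +-mono-<₀ : ∀ {x y} → R.0# R.< x → R.0# R.< y → R.0# R.< x R.+ y
            +-mono-<₀ 0<x 0<y = <-respˡ-≈ (R.+-identityˡ R.0#) (+-mono-< 0<x 0<y)
          0<halved (suc k) = 0<half (0<halved k)

          -- Two halvings take `angle`, which is `4 (π/2) / p`, to `(π/2) / p`, below `π/2` since
          -- `1 < p`; further halvings only shrink it.
          halved-quarter : ∀ k → halved (suc (suc k)) R.< π/2
          halved-quarter zero = from-difference-< (R.trans (R.+-congˡ (R.-‿cong (R.trans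
                (solve 3 (λ x r h → (((x :+ x) :+ (x :+ x)) :* r) :* h :* h
                    := (x :* r) :* (((con (+ 1) :+ (con (+ 1) :+ con (+ 0))) :* h) :* ((con (+ 1)
                    :+ (con (+ 1) :+ con (+ 0))) :* h))) R.refl π/2 (recip p) (recip 2))
                (R.trans (R.*-congˡ (R.trans (R.*-cong (recip-inverseʳ 2) (recip-inverseʳ 2))
                    (R.*-identityʳ R.1#))) (R.*-identityʳ _)))))
              (solve 2 (λ x r → x :- x :* r := x :* (con (+ 1) :- r)) R.refl π/2 (recip p)))
            (R.*-pos π/2-positive (to-difference-< recip<1))
            where
            recip<1 : recip p R.< R.1#
            recip<1 = from-difference-< (R.trans (R.+-congʳ (R.sym (recip-inverseʳ p)))
                (solve 2 (λ p r → p :* r :- r := r :* (p :- con (+ 1))) R.refl (R.fromℕ p) (recip p)))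
              (R.*-pos (recip-positive p)
                  (to-difference-< (<-≤-trans (<-respˡ-≈ (R.+-identityʳ R.1#) 1+0<2) (fromℕ-mono-≤ 1<p))))
              where
              1+0<2 : R.1# R.+ R.0# R.< R.1# R.+ (R.1# R.+ R.0#)
              1+0<2 = <-respˡ-≈ (R.+-comm R.0# R.1#) (<-respʳ-≈ (R.+-comm (R.1# R.+ R.0#) R.1#)
                  (R.+-monoˡ-< R.1# (0<suc 0)))
          halved-quarter (suc k) = <-trans (shrink (suc (suc k))) (halved-quarter k)
            where
            shrink : ∀ k → halved (suc k) R.< halved k
            shrink k = from-difference-< (R.trans (R.+-congʳ (R.sym (half+half (halved k))))
                (solve 1 (λ h → (h :+ h) :- h := h) R.refl (halved (suc k)))) (0<halved (suc k))

          -- `cis-halve` is applied to the angle two halvings below `halved k`, where the cosine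
          -- cannot vanish.
          cis-halved : ∀ k → cis (halved k) ≈ 1ℂ
          cis-halved zero    = ζ≈1
          cis-halved (suc k) = trans (cis-cong (R.sym (half+half (halved (suc k)))))
            (cis-halve (λ cos≈0 → π/2-least w (0<halved (suc (suc k))) cos≈0 (halved-quarter k))
              (trans (cis-cong (R.trans (R.+-cong (half+half (halved (suc k)))
                  (half+half (halved (suc k)))) (half+half (halved k)))) (cis-halved k)))
            where w = halved (suc (suc k))

          halved≈ : ∀ k → halved k R.≈ angle R.* (recip 2 ^ʳ k)
          halved≈ zero    = R.sym (R.*-identityʳ angle)
          halved≈ (suc k) = R.trans (R.*-congʳ (halved≈ k))
              (solve 3 (λ a x h → (a :* x) :* h := a :* (h :* x)) R.refl angle (recip 2 ^ʳ k) (recip 2))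

          -- Below 1/2, `cis-small` excludes the value 1 that `cis-halved` asserts.
          halved-not-small : ∀ n → ¬ (angle R.* (recip 2 ^ʳ n) R.< R.1# R.* recip 2)
          halved-not-small n small = cis-small (0<halved n) (<-respʳ-≈ (half+half R.1#)
              (+-mono-< lt lt)) (cis-halved n)
            where
            lt : halved n R.< R.1# R.* recip 2
            lt = <-respˡ-≈ (R.sym (halved≈ n)) small

          ζ≈1-absurd : ⊥
          ζ≈1-absurd = halved-not-small (proj₁ eventually) (proj₂ eventually (proj₁ eventually) ℕ.≤-refl)
            where
            eventually : ∃[ N ] (∀ n → N ℕ.≤ n → angle R.* (recip 2 ^ʳ n) R.< R.1# R.* recip 2)
            eventually = half-power-small (recip-inverseʳ 2) angle (R.1# R.* recip 2) (0<half 0<1)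

-- Zeros of the simplest cubic

module SplitCubic {c ℓ : Level} (K : CommutativeRing c ℓ) where
  open CommutativeRing K
  open RingProperties ring using (x∙y⁻¹≈ε⇒x≈y)
  open IntegerEmbedding K using (ι; homomorphism)
  open IntegerSolver K homomorphism
  open SetoidReasoning setoid

  -- Plays the part of apartness from `0#`, as `ℂ` is given no apartness relation.
  Invertible : Carrier → Set _
  Invertible x = ∃[ w ] x * w ≈ 1#

  invertible-factorˡ : ∀ {x y} → Invertible (x * y) → Invertible x
  invertible-factorˡ {x} {y} (w , eq) = y * w , trans (sym (*-assoc x y w)) eq

  invertible-resp : ∀ {x y} → x ≈ y → Invertible x → Invertible y
  invertible-resp x≈y (w , eq) = w , trans (*-congʳ (sym x≈y)) eq

  invertible-factorʳ : ∀ {x y} → Invertible (x * y) → Invertible y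
  invertible-factorʳ {x} {y} = invertible-factorˡ ∘ invertible-resp (*-comm x y)

  cancel-invertible : ∀ {x y} → Invertible x → x * y ≈ 0# → y ≈ 0#
  cancel-invertible {x} {y} (w , xw≈1) xy≈0 = begin
    y               ≈⟨ *-identityˡ y ⟨
    1# * y          ≈⟨ *-congʳ xw≈1 ⟨
    x * w * y       ≈⟨ solve 3 (λ x w y → x :* w :* y := w :* (x :* y)) refl x w y ⟩
    w * (x * y)     ≈⟨ *-congˡ xy≈0 ⟩
    w * 0#          ≈⟨ zeroʳ w ⟩
    0#              ∎

  module _ (local : ∀ x y → Invertible (x - y) → Invertible x ⊎ Invertible y) where

    -- `y - z = (X - z) - (X - y)`, so locality makes one factor invertible, and the other one then
    -- vanishes.
    two-roots : ∀ {X y z} → Invertible (y - z) → (X - y) * (X - z) ≈ 0# → X ≈ y ⊎ X ≈ z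
    two-roots {X} {y} {z} y#z product≈0 = [
        (λ inv → inj₁ (x∙y⁻¹≈ε⇒x≈y X y (cancel-invertible inv (trans (*-comm _ _) product≈0))))
                                          , (λ inv → inj₂ (x∙y⁻¹≈ε⇒x≈y X z
                                              (cancel-invertible inv product≈0))) ]′
      (local (X - z) (X - y) (invertible-resp
          (solve 3 (λ X y z → y :- z := (X :- z) :- (X :- y)) refl X y z) y#z))

    -- Applied to `x - y`, locality finds a factor among `X - x` and `X - y` to cancel, which leaves
    -- the case of two roots.
    three-roots : ∀ (r : Fin 3 → Carrier) →
      Invertible ((r 0F - r 1F) * ((r 1F - r 2F) * (r 0F - r 2F))) →
      ∀ X → (X - r 0F) * ((X - r 1F) * (X - r 2F)) ≈ 0# → ∃[ k ] X ≈ r k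
    three-roots r distinct X product≈0 = [ without-x , without-y ]′
        (local (X - y) (X - x) (invertible-resp
            (solve 3 (λ X x y → x :- y := (X :- y) :- (X :- x)) refl X x y) (invertible-factorˡ distinct)))
      where
      x = r 0F
      y = r 1F
      z = r 2F
      without-x : Invertible (X - y) → ∃[ k ] X ≈ r k
      without-x inv = [ (0F ,_) , (2F ,_) ]′ (two-roots (invertible-factorʳ (invertible-factorʳ distinct))
        (cancel-invertible inv (trans (solve 3 (λ a b c → b :* (a :* c) := a :* (b :* c)) refl (X - x)
            (X - y) (X - z)) product≈0)))
      without-y : Invertible (X - x) → ∃[ k ] X ≈ r k
      without-y inv = [ (1F ,_) , (2F ,_) ]′
          (two-roots (invertible-factorˡ (invertible-factorʳ distinct)) (cancel-invertible inv product≈0))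

    -- An invertible discriminant makes its square root invertible, and with it each difference of
    -- roots.
    factored-zeros : ∀ (f : Carrier → Carrier) (r r′ : Fin 3 → Carrier) → (∀ k → r′ k ≈ r k) →
      (∀ X → (X - r 0F) * ((X - r 1F) * (X - r 2F)) ≈ f X) →
      ∀ {n} → ((r 0F - r 1F) * ((r 1F - r 2F) * (r 0F - r 2F))) * ((r 0F - r 1F) * ((r 1F - r 2F) * (r 0F - r 2F))) ≈ n → Invertible n →
      ∀ X → f X ≈ 0# ⇔ (∃[ k ] X ≈ r′ k)
    factored-zeros f r r′ r′≈r factorisation squared n-invertible X = mk⇔
      (λ fX≈0 → let k , X≈ = three-roots r (invertible-factorˡ (invertible-resp (sym squared) n-invertible)) X (trans (factorisation X) fX≈0) in k , trans X≈ (sym (r′≈r k)))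
      (λ (k , X≈) → trans (sym (factorisation X)) (vanish k (trans X≈ (r′≈r k))))
      where
      X-r≈0 : ∀ {r} → X ≈ r → X - r ≈ 0#
      X-r≈0 {r} X≈r = trans (+-congʳ X≈r) (-‿inverseʳ r)
      vanish : ∀ k → X ≈ r k → (X - r 0F) * ((X - r 1F) * (X - r 2F)) ≈ 0#
      vanish 0F X≈ = trans (*-congʳ (X-r≈0 X≈)) (zeroˡ _)
      vanish 1F X≈ = trans (*-congˡ (trans (*-congʳ (X-r≈0 X≈)) (zeroˡ _))) (zeroʳ _)
      vanish 2F X≈ = trans (*-congˡ (trans (*-congˡ (X-r≈0 X≈)) (zeroʳ _))) (zeroʳ _)

  ι-square-invertible : ∀ n → Invertible (ι n) → Invertible (ι (n ℤ.* n))
  ι-square-invertible n (i , eq) = i * i , trans (*-congʳ (IntegerEmbedding.ι-* K n n))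
    (trans (solve 2 (λ n i → (n :* n) :* (i :* i) := (n :* i) :* (n :* i)) refl (ι n) i)
        (trans (*-cong eq eq) (*-identityˡ 1#)))

module SimplestCubic {c ℓ : Level} (K : CommutativeRing c ℓ) where
  open CommutativeRing K
  open CubicRelations K using (ι; solve; _:+_; _:*_; _:-_; :-_; con; _:=_; _:^_; hom-+; hom-*; hom-neg)
  open Exp semiring using (_^_; ^-congˡ)
  open SetoidReasoning setoid
  open IntegerEmbedding K using (ι-*)

  -- The sum of the roots is `-1`; `e₂` is minus their second symmetric function and `e₃` their
  -- product.
  P : ℤ → ℤ → Carrier → Carrier
  P e₂ e₃ X = X * X * X + X * X - ι e₂ * X - ι e₃

  P-cong : ∀ e₂ e₃ {X Y} → X ≈ Y → P e₂ e₃ X ≈ P e₂ e₃ Y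
  P-cong e₂ e₃ X≈Y = +-congʳ (+-cong (+-cong (*-cong (*-cong X≈Y X≈Y) X≈Y) (*-cong X≈Y X≈Y))
      (-‿cong (*-congˡ X≈Y)))

  -- At `s = 1` this is, up to sign, Shanks' simplest cubic `x³ - h x² - (h + 3) x - 1` with `- x`
  -- for `x`. `H₃` stands for `h + 3`, which `ρ` embeds as a single integer.
  shanks : Carrier → Carrier → Carrier → Carrier → Carrier
  shanks H H₃ s x = x ^ 3 + H * s * x ^ 2 - H₃ * s ^ 2 * x + s ^ 3

  shanks-cong : ∀ {H H′ H₃ H₃′ x x′} s → H ≈ H′ → H₃ ≈ H₃′ → x ≈ x′ → shanks H H₃ s x ≈ shanks H′ H₃′ s x′
  shanks-cong s H≈ H₃≈ x≈ = +-congʳ (+-cong (+-cong (^-congˡ 3 x≈) (*-cong (*-congʳ H≈) (^-congˡ 2 x≈)))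
      (-‿cong (*-cong (*-congʳ H₃≈) x≈)))

  -- After scaling by `s`, the shift `w = X - m` changes the quadratic coefficient `h` to
  -- `h - 3 m = 1`, the one that periods require. In `shanks₂`, `h - 3 m = -1`, and the reflection
  -- `w = - X - m` repairs the sign.
  shanks₁ : ∀ m {h h₃ e₂ e₃} → h ≡ + 1 ℤ.+ m ℤ.* + 3 → h₃ ≡ + 4 ℤ.+ m ℤ.* + 3 →
    e₂ ≡ + 3 ℤ.* (m ℤ.* m) ℤ.+ + 5 ℤ.* m ℤ.+ + 4 →
    e₃ ≡ ℤ.- (+ 2 ℤ.* (m ℤ.* m ℤ.* m) ℤ.+ + 4 ℤ.* (m ℤ.* m) ℤ.+ + 4 ℤ.* m ℤ.+ + 1) →
    ∀ s w → shanks (ι h) (ι h₃) s (s * w) ≈ s ^ 3 * P e₂ e₃ (w + ι m)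
  shanks₁ m {e₂ = e₂} {e₃} ≡.refl ≡.refl e₂≡ e₃≡ s w = begin
    shanks (ι (+ 1 ℤ.+ m ℤ.* + 3)) (ι (+ 4 ℤ.+ m ℤ.* + 3)) s (s * w)
      ≈⟨ shanks-cong s (hom-+ (+ 1) (m ℤ.* + 3) refl (ι-* m (+ 3))) (hom-+ (+ 4) (m ℤ.* + 3) refl
          (ι-* m (+ 3))) refl ⟩
    shanks (ι (+ 1) + μ * ι (+ 3)) (ι (+ 4) + μ * ι (+ 3)) s (s * w)
      ≈⟨ solve 3 (λ s w μ → let H = con (+ 1) :+ μ :* con (+ 3) ; H₃ = con (+ 4) :+ μ :* con (+ 3) ; x = s :* w ; X = w :+ μ in
           x :^ 3 :+ H :* s :* x :^ 2 :- H₃ :* s :^ 2 :* x :+ s :^ 3 :=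
           s :^ 3 :* (X :* X :* X :+ X :* X :- (con (+ 3) :* (μ :* μ) :+ con (+ 5) :* μ :+ con (+ 4)) :* X
             :- (:- (con (+ 2) :* (μ :* μ :* μ) :+ con (+ 4) :* (μ :* μ) :+ con (+ 4) :* μ
                 :+ con (+ 1))))) refl s w μ ⟩
    s ^ 3 * _
      ≈⟨ *-congˡ (+-cong (+-congˡ (-‿cong (*-congʳ e₂≈))) (-‿cong e₃≈)) ⟨
    s ^ 3 * P e₂ e₃ (w + ι m) ∎
    where
    μ = ι m
    e₂≈ : ι e₂ ≈ ι (+ 3) * (μ * μ) + ι (+ 5) * μ + ι (+ 4)
    e₂≈ = trans (reflexive (≡.cong ι e₂≡)) (hom-+ (+ 3 ℤ.* (m ℤ.* m) ℤ.+ + 5 ℤ.* m) (+ 4)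
      (hom-+ (+ 3 ℤ.* (m ℤ.* m)) (+ 5 ℤ.* m) (hom-* (+ 3) (m ℤ.* m) refl (ι-* m m)) (ι-* (+ 5) m)) refl)
    e₃≈ : ι e₃ ≈ - (ι (+ 2) * (μ * μ * μ) + ι (+ 4) * (μ * μ) + ι (+ 4) * μ + ι (+ 1))
    e₃≈ = trans (reflexive (≡.cong ι e₃≡)) (hom-neg (+ 2 ℤ.* (m ℤ.* m ℤ.* m) ℤ.+ + 4 ℤ.* (m ℤ.* m)
        ℤ.+ + 4 ℤ.* m ℤ.+ + 1)
      (hom-+ (+ 2 ℤ.* (m ℤ.* m ℤ.* m) ℤ.+ + 4 ℤ.* (m ℤ.* m) ℤ.+ + 4 ℤ.* m) (+ 1)
        (hom-+ (+ 2 ℤ.* (m ℤ.* m ℤ.* m) ℤ.+ + 4 ℤ.* (m ℤ.* m)) (+ 4 ℤ.* m)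
          (hom-+ (+ 2 ℤ.* (m ℤ.* m ℤ.* m)) (+ 4 ℤ.* (m ℤ.* m)) (hom-* (+ 2) (m ℤ.* m ℤ.* m) refl
              (hom-* (m ℤ.* m) m (ι-* m m) refl)) (hom-* (+ 4) (m ℤ.* m) refl (ι-* m m)))
          (ι-* (+ 4) m)) refl))

  shanks₂ : ∀ m {h h₃ e₂ e₃} → h ≡ m ℤ.* + 3 ℤ.- + 1 → h₃ ≡ m ℤ.* + 3 ℤ.+ + 2 →
    e₂ ≡ + 3 ℤ.* (m ℤ.* m) ℤ.+ m ℤ.+ + 2 →
    e₃ ≡ + 2 ℤ.* (m ℤ.* m ℤ.* m) ℤ.+ + 2 ℤ.* (m ℤ.* m) ℤ.+ + 2 ℤ.* m ℤ.+ + 1 →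
    ∀ s w → shanks (ι h) (ι h₃) s (s * w) ≈ - (s ^ 3) * P e₂ e₃ (- w - ι m)
  shanks₂ m {e₂ = e₂} {e₃} ≡.refl ≡.refl e₂≡ e₃≡ s w = begin
    shanks (ι (m ℤ.* + 3 ℤ.- + 1)) (ι (m ℤ.* + 3 ℤ.+ + 2)) s (s * w)
      ≈⟨ shanks-cong s (hom-+ (m ℤ.* + 3) (ℤ.- + 1) (ι-* m (+ 3)) refl) (hom-+ (m ℤ.* + 3) (+ 2)
          (ι-* m (+ 3)) refl) refl ⟩
    shanks (μ * ι (+ 3) - ι (+ 1)) (μ * ι (+ 3) + ι (+ 2)) s (s * w)
      ≈⟨ solve 3 (λ s w μ → let H = μ :* con (+ 3) :- con (+ 1) ; H₃ = μ :* con (+ 3) :+ con (+ 2) ; x = s :* w ; X = :- w :- μ in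
           x :^ 3 :+ H :* s :* x :^ 2 :- H₃ :* s :^ 2 :* x :+ s :^ 3 :=
           (:- (s :^ 3)) :* (X :* X :* X :+ X :* X :- (con (+ 3) :* (μ :* μ) :+ μ :+ con (+ 2)) :* X
             :- (con (+ 2) :* (μ :* μ :* μ) :+ con (+ 2) :* (μ :* μ) :+ con (+ 2) :* μ
                 :+ con (+ 1)))) refl s w μ ⟩
    - (s ^ 3) * _
      ≈⟨ *-congˡ (+-cong (+-congˡ (-‿cong (*-congʳ e₂≈))) (-‿cong e₃≈)) ⟨
    - (s ^ 3) * P e₂ e₃ (- w - ι m) ∎
    where
    μ = ι m
    e₂≈ : ι e₂ ≈ ι (+ 3) * (μ * μ) + μ + ι (+ 2)
    e₂≈ = trans (reflexive (≡.cong ι e₂≡)) (hom-+ (+ 3 ℤ.* (m ℤ.* m) ℤ.+ m) (+ 2)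
      (hom-+ (+ 3 ℤ.* (m ℤ.* m)) m (hom-* (+ 3) (m ℤ.* m) refl (ι-* m m)) refl) refl)
    e₃≈ : ι e₃ ≈ ι (+ 2) * (μ * μ * μ) + ι (+ 2) * (μ * μ) + ι (+ 2) * μ + ι (+ 1)
    e₃≈ = trans (reflexive (≡.cong ι e₃≡)) (hom-+ (+ 2 ℤ.* (m ℤ.* m ℤ.* m) ℤ.+ + 2 ℤ.* (m ℤ.* m)
        ℤ.+ + 2 ℤ.* m) (+ 1)
      (hom-+ (+ 2 ℤ.* (m ℤ.* m ℤ.* m) ℤ.+ + 2 ℤ.* (m ℤ.* m)) (+ 2 ℤ.* m)
        (hom-+ (+ 2 ℤ.* (m ℤ.* m ℤ.* m)) (+ 2 ℤ.* (m ℤ.* m)) (hom-* (+ 2) (m ℤ.* m ℤ.* m) refl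
            (hom-* (m ℤ.* m) m (ι-* m m) refl)) (hom-* (+ 2) (m ℤ.* m) refl (ι-* m m)))
        (ι-* (+ 2) m)) refl)

  polynomial₁ : ∀ {e₂ e₃ a b} y → a ≈ ι e₂ → b ≈ ι (ℤ.- e₃) → y ^ 3 + y ^ 2 - a * y + b ≈ P e₂ e₃ y
  polynomial₁ {e₂} {e₃} {a} {b} y a≈ b≈ = trans (+-cong (+-congˡ (-‿cong (*-congʳ a≈)))
      (trans b≈ (hom-neg e₃ refl)))
    (solve 3 (λ y a e → y :^ 3 :+ y :^ 2 :- a :* y :+ :- e := y :* y :* y
        :+ y :* y :- a :* y :- e) refl y (ι e₂) (ι e₃))

  polynomial₂ : ∀ {e₂ e₃ a b} y → a ≈ ι e₂ → b ≈ ι e₃ → y ^ 3 + y ^ 2 - a * y - b ≈ P e₂ e₃ y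
  polynomial₂ {e₂} {e₃} y a≈ b≈ = trans (+-cong (+-congˡ (-‿cong (*-congʳ a≈))) (-‿cong b≈))
    (solve 3 (λ y a e → y :^ 3 :+ y :^ 2 :- a :* y :- e := y :* y :* y :+ y :* y :- a :* y :- e) refl y
        (ι e₂) (ι e₃))

  open SplitCubic K using (Invertible; cancel-invertible)

  substitute-zeros : ∀ {f g : Carrier → Carrier} {a} (Y γ : Carrier → Carrier) (r : Fin 3 → Carrier) →
    Invertible a → (∀ x → f x ≈ a * g (Y x)) → (∀ {x y} → Y x ≈ y → x ≈ γ y) → (∀ {x y} → x ≈ γ y → Y x ≈ y) →
    (∀ X → g X ≈ 0# ⇔ (∃[ k ] X ≈ r k)) → ∀ x → f x ≈ 0# ⇔ (∃[ k ] x ≈ γ (r k))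
  substitute-zeros Y γ r a-invertible f≈ to from zeros x = mk⇔
    (λ fx≈0 → let k , Y≈ = Equivalence.to (zeros (Y x)) (cancel-invertible a-invertible (trans (sym (f≈ x)) fx≈0)) in k , to Y≈)
    (λ (k , x≈) → trans (f≈ x) (trans (*-congˡ (Equivalence.from (zeros (Y x)) (k , from x≈))) (zeroʳ _)))

  module _ {s t third : Carrier} (st≈1 : s * t ≈ 1#) (third≈ : ι (+ 3) * third ≈ 1#) where

    scale : ∀ x → s * (x * t) ≈ x
    scale x = trans (solve 3 (λ s t x → s :* (x :* t) := (s :* t) :* x) refl s t x)
        (trans (*-congʳ st≈1) (*-identityˡ x))

    cube-invertible : Invertible (s ^ 3)
    cube-invertible = t ^ 3 , trans (solve 2 (λ s t → s :^ 3 :* t :^ 3 := (s :* t) :^ 3) refl s t)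
        (trans (^-congˡ 3 st≈1) (solve 0 (con (+ 1) :^ 3 := con (+ 1)) refl))

    neg-cube-invertible : Invertible (- (s ^ 3))
    neg-cube-invertible = - proj₁ cube-invertible , trans (solve 2 (λ a b → :- a :* :- b := a :* b) refl
        (s ^ 3) (t ^ 3)) (proj₂ cube-invertible)

    γ₁-simplify : ∀ {a b μ} y → a ≈ ι (+ 3) * μ → b ≈ ι (+ 3) → - third * s * (a - b * y) ≈ s * (y - μ)
    γ₁-simplify {μ = μ} y a≈ b≈ = trans (*-congˡ (+-cong a≈ (-‿cong (*-congʳ b≈))))
      (trans (solve 4 (λ th s μ y → (:- th) :* s :* (con (+ 3) :* μ :- con (+ 3) :* y)
          := (con (+ 3) :* th) :* (s :* (y :- μ))) refl third s μ y)
        (trans (*-congʳ third≈) (*-identityˡ _)))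

    γ₂-simplify : ∀ {a b μ} y → a ≈ ι (+ 3) * μ → b ≈ ι (+ 3) → - third * s * (a + b * y) ≈ s * (- y - μ)
    γ₂-simplify {μ = μ} y a≈ b≈ = trans (*-congˡ (+-cong a≈ (*-congʳ b≈)))
      (trans (solve 4 (λ th s μ y → (:- th) :* s :* (con (+ 3) :* μ :+ con (+ 3) :* y)
          := (con (+ 3) :* th) :* (s :* (:- y :- μ))) refl third s μ y)
        (trans (*-congʳ third≈) (*-identityˡ _)))

    -- This and the three lemmas below say that `γ₁` and `γ₂` invert `θ₁` and `θ₂`.
    solve-θ₁ : ∀ {μ x y} → x * t + μ ≈ y → x ≈ s * (y - μ)
    solve-θ₁ {μ} {x} {y} eq = sym
        (trans (*-congˡ (trans (+-congʳ (sym eq)) (solve 2 (λ w μ → w :+ μ :- μ := w) refl (x * t) μ)))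
        (scale x))

    unsolve-θ₁ : ∀ {μ x y} → x ≈ s * (y - μ) → x * t + μ ≈ y
    unsolve-θ₁ {μ} {x} {y} eq = trans
        (+-congʳ (trans (*-congʳ eq)
        (trans (solve 4 (λ s t y μ → s :* (y :- μ) :* t := (s :* t) :* (y :- μ)) refl s t y μ)
        (trans (*-congʳ st≈1) (*-identityˡ _)))))
      (solve 2 (λ y μ → y :- μ :+ μ := y) refl y μ)

    solve-θ₂ : ∀ {μ x y} → - (x * t) - μ ≈ y → x ≈ s * (- y - μ)
    solve-θ₂ {μ} {x} {y} eq = sym
        (trans (*-congˡ (trans (+-congʳ (-‿cong (sym eq)))
        (solve 2 (λ w μ → :- (:- w :- μ) :- μ := w) refl (x * t) μ))) (scale x))

    unsolve-θ₂ : ∀ {μ x y} → x ≈ s * (- y - μ) → - (x * t) - μ ≈ y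
    unsolve-θ₂ {μ} {x} {y} eq = trans
        (+-congʳ (-‿cong (trans (*-congʳ eq)
        (trans (solve 4 (λ s t y μ → s :* (:- y :- μ) :* t := (s :* t) :* (:- y :- μ)) refl s t y μ)
        (trans (*-congʳ st≈1) (*-identityˡ _))))))
      (solve 2 (λ y μ → :- (:- y :- μ) :- μ := y) refl y μ)

-- A primitive cube root of unity modulo p

module CubeRootOfUnity {p : ℕ} (p-prime : Prime p) where
  open import Data.Integer.Base using (_+_; _*_; _-_; -_)
  open PrimeField p-prime
  open +-*-Solver

  -- ω = h / 3, since 3 k = p - 1 makes - k the inverse of 3.
  module _ (h k : ℤ) (p≡ : + p ≡ h * h + + 3 * h + + 9) (p≡′ : + p ≡ + 1 + + 3 * k) where

    ωℤ : ℤ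
    ωℤ = - (h * k)

    ω : Fin p
    ω = red ωℤ

    -- Subtracting `k² (h² + 3 h + 9)` from the left side leaves `- (k h + 3 k - 1) (3 k + 1)`, and
    -- both `h² + 3 h + 9` and `3 k + 1` are `p`.
    ωℤ-root : ωℤ * ωℤ + ωℤ + + 1 ≡ + 0 + (k * k - k * h - + p + + 2) * + p
    ωℤ-root = ≡.trans (solve 2 (λ h k → let ω = :- (h :* k) ; p = con (+ 1) :+ con (+ 3) :* k in
        ω :* ω :+ ω :+ con (+ 1) := con (+ 0) :+ (k :* k :* (h :* h :+ con (+ 3) :* h :+ con (+ 9))
            :+ (:- (k :* h) :- p :+ con (+ 2)) :* p)) ≡.refl h k)
      (≡.trans (≡.cong₂ (λ p p′ → + 0 + (k * k * p + (- (k * h) - p′ + + 2) * p′)) (≡.sym p≡) (≡.sym p≡′))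
        (solve 3 (λ h k p → con (+ 0) :+ (k :* k :* p :+ (:- (k :* h) :- p :+ con (+ 2)) :* p)
            := con (+ 0) :+ (k :* k :- k :* h :- p :+ con (+ 2)) :* p) ≡.refl h k (+ p)))

    ω-root : ω ⊗ ω ⊕ ω ⊕ 1ₚ ≡ 0ₚ
    ω-root = ≡.trans (≡.sym (≡.trans (red-⊕ (ωℤ * ωℤ + ωℤ) (+ 1))
        (≡.cong (_⊕ 1ₚ) (≡.trans (red-⊕ (ωℤ * ωℤ) ωℤ) (≡.cong (_⊕ ω) (red-⊗ ωℤ ωℤ))))))
      (red-cong (ωℤ * ωℤ + ωℤ + + 1) (+ 0) (k * k - k * h - + p + + 2) ωℤ-root)

module GeometricIdentities {c ℓ : Level} (K : CommutativeRing c ℓ) where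
  open CommutativeRing K
  open IntegerEmbedding K using (homomorphism)
  open IntegerSolver K homomorphism

  step : ∀ ζ s z → (ζ - 1#) * s ≈ z - 1# → (ζ - 1#) * (1# + ζ * s) ≈ ζ * z - 1#
  step ζ s z eq = trans (solve 2 (λ ζ s → (ζ :- con (+ 1)) :* (con (+ 1) :+ ζ :* s) := ζ :- con (+ 1)
      :+ ζ :* ((ζ :- con (+ 1)) :* s)) refl ζ s)
    (trans (+-congˡ (*-congˡ eq)) (solve 2 (λ ζ z → ζ :- con (+ 1) :+ ζ :* (z :- con (+ 1))
        := ζ :* z :- con (+ 1)) refl ζ z))

-- Invertible complex numbers and sums of roots of unity

module ComplexField {c ℓ₁ ℓ₂ : Level} (R : RealField c ℓ₁ ℓ₂) where
  open Complex R hiding (1#0; 0<1; 0<suc; fromℕ#0; invℝ)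
  open ComplexSequences R
  open SplitCubic ℂ-commutativeRing public
  open IntegerEmbedding R.commutativeRing using (homomorphism)
  open IntegerSolver R.commutativeRing homomorphism
  open RingProperties ring using (x∙y⁻¹≈ε⇒x≈y)

  positive-norm⇒invertible : ∀ a b → R.0# R.< a R.* a R.+ b R.* b → Invertible (a +i b)
  positive-norm⇒invertible a b 0<n = (a R.* i) +i (R.- (b R.* i)) ,
      R.trans (solve 3 (λ a b i → a :* (a :* i) :- b :* (:- (b :* i))
          := (a :* a :+ b :* b) :* i) R.refl a b i) (invℝ-inverseʳ (>⇒# 0<n)) ,
      solve 3 (λ a b i → a :* (:- (b :* i)) :+ b :* (a :* i) := con (+ 0)) R.refl a b i
    where i = invℝ (>⇒# 0<n)

  square-positive : ∀ {a} → a # 0ℝ → R.0# R.< a R.* a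
  square-positive {a} a#0 = [ (λ a<0 → ⊥-elim (0≤square a a<0)) , (λ 0<a → 0<a) ]′
      (Equivalence.to R.#⇔<> a²#0)
    where
    a²#0 : (a R.* a) # 0ℝ
    a²#0 = invertibleʳ⇒# (i R.* i , R.trans (R.*-congʳ (x-0≈x (a R.* a)))
      (R.trans (solve 2 (λ a i → (a :* a) :* (i :* i) := (a :* i) :* (a :* i)) R.refl a i)
          (R.trans (R.*-cong (invℝ-inverseʳ a#0) (invℝ-inverseʳ a#0)) (R.*-identityʳ R.1#))))
      where i = invℝ a#0

  re#0⇒invertible : ∀ {z} → re z # 0ℝ → Invertible z
  re#0⇒invertible {a +i b} a#0 = positive-norm⇒invertible a b
      (<-≤-trans (<-respʳ-≈ (R.sym (R.+-identityʳ _)) (square-positive a#0))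
      (+-mono-≤ (≤-reflexive R.refl) (0≤square b)))

  im#0⇒invertible : ∀ {z} → im z # 0ℝ → Invertible z
  im#0⇒invertible {a +i b} b#0 = positive-norm⇒invertible a b
      (<-≤-trans (<-respʳ-≈ (R.sym (R.+-identityˡ _)) (square-positive b#0)) (+-mono-≤ (0≤square a)
      (≤-reflexive R.refl)))

  #-split : ∀ {x y} → (x R.- y) # 0ℝ → x # 0ℝ ⊎ y # 0ℝ
  #-split {x} {y} x-y#0 = Sum.map₂ R.#-sym (R.#-cotrans x#y R.0#)
    where
    x#y : x # y
    x#y = R.invertible⇒# (proj₁ inv , R.trans (R.*-congˡ (R.sym (x-0≈x (x R.- y)))) (proj₁ (proj₂ inv))
        , R.trans (R.*-congʳ (R.sym (x-0≈x (x R.- y)))) (proj₂ (proj₂ inv)))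
      where inv = R.#⇒invertible x-y#0

  -- The product with the inverse has real part `a d - b e = 1`, so one of `a d` and `b e` is apart
  -- from 0.
  invertible⇒#0 : ∀ {z} → Invertible z → re z # 0ℝ ⊎ im z # 0ℝ
  invertible⇒#0 {a +i b} ((d +i e) , eq , _) = Sum.map #0-factorˡ #0-factorˡ
      (#-split (#-congʳ (R.sym eq) 1#0))

  -- Some component of `z - w` is apart from 0, and cotransitivity passes this on to that component
  -- of `z` or of `w`.
  local : ∀ z w → Invertible (z - w) → Invertible z ⊎ Invertible w
  local z w inv = [ (λ r → Sum.map re#0⇒invertible re#0⇒invertible (#-split r)) ,
      (λ i → Sum.map im#0⇒invertible im#0⇒invertible (#-split i)) ]′
    (invertible⇒#0 {z - w} inv)

  not-invertible⇒≈0 : ∀ {z} → ¬ Invertible z → z ≈ 0ℂ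
  not-invertible⇒≈0 {z} ¬inv = #-reflect (¬inv ∘ re#0⇒invertible) , #-reflect (¬inv ∘ im#0⇒invertible)

  fromℤ≈0⇒≡0 : ∀ n → fromℤ n ≈ 0ℂ → n ≡ + 0
  fromℤ≈0⇒≡0 (+ zero)  _ = ≡.refl
  fromℤ≈0⇒≡0 (+ suc n) (eq , _) = ⊥-elim (<-irrefl (R.sym eq) (0<suc n))
  fromℤ≈0⇒≡0 -[1+ n ]  (eq , _) = ⊥-elim
      (<-irrefl (R.sym (R.trans (solve 1 (λ x → x := :- (:- x)) R.refl (R.fromℕ (suc n)))
    (R.trans (R.-‿cong eq) (solve 0 (:- con (+ 0) := con (+ 0)) R.refl)))) (0<suc n))

  ι-injective : ∀ {m n} → ι m ≈ ι n → m ≡ n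
  ι-injective {m} {n} eq = ℤ.i-j≡0⇒i≡j m n (fromℤ≈0⇒≡0 (m ℤ.- n) (trans (fromℤ≈ι (m ℤ.- n))
    (trans (ℂι.ι-+ m (ℤ.- n)) (trans (+-cong eq (ℂι.ι-neg n)) (-‿inverseʳ (ι n))))))

  ι-nonzero-invertible : ∀ n .{{_ : ℕ.NonZero n}} → Invertible (ι (+ n))
  ι-nonzero-invertible n = 1ℂ / n , fromℕ*/ n 1ℂ

  open Exp semiring using (^-homo-*; ^-assocʳ; ^-congˡ)

  1^n≈1 : ∀ n → 1ℂ ^ n ≈ 1ℂ
  1^n≈1 zero    = refl
  1^n≈1 (suc n) = trans (*-identityˡ (1ℂ ^ n)) (1^n≈1 n)

  ^-mod : ∀ {ζ} p .{{_ : ℕ.NonZero p}} → ζ ^ p ≈ 1ℂ → ∀ n → ζ ^ (n ℕ.% p) ≈ ζ ^ n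
  ^-mod {ζ} p ζ^p≈1 n = sym (begin
    ζ ^ n                                       ≡⟨ ≡.cong (ζ ^_) (m≡m%n+[m/n]*n n p) ⟩
    ζ ^ (n ℕ.% p ℕ.+ n ℕ./ p ℕ.* p)             ≈⟨ ^-homo-* ζ (n ℕ.% p) (n ℕ./ p ℕ.* p) ⟩
    ζ ^ (n ℕ.% p) * ζ ^ (n ℕ./ p ℕ.* p)         ≡⟨ ≡.cong (λ k → ζ ^ (n ℕ.% p) * ζ ^ k)
        (ℕ.*-comm (n ℕ./ p) p) ⟩
    ζ ^ (n ℕ.% p) * ζ ^ (p ℕ.* (n ℕ./ p))       ≈⟨ *-congˡ {ζ ^ (n ℕ.% p)} (^-assocʳ ζ p (n ℕ./ p)) ⟨
    ζ ^ (n ℕ.% p) * (ζ ^ p) ^ (n ℕ./ p)         ≈⟨ *-congˡ {ζ ^ (n ℕ.% p)}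
        (trans (^-congˡ (n ℕ./ p) ζ^p≈1) (1^n≈1 (n ℕ./ p))) ⟩
    ζ ^ (n ℕ.% p) * 1ℂ                          ≈⟨ *-identityʳ _ ⟩
    ζ ^ (n ℕ.% p)                               ∎)
    where open SetoidReasoning setoid

  open SemiringSum semiring using (*-distribˡ-sum)

  geometric-sum : ∀ ζ n → (ζ - 1ℂ) * S (ζ ^_) n ≈ ζ ^ n - 1ℂ
  geometric-sum ζ zero    = trans (zeroʳ (ζ - 1ℂ)) (sym (-‿inverseʳ 1ℂ))
  geometric-sum ζ (suc n) = begin
    (ζ - 1ℂ) * (1ℂ + S (λ k → ζ * ζ ^ k) n)
      ≈⟨ *-congˡ {ζ - 1ℂ} (+-congˡ {1ℂ} (*-distribˡ-sum {n} ζ (λ k → ζ ^ toℕ k))) ⟨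
    (ζ - 1ℂ) * (1ℂ + ζ * S (ζ ^_) n)
      ≈⟨ GeometricIdentities.step ℂ-commutativeRing ζ (S (ζ ^_) n) (ζ ^ n) (geometric-sum ζ n) ⟩
    ζ * ζ ^ n - 1ℂ ∎
    where open SetoidReasoning setoid

  -- `ζ ≉ 1` is a mere negation and does not make `ζ - 1` invertible. Instead, an invertible sum
  -- would force `ζ = 1`, so the sum is not invertible, and tightness of the apartness makes it 0.
  roots-of-unity-sum : ∀ {ζ} p → ζ ^ p ≈ 1ℂ → ¬ (ζ ≈ 1ℂ) → S (ζ ^_) p ≈ 0ℂ
  roots-of-unity-sum {ζ} p ζ^p≈1 ζ≉1 = not-invertible⇒≈0
      (λ inv → ζ≉1 (x∙y⁻¹≈ε⇒x≈y ζ 1ℂ (cancel-invertible {S (ζ ^_) p} {ζ - 1ℂ} inv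
    (trans (*-comm (S (ζ ^_) p) (ζ - 1ℂ)) (trans (geometric-sum ζ p) (trans (+-congʳ { - 1ℂ} ζ^p≈1)
        (-‿inverseʳ 1ℂ)))))))

-- The Gaussian periods as roots of the cubic

module ComplexPeriods {c ℓ₁ ℓ₂ : Level} (R : RealField c ℓ₁ ℓ₂)
  {exp : Complex.ℂ R → Complex.ℂ R} (isExp : Complex.IsExponential R exp)
  {π : RealField.ℝ R} (isPi : Complex.IsPi R exp π)
  {p : ℕ} (p-prime : Prime p) (C : Fin 3 → Subset p) (cosets : IsCubicCosets p-prime C)
  (ω : Fin p) (ω-root : PrimeField.IsPrimitiveCubeRoot p-prime ω) where
  open PrimeField p-prime
  open Complex R hiding (1#0; 0<1; 0<suc; fromℕ#0; invℝ)
  open ComplexSequences R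
  open ComplexField R
  open RootOfUnity R using (exp-term; ζ^p≈1; ζ≈1-absurd)
  open CubicCosets p-prime C cosets ω ω-root using (coset?)
  open Periods p-prime C cosets ω ω-root
  open InSemiring commutativeSemiring
  open Exp semiring using (^-homo-*)
  open SemiringSum semiring using (sum-cong-≋)
  open CubicRelations ℂ-commutativeRing using (module Integrality)
  open SimplestCubic ℂ-commutativeRing using (P)

  η : Fin 3 → ℂ
  η = cubicPeriods exp π p-prime C

  ζ : ℂ
  ζ = RootOfUnity.ζ R isExp isPi p

  ψ : Fin p → ℂ
  ψ j = ζ ^ toℕ j

  ψ-⊕ : ∀ x y → ψ (x ⊕ y) ≈ ψ x * ψ y
  ψ-⊕ x y = trans (reflexive (≡.cong (ζ ^_) (toℕ-⊕ x y)))
      (trans (^-mod p (ζ^p≈1 isExp isPi p) (toℕ x ℕ.+ toℕ y)) (^-homo-* ζ (toℕ x) (toℕ y)))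

  η≈period : ∀ k → η k ≈ period ψ k
  η≈period k = sum-cong-≋ {p} (λ j → if-cong (coset? k j) (exp-term isExp isPi p (toℕ j)))

  sum-of-η : 1ℂ + (period ψ 0F + (period ψ 1F + period ψ 2F)) ≈ 0ℂ
  sum-of-η = trans (sym (sum-of-periods ψ (reflexive (≡.cong (ζ ^_) toℕ-0ₚ))))
    (roots-of-unity-sum p (ζ^p≈1 isExp isPi p) (ζ≈1-absurd isExp isPi p
        (ℕ.nonTrivial⇒n>1 p {{prime⇒nonTrivial p-prime}})))

  module PeriodRelations = Integrality (λ {m} {n} → ι-injective {m} {n}) {1ℂ / 3} (fromℕ*/ 3 1ℂ)
    {period ψ 0F} {period ψ 1F} {period ψ 2F} {N 0F} {N 1F} {N 2F} {card} {p}
    (period-product ψ ψ-⊕ 0F) (period-product ψ ψ-⊕ 1F) (period-product ψ ψ-⊕ 2F)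
    sum-of-η N-sum 3card+1≡p p-prime

  zeros : ∀ e₂ e₃ → PeriodRelations.PeriodEquation e₂ e₃ → ∀ X → P e₂ e₃ X ≈ 0ℂ ⇔ (∃[ k ] X ≈ η k)
  zeros e₂ e₃ (factorisation , squared) = factored-zeros local (P e₂ e₃)
      (period ψ) η η≈period factorisation squared
    (ι-square-invertible (+ p) (ι-nonzero-invertible p))

-- The substitutions h = 3 m + 1 and h = 3 m - 1

module Parametrisation where
  open import Data.Integer.Base using (_+_; _*_; _-_; -_)
  open +-*-Solver

  residue₁ : ∀ h → h %ℕ 3 ≡ 1 → h ≡ + 1 + (h ℤ./ℕ 3) * + 3
  residue₁ h eq = ≡.trans (ℤ.a≡a%ℕn+[a/ℕn]*n h 3) (≡.cong (λ r → + r + (h ℤ./ℕ 3) * + 3) eq)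

  -- Here `m` is one more than the quotient, so that `(h + 1) / 3`, the shift in `θ₂`, is `m`.
  residue₂ : ∀ h → h %ℕ 3 ≡ 2 → h ≡ (h ℤ./ℕ 3 + + 1) * + 3 - + 1
  residue₂ h eq = ≡.trans (ℤ.a≡a%ℕn+[a/ℕn]*n h 3) (≡.trans (≡.cong (λ r → + r + (h ℤ./ℕ 3) * + 3) eq)
    (solve 1 (λ q → con (+ 2) :+ q :* con (+ 3) := (q :+ con (+ 1)) :* con (+ 3) :- con (+ 1)) ≡.refl
        (h ℤ./ℕ 3)))

  expand-square : ∀ h → h ℤ.^ 2 + + 3 * h + + 9 ≡ h * h + + 3 * h + + 9
  expand-square h = ≡.cong (λ z → h * z + + 3 * h + + 9) (ℤ.*-identityʳ h)

  module _ (m : ℤ) where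

    e₂₁ e₃₁ e₂₂ e₃₂ : ℤ
    e₂₁ = + 3 * (m * m) + + 5 * m + + 4
    e₃₁ = - (+ 2 * (m * m * m) + + 4 * (m * m) + + 4 * m + + 1)
    e₂₂ = + 3 * (m * m) + m + + 2
    e₃₂ = + 2 * (m * m * m) + + 2 * (m * m) + + 2 * m + + 1

    module Case₁ {h p : ℤ} (h≡ : h ≡ + 1 + m * + 3) (p≡ : p ≡ h * h + + 3 * h + + 9) where

      p≡₁ : p ≡ + 9 * (m * m) + + 15 * m + + 13
      p≡₁ = ≡.trans p≡ (≡.trans (≡.cong (λ h → h * h + + 3 * h + + 9) h≡)
        (solve 1 (λ m → let h = con (+ 1) :+ m :* con (+ 3) in h :* h :+ con (+ 3) :* h :+ con (+ 9) := con (+ 9) :* (m :* m) :+ con (+ 15) :* m :+ con (+ 13)) ≡.refl m))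

      h+3≡ : h + + 3 ≡ + 4 + m * + 3
      h+3≡ = ≡.trans (≡.cong (_+ + 3) h≡) (solve 1 (λ m → con (+ 1) :+ m :* con (+ 3) :+ con (+ 3)
          := con (+ 4) :+ m :* con (+ 3)) ≡.refl m)

      h-1≡ : h - + 1 ≡ + 3 * m
      h-1≡ = ≡.trans (≡.cong (_- + 1) h≡) (solve 1 (λ m → con (+ 1) :+ m :* con (+ 3) :- con (+ 1)
          := con (+ 3) :* m) ≡.refl m)

      p≡1+3e₂ : p ≡ + 1 + + 3 * e₂₁
      p≡1+3e₂ = ≡.trans p≡₁ (CyclotomicIdentities.third-of-p-1₁ m)

      p-1≡ : p - + 1 ≡ + 3 * e₂₁
      p-1≡ = ≡.trans (≡.cong (_- + 1) p≡1+3e₂) (solve 1 (λ e → con (+ 1) :+ con (+ 3) :* e :- con (+ 1)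
          := con (+ 3) :* e) ≡.refl e₂₁)

      constant≡ : + 2 * h * p + + 1 ≡ + 27 * (- e₃₁)
      constant≡ = ≡.trans (≡.cong₂ (λ h p → + 2 * h * p + + 1) h≡ p≡₁)
        (solve 1 (λ m → con (+ 2) :* (con (+ 1) :+ m :* con (+ 3)) :* (con (+ 9) :* (m :* m)
            :+ con (+ 15) :* m :+ con (+ 13)) :+ con (+ 1) :=
          con (+ 27) :* (:- (:- (con (+ 2) :* (m :* m :* m) :+ con (+ 4) :* (m :* m) :+ con (+ 4) :* m
              :+ con (+ 1))))) ≡.refl m)

    module Case₂ {h p : ℤ} (h≡ : h ≡ m * + 3 - + 1) (p≡ : p ≡ h * h + + 3 * h + + 9) where

      p≡₂ : p ≡ + 9 * (m * m) + + 3 * m + + 7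
      p≡₂ = ≡.trans p≡ (≡.trans (≡.cong (λ h → h * h + + 3 * h + + 9) h≡)
        (solve 1 (λ m → let h = m :* con (+ 3) :- con (+ 1) in h :* h :+ con (+ 3) :* h :+ con (+ 9) := con (+ 9) :* (m :* m) :+ con (+ 3) :* m :+ con (+ 7)) ≡.refl m))

      h+3≡ : h + + 3 ≡ m * + 3 + + 2
      h+3≡ = ≡.trans (≡.cong (_+ + 3) h≡) (solve 1 (λ m → m :* con (+ 3) :- con (+ 1) :+ con (+ 3)
          := m :* con (+ 3) :+ con (+ 2)) ≡.refl m)

      h+1≡ : h + + 1 ≡ + 3 * m
      h+1≡ = ≡.trans (≡.cong (_+ + 1) h≡) (solve 1 (λ m → m :* con (+ 3) :- con (+ 1) :+ con (+ 1)
          := con (+ 3) :* m) ≡.refl m)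

      p≡1+3e₂ : p ≡ + 1 + + 3 * e₂₂
      p≡1+3e₂ = ≡.trans p≡₂ (CyclotomicIdentities.third-of-p-1₂ m)

      p-1≡ : p - + 1 ≡ + 3 * e₂₂
      p-1≡ = ≡.trans (≡.cong (_- + 1) p≡1+3e₂) (solve 1 (λ e → con (+ 1) :+ con (+ 3) :* e :- con (+ 1)
          := con (+ 3) :* e) ≡.refl e₂₂)

      constant≡ : (+ 6 + + 2 * h) * p - + 1 ≡ + 27 * e₃₂
      constant≡ = ≡.trans (≡.cong₂ (λ h p → (+ 6 + + 2 * h) * p - + 1) h≡ p≡₂)
        (solve 1 (λ m → (con (+ 6)
            :+ con (+ 2) :* (m :* con (+ 3) :- con (+ 1))) :* (con (+ 9) :* (m :* m) :+ con (+ 3) :* m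
            :+ con (+ 7)) :- con (+ 1) :=
          con (+ 27) :* (con (+ 2) :* (m :* m :* m) :+ con (+ 2) :* (m :* m) :+ con (+ 2) :* m
              :+ con (+ 1))) ≡.refl m)

-- The zeros of ρ and its expression through the two cubics

module ShanksZeros {c ℓ₁ ℓ₂ : Level} (R : RealField c ℓ₁ ℓ₂) where
  open Complex R hiding (1#0; 0<1; 0<suc; fromℕ#0; invℝ)
  open ComplexRing R
  open SimplestCubic ℂ-commutativeRing
  open Parametrisation

  divide : ∀ n .{{_ : ℕ.NonZero n}} {a b} → a ≡ + n ℤ.* b → fromℤ a / n ≈ ι b
  divide n {a} {b} a≡ = begin
    fromℤ a * i                     ≈⟨ *-congʳ {i} (trans (fromℤ≈ι a) (trans (reflexive (≡.cong ι a≡))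
        (trans (ℂι.ι-* (+ n) b) (*-comm (ι (+ n)) (ι b))))) ⟩
    ι b * ι (+ n) * i               ≈⟨ *-assoc (ι b) (ι (+ n)) i ⟩
    ι b * (ι (+ n) * i)             ≈⟨ *-congˡ {ι b} (trans (*-congʳ {i} (sym (fromℤ≈ι (+ n))))
        (fromℝ-inverseʳ (Complex.fromℕ#0 R n))) ⟩
    ι b * 1ℂ                        ≈⟨ *-identityʳ (ι b) ⟩
    ι b                             ∎
    where
    open SetoidReasoning setoid
    i = fromℝ (Complex.invℝ R (Complex.fromℕ#0 R n))

  triple : ∀ {a b} → a ≡ + 3 ℤ.* b → fromℤ a ≈ ι (+ 3) * ι b
  triple {a} {b} a≡ = trans (fromℤ≈ι a) (trans (reflexive (≡.cong ι a≡)) (ℂι.ι-* (+ 3) b))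

  module _ {h : ℤ} {p : ℕ} (p≡ : + p ≡ h ℤ.* h ℤ.+ + 3 ℤ.* h ℤ.+ + 9) {s : ℝ} (s#0 : s # 0ℝ) where

    σ t : ℂ
    σ = fromℝ s
    t = fromℝ (Complex.invℝ R s#0)

    σt≈1 : σ * t ≈ 1ℂ
    σt≈1 = fromℝ-inverseʳ s#0

    third≈ : ι (+ 3) * (1ℂ / 3) ≈ 1ℂ
    third≈ = fromℕ*/ 3 1ℂ

    module _ {m : ℤ} (h≡ : h ≡ + 1 ℤ.+ m ℤ.* + 3) where
      open Case₁ m {h} {+ p} h≡ p≡

      ρ≈₁ : ∀ x → ρ h s x ≈ σ ^ 3 * P (e₂₁ m) (e₃₁ m) (x * t + ι m)
      ρ≈₁ x = trans (shanks-cong σ (fromℤ≈ι h) (fromℤ≈ι (h ℤ.+ + 3)) (sym (scale σt≈1 third≈ x)))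
        (shanks₁ m h≡ h+3≡ ≡.refl ≡.refl σ (x * t))

      θ₁≈ : ∀ x → θ₁ h s#0 x ≈ x * t + ι m
      θ₁≈ x = +-congˡ {x * t} (divide 3 h-1≡)

      -- Purely algebraic: both sides are `σ ^ 3` times `P` at `x * t + ι m`.
      ρ≈G₁ : ∀ x → ρ h s x ≈ σ ^ 3 * G₁ p h (θ₁ h s#0 x)
      ρ≈G₁ x = trans (ρ≈₁ x) (*-congˡ {σ ^ 3} (sym (trans
        (polynomial₁ {e₂₁ m} {e₃₁ m} (θ₁ h s#0 x) (divide 3 p-1≡) (divide 27 constant≡))
            (P-cong (e₂₁ m) (e₃₁ m) (θ₁≈ x)))))

      zeros-ρ₁ : ∀ (η : Fin 3 → ℂ) → (∀ X → P (e₂₁ m) (e₃₁ m) X ≈ 0ℂ ⇔ (∃[ k ] X ≈ η k)) → ZerosAre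
          (ρ h s) (λ k → γ₁ h s (η k))
      zeros-ρ₁ η zeros = substitute-zeros {ρ h s} {P (e₂₁ m) (e₃₁ m)} (λ x → x * t + ι m) (γ₁ h s) η
        (cube-invertible σt≈1 third≈) ρ≈₁
        (λ {x} {y} eq → trans (solve-θ₁ σt≈1 third≈ eq) (sym (γ₁≈ y)))
        (λ {x} {y} eq → unsolve-θ₁ σt≈1 third≈ (trans eq (γ₁≈ y))) zeros
        where
        γ₁≈ : ∀ y → γ₁ h s y ≈ σ * (y - ι m)
        γ₁≈ y = γ₁-simplify σt≈1 third≈ y (triple h-1≡) (fromℤ≈ι (+ 3))

    module _ {m : ℤ} (h≡ : h ≡ m ℤ.* + 3 ℤ.- + 1) where
      open Case₂ m {h} {+ p} h≡ p≡

      ρ≈₂ : ∀ x → ρ h s x ≈ - (σ ^ 3) * P (e₂₂ m) (e₃₂ m) (- (x * t) - ι m)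
      ρ≈₂ x = trans (shanks-cong σ (fromℤ≈ι h) (fromℤ≈ι (h ℤ.+ + 3)) (sym (scale σt≈1 third≈ x)))
        (shanks₂ m h≡ h+3≡ ≡.refl ≡.refl σ (x * t))

      θ₂≈ : ∀ x → θ₂ h s#0 x ≈ - (x * t) - ι m
      θ₂≈ x = +-congˡ { - (x * t)} (-‿cong (divide 3 h+1≡))

      ρ≈G₂ : ∀ x → ρ h s x ≈ - (σ ^ 3) * G₂ p h (θ₂ h s#0 x)
      ρ≈G₂ x = trans (ρ≈₂ x) (*-congˡ { - (σ ^ 3)} (sym (trans
        (polynomial₂ {e₂₂ m} {e₃₂ m} (θ₂ h s#0 x) (divide 3 p-1≡) (divide 27 constant≡))
            (P-cong (e₂₂ m) (e₃₂ m) (θ₂≈ x)))))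

      zeros-ρ₂ : ∀ (η : Fin 3 → ℂ) → (∀ X → P (e₂₂ m) (e₃₂ m) X ≈ 0ℂ ⇔ (∃[ k ] X ≈ η k)) → ZerosAre
          (ρ h s) (λ k → γ₂ h s (η k))
      zeros-ρ₂ η zeros = substitute-zeros {ρ h s} {P (e₂₂ m) (e₃₂ m)} (λ x → - (x * t) - ι m) (γ₂ h s) η
        (neg-cube-invertible σt≈1 third≈) ρ≈₂
        (λ {x} {y} eq → trans (solve-θ₂ σt≈1 third≈ eq) (sym (γ₂≈ y)))
        (λ {x} {y} eq → unsolve-θ₂ σt≈1 third≈ (trans eq (γ₂≈ y))) zeros
        where
        γ₂≈ : ∀ y → γ₂ h s y ≈ σ * (- y - ι m)
        γ₂≈ y = γ₂-simplify σt≈1 third≈ y (triple h+1≡) (fromℤ≈ι (+ 3))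

  module PeriodZeros {exp : ℂ → ℂ} (isExp : IsExponential exp) {π : ℝ} (isPi : IsPi exp π)
    {p : ℕ} (p-prime : Prime p) (C : Fin 3 → Subset p) (cosets : IsCubicCosets p-prime C)
    (h : ℤ) (p≡ : + p ≡ h ℤ.* h ℤ.+ + 3 ℤ.* h ℤ.+ + 9) where

    η : Fin 3 → ℂ
    η = cubicPeriods exp π p-prime C

    η-zeros₁ : ∀ {m} → h ≡ + 1 ℤ.+ m ℤ.* + 3 → ∀ X → P (e₂₁ m) (e₃₁ m) X ≈ 0ℂ ⇔ (∃[ k ] X ≈ η k)
    η-zeros₁ {m} h≡ = zeros (e₂₁ m) (e₃₁ m) (PeriodRelations.period-equation₁ m p≡₁)
      where
      open Case₁ m {h} {+ p} h≡ p≡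
      open CubeRootOfUnity p-prime
      open ComplexPeriods R isExp isPi p-prime C cosets (ω h (e₂₁ m) p≡ p≡1+3e₂) (ω-root h (e₂₁ m) p≡ p≡1+3e₂)

    η-zeros₂ : ∀ {m} → h ≡ m ℤ.* + 3 ℤ.- + 1 → ∀ X → P (e₂₂ m) (e₃₂ m) X ≈ 0ℂ ⇔ (∃[ k ] X ≈ η k)
    η-zeros₂ {m} h≡ = zeros (e₂₂ m) (e₃₂ m) (PeriodRelations.period-equation₂ m p≡₂)
      where
      open Case₂ m {h} {+ p} h≡ p≡
      open CubeRootOfUnity p-prime
      open ComplexPeriods R isExp isPi p-prime C cosets (ω h (e₂₂ m) p≡ p≡1+3e₂) (ω-root h (e₂₂ m) p≡ p≡1+3e₂)

theorem18 : ∀ {c ℓ₁ ℓ₂ : Level} (R : RealField c ℓ₁ ℓ₂) → let open Complex R in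
    (h : ℤ) → ¬ (+ 3 ∣ h) →
    (p : ℕ) → + p ≡ h ℤ.^ 2 ℤ.+ + 3 ℤ.* h ℤ.+ + 9 → (p-prime : Prime p) →
    (s : ℝ) (s#0 : s # 0ℝ) →
    ((exp : ℂ → ℂ) → IsExponential exp →
    (π : ℝ) → IsPi exp π →
    (C : Fin 3 → Subset p) → IsCubicCosets p-prime C →
    let η = cubicPeriods exp π p-prime C in
    (h %ℕ 3 ≡ 1 → ZerosAre (ρ h s) (λ k → γ₁ h s (η k))) ×
    (h %ℕ 3 ≡ 2 → ZerosAre (ρ h s) (λ k → γ₂ h s (η k))))
    ×
    (h %ℕ 3 ≡ 1 → ∀ x → ρ h s x ≈ fromℝ s ^ 3 * G₁ p h (θ₁ h s#0 x)) ×
    (h %ℕ 3 ≡ 2 → ∀ x → ρ h s x ≈ - (fromℝ s ^ 3) * G₂ p h (θ₂ h s#0 x))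
theorem18 R h _ p p≡h^2 p-prime s s#0 =
    (λ exp isExp π isPi C cosets →
      (λ h≡1 → zeros-ρ₁ {h} {p} p≡ s#0 {h ℤ./ℕ 3} (residue₁ h h≡1) (cubicPeriods exp π p-prime C)
                 (PeriodZeros.η-zeros₁ isExp isPi p-prime C cosets h p≡ {h ℤ./ℕ 3} (residue₁ h h≡1))) ,
      (λ h≡2 → zeros-ρ₂ {h} {p} p≡ s#0 {h ℤ./ℕ 3 ℤ.+ + 1} (residue₂ h h≡2) (cubicPeriods exp π p-prime C)
                 (PeriodZeros.η-zeros₂ isExp isPi p-prime C cosets h p≡ {h ℤ./ℕ 3 ℤ.+ + 1}
                     (residue₂ h h≡2)))) ,
    (λ h≡1 → ρ≈G₁ {h} {p} p≡ s#0 {h ℤ./ℕ 3} (residue₁ h h≡1)) ,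
    (λ h≡2 → ρ≈G₂ {h} {p} p≡ s#0 {h ℤ./ℕ 3 ℤ.+ + 1} (residue₂ h h≡2))
  where
  open Complex R using (cubicPeriods)
  open Parametrisation
  open ShanksZeros R
  p≡ : + p ≡ h ℤ.* h ℤ.+ + 3 ℤ.* h ℤ.+ + 9
  p≡ = ≡.trans p≡h^2 (expand-square h)
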